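{- Let $p<q$ be primes. For every positive integer $b$, $$\mathrm{B}(pq^b)=\begin{cases}2, & \text{if } p=2,\\ 3\cdot 2^{\left[\frac{b-1}{2}\right]}, & \text{if } p=3.\end{cases}$$
   Context: The height $\mathrm{H}(f)$ of a polynomial $f\in\mathbb{Z}[x]$ is the largest absolute value of its coefficients. For a positive integer $n$, $\mathrm{B}(n):=\max\{\mathrm{H}(f) : f\in\mathbb{Z}[x],\ f \mid x^{n}-1\}$. $[y]$ denotes the greatest integer not exceeding $y$. -}

module Defs where

open import Algebra.Bundles.Raw using (RawMagma)
import Algebra.Definitions.RawMagma as Divisibility
open import Data.Integer as ℤ using (ℤ; 0ℤ; 1ℤ; -1ℤ; ∣_∣)
open import Data.List using (List; []; _∷_; _++_; [_]; map; foldr; replicate)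
open import Data.Nat using (ℕ; zero; suc; _≤_; _⊔_)
open import Data.Product using (_×_; ∃-syntax)
open import Level using (0ℓ)
open import Relation.Binary.PropositionalEquality using (_≡_)
open import Relation.Unary using (Pred)

infix  4 _≈_
infixl 6 _+_
infixl 7 _*_

-- A polynomial over ℤ is a list of coefficients, constant term first.
-- Trailing zeros are allowed, so polynomials are compared with _≈_.
Poly : Set
Poly = List ℤ

coeff : Poly → ℕ → ℤ
coeff []      _       = 0ℤ
coeff (a ∷ f) zero    = a
coeff (a ∷ f) (suc i) = coeff f i

_≈_ : Poly → Poly → Set
f ≈ g = ∀ i → coeff f i ≡ coeff g i

_+_ : Poly → Poly → Poly
[]      + g       = g
(a ∷ f) + []      = a ∷ f
(a ∷ f) + (b ∷ g) = (a ℤ.+ b) ∷ (f + g)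

-- (a + x f) g = a g + x (f g)
_*_ : Poly → Poly → Poly
[]      * g = []
(a ∷ f) * g = map (a ℤ.*_) g + (0ℤ ∷ f * g)

*-rawMagma : RawMagma 0ℓ 0ℓ
*-rawMagma = record { Carrier = Poly ; _≈_ = _≈_ ; _∙_ = _*_ }

-- f ∣ g unfolds to a record packing a quotient h with a proof of h * f ≈ g.
open Divisibility *-rawMagma public using (_∣_)

x^_ : ℕ → Poly
x^ n = replicate n 0ℤ ++ [ 1ℤ ]

xⁿ-1 : ℕ → Poly
xⁿ-1 n = (x^ n) + [ -1ℤ ]

-- Trailing zeros do not affect the height, so H respects _≈_.
H : Poly → ℕ
H f = foldr _⊔_ 0 (map ∣_∣ f)

DivisorHeight : ℕ → Pred ℕ 0ℓ
DivisorHeight n k = ∃[ f ] (f ∣ xⁿ-1 n × H f ≡ k)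

IsMax : Pred ℕ 0ℓ → ℕ → Set
IsMax P m = P m × (∀ k → P k → k ≤ m)

-- B[ n ]≡ m says that the maximum defining B(n) is attained and equals m.
-- It is a relation, as a maximum over a set of naturals given by a predicate
-- is not a total operation; by antisymmetry of ≤, m is determined by n.
B[_]≡_ : ℕ → ℕ → Set
B[ n ]≡ m = IsMax (DivisorHeight n) m

{-# OPTIONS --safe #-}
module Submission where

open import Defs using (B[_]≡_)
open import Data.Nat using (ℕ; _*_; _^_; _∸_; _/_; _<_; _≤_)
open import Data.Nat.Primality using (Prime)
open import Data.Product using (_×_)
open import Relation.Binary.PropositionalEquality using (_≡_)

open import Defs using (Poly; coeff; _≈_; H; x^_; xⁿ-1) renaming (_+_ to infixl 6 _⊕_; _*_ to infixl 7 _⊗_)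
open import Algebra.Bundles using (CommutativeRing)
open import Algebra.Definitions.RawMagma using (_,_)
import Algebra.Solver.Ring as RingSolver
open import Algebra.Solver.Ring.AlmostCommutativeRing using (AlmostCommutativeRing; fromCommutativeRing; _-Raw-AlmostCommutative⟶_)
open import Data.Empty using (⊥-elim)
open import Data.Fin as Fin using (Fin; zero; suc; toℕ; fromℕ; inject₁)
import Data.Fin.Properties as Fin
open import Data.Integer as ℤ using (ℤ; +_; -[1+_]; 0ℤ; 1ℤ; -1ℤ)
open import Data.Integer.Divisibility.Signed as ℤ using () renaming (_∣_ to infix 4 _∣ᶻ_; divides to dividesᶻ; _∣?_ to _∣ᶻ?_)
import Data.Integer.Properties as ℤ
open import Data.Integer.Tactic.RingSolver using (solve-∀)
open import Data.List using (List; []; _∷_; _++_; map; length; replicate; reverse)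
import Data.List.Properties as List
open import Data.List.Relation.Unary.All as All using (All; []; _∷_)
import Data.List.Relation.Unary.All.Properties as AllP
open import Data.Maybe using (Maybe; just; nothing)
open import Data.Nat as ℕ using (zero; suc; z≤n; s≤s)
import Data.Nat.Combinatorics as Comb
open import Data.Nat.Divisibility using (_∣_; divides; ∣⇒≤)
open import Data.Nat.DivMod using (_%_; m≡m%n+[m/n]*n; m%n<n; m/n≡1+[m∸n]/n)
open import Data.Nat.Primality using (euclidsLemma; prime⇒irreducible; ¬prime[0]; ¬prime[1])
import Data.Nat.Properties as ℕ
open import Data.Product using (_,_; ∃-syntax; proj₁; proj₂)
open import Data.Sum using (_⊎_; inj₁; inj₂; [_,_]′)
open import Level using (0ℓ)
open import Relation.Binary.Definitions using (tri<; tri≈; tri>)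
open import Relation.Binary.PropositionalEquality as ≡ using (_≢_; refl; cong; cong₂; subst)
open import Relation.Nullary using (¬_; Dec; yes; no; contradiction)

-- By reciprocity and an Eisenstein argument at q, a divisor of x^n − 1, n = p q^b, is up to sign a product of polynomials
-- P(x^{q^i}) / P(x^{q^{i−1}}) and P(x), for P = x − 1 and P = 1 + … + x^{p−1}.
-- Reciprocity: if f h = x^n − 1 and w = f(1/x) h(x), then w(x) w(1/x) ≡ 0 modulo x^n − 1, so the sum of the squares of the
-- coefficients of w vanishes and f divides f(1/x). For p = 3 this replaces the missing domain property of Z[ω]/(q) when q splits.
-- Heights: such a product is built up by steps g ↦ A(x) g(x^q) with A ∈ {1 , Φ_q , Φ_{pq} , Φ_q Φ_{pq}}, and block s (of length q)
-- of the new coefficient sequence depends only on g_s, g_{s−1}, g_{s−2}. For p = 2 every step preserves the height 1.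
-- For p = 3, Φ_{3q} produces g_s + g_{s−1} up to sign but preserves the bound for sums of two neighbours, while the other
-- steps preserve the height and at most double that bound. So the height at most doubles in every second step, and a divisor
-- of x^3 − 1 times the result of the last step has at most 3 times the height before that step. Alternating Φ_q and Φ_{3q}
-- attains the bound.

-- What a factorization needs of a cyclotomic factor φ is only this: if f h divides x^n - 1 and φ
-- divides f h, then φ divides f or h. Such an f divides its reciprocal σf, so φ divides σf h as
-- well. For p = 3 the second divisibility is decisive: the residue ring at q is Z[ω]/(q), which has
-- zero divisors when q ≡ 1 modulo 3, but f h ≡ 0 and σf h ≡ 0 together say that h is killed by the
-- traces of f and of ωf. These are integers, hence zero or invertible modulo q, and both are zero
-- only for f ≡ 0, because 3 is invertible. The constants have separate origins. A doubling by
-- Φ_{3q} needs two equal neighbours in g, and it is Φ_q that creates them; this costs every second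
-- step. The factor 3 is the number of terms of 1 + x + x². Right after a step with Φ_{3q} it
-- multiplies only the height before that step, since 1 + x + x² cancels the denominator of
-- Φ_{3q}(x) = (1 + x^q + x^{2q}) / (1 + x + x²).

infix 4 _≋_
infix 8 ⊝_

-- A record, so that f and g can be inferred from a proof.
record _≋_ (f g : Poly) : Set where
  constructor mk
  field at : f ≈ g
open _≋_

-- The commutative ring of polynomials over ℤ

⊝_ : Poly → Poly
⊝_ = map (λ a → ℤ.- a)

scale : ℤ → Poly → Poly
scale a = map (a ℤ.*_)

≋-refl : ∀ {f} → f ≋ f
≋-refl = mk λ _ → refl

≋-sym : ∀ {f g} → f ≋ g → g ≋ f
≋-sym e = mk λ i → ≡.sym (at e i)

≋-trans : ∀ {f g h} → f ≋ g → g ≋ h → f ≋ h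
≋-trans d e = mk λ i → ≡.trans (at d i) (at e i)

coeff-⊕ : ∀ f g i → coeff (f ⊕ g) i ≡ coeff f i ℤ.+ coeff g i
coeff-⊕ []      g       i       = ≡.sym (ℤ.+-identityˡ _)
coeff-⊕ (a ∷ f) []      i       = ≡.sym (ℤ.+-identityʳ _)
coeff-⊕ (a ∷ f) (b ∷ g) zero    = refl
coeff-⊕ (a ∷ f) (b ∷ g) (suc i) = coeff-⊕ f g i

coeff-⊝ : ∀ f i → coeff (⊝ f) i ≡ ℤ.- coeff f i
coeff-⊝ []      i       = refl
coeff-⊝ (a ∷ f) zero    = refl
coeff-⊝ (a ∷ f) (suc i) = coeff-⊝ f i

coeff-scale : ∀ a f i → coeff (scale a f) i ≡ a ℤ.* coeff f i
coeff-scale a []      i       = ≡.sym (ℤ.*-zeroʳ a)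
coeff-scale a (b ∷ f) zero    = refl
coeff-scale a (b ∷ f) (suc i) = coeff-scale a f i

∷-cong : ∀ {a b f g} → a ≡ b → f ≋ g → a ∷ f ≋ b ∷ g
∷-cong p e = mk λ { zero → p ; (suc i) → at e i }

∷-tail : ∀ {a b f g} → a ∷ f ≋ b ∷ g → f ≋ g
∷-tail e = mk λ i → at e (suc i)

0∷[]≋[] : 0ℤ ∷ [] ≋ []
0∷[]≋[] = mk λ { zero → refl ; (suc _) → refl }

⊕-cong : ∀ {f f′ g g′} → f ≋ f′ → g ≋ g′ → f ⊕ g ≋ f′ ⊕ g′
⊕-cong {f} {f′} {g} {g′} d e = mk λ i → ≡.trans (coeff-⊕ f g i)
  (≡.trans (cong₂ ℤ._+_ (at d i) (at e i)) (≡.sym (coeff-⊕ f′ g′ i)))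

⊝-cong : ∀ {f g} → f ≋ g → ⊝ f ≋ ⊝ g
⊝-cong {f} {g} e = mk λ i → ≡.trans (coeff-⊝ f i) (≡.trans (cong (λ a → ℤ.- a) (at e i)) (≡.sym (coeff-⊝ g i)))

⊕-assoc : ∀ f g h → (f ⊕ g) ⊕ h ≋ f ⊕ (g ⊕ h)
⊕-assoc f g h = mk λ i → ≡.trans (coeff-⊕ (f ⊕ g) h i) (≡.trans (cong (ℤ._+ _) (coeff-⊕ f g i))
  (≡.trans (ℤ.+-assoc (coeff f i) _ _)
  (≡.sym (≡.trans (coeff-⊕ f (g ⊕ h) i) (cong (λ z → coeff f i ℤ.+ z) (coeff-⊕ g h i))))))

⊕-comm : ∀ f g → f ⊕ g ≋ g ⊕ f
⊕-comm f g = mk λ i → ≡.trans (coeff-⊕ f g i) (≡.trans (ℤ.+-comm (coeff f i) _) (≡.sym (coeff-⊕ g f i)))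

⊕-identityʳ : ∀ f → f ⊕ [] ≋ f
⊕-identityʳ f = mk λ i → ≡.trans (coeff-⊕ f [] i) (ℤ.+-identityʳ _)

⊝-inverseˡ : ∀ f → ⊝ f ⊕ f ≋ []
⊝-inverseˡ f = mk λ i → ≡.trans (coeff-⊕ (⊝ f) f i)
  (≡.trans (cong (λ z → z ℤ.+ coeff f i) (coeff-⊝ f i)) (ℤ.+-inverseˡ (coeff f i)))

⊕-interchange : ∀ f g h k → (f ⊕ g) ⊕ (h ⊕ k) ≋ (f ⊕ h) ⊕ (g ⊕ k)
⊕-interchange f g h k = mk λ i → ≡.trans (expand4 f g h k i) (≡.trans (swap (coeff f i) _ _ _) (≡.sym (expand4 f h g k i)))
  where
  expand4 : ∀ a b c d i → coeff ((a ⊕ b) ⊕ (c ⊕ d)) i ≡ (coeff a i ℤ.+ coeff b i) ℤ.+ (coeff c i ℤ.+ coeff d i)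
  expand4 a b c d i = ≡.trans (coeff-⊕ (a ⊕ b) (c ⊕ d) i) (cong₂ ℤ._+_ (coeff-⊕ a b i) (coeff-⊕ c d i))
  swap : ∀ a b c d → (a ℤ.+ b) ℤ.+ (c ℤ.+ d) ≡ (a ℤ.+ c) ℤ.+ (b ℤ.+ d)
  swap = solve-∀

scale-cong : ∀ a {f g} → f ≋ g → scale a f ≋ scale a g
scale-cong a {f} {g} e = mk λ i → ≡.trans (coeff-scale a f i) (≡.trans (cong (a ℤ.*_) (at e i)) (≡.sym (coeff-scale a g i)))

scale-⊕ : ∀ a f g → scale a (f ⊕ g) ≋ scale a f ⊕ scale a g
scale-⊕ a f g = mk λ i → ≡.trans (coeff-scale a (f ⊕ g) i) (≡.trans (cong (a ℤ.*_) (coeff-⊕ f g i))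
  (≡.trans (ℤ.*-distribˡ-+ a (coeff f i) _)
  (≡.sym (≡.trans (coeff-⊕ (scale a f) (scale a g) i) (cong₂ ℤ._+_ (coeff-scale a f i) (coeff-scale a g i))))))

scale-+ : ∀ a b f → scale (a ℤ.+ b) f ≋ scale a f ⊕ scale b f
scale-+ a b f = mk λ i → ≡.trans (coeff-scale (a ℤ.+ b) f i)
  (≡.trans (ℤ.*-distribʳ-+ (coeff f i) a b)
  (≡.sym (≡.trans (coeff-⊕ (scale a f) (scale b f) i) (cong₂ ℤ._+_ (coeff-scale a f i) (coeff-scale b f i)))))

scale-scale : ∀ a b f → scale (a ℤ.* b) f ≋ scale a (scale b f)
scale-scale a b f = mk λ i → ≡.trans (coeff-scale (a ℤ.* b) f i) (≡.trans (ℤ.*-assoc a b _)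
  (≡.sym (≡.trans (coeff-scale a (scale b f) i) (cong (a ℤ.*_) (coeff-scale b f i)))))

scale-0 : ∀ f → scale 0ℤ f ≋ []
scale-0 f = mk λ i → ≡.trans (coeff-scale 0ℤ f i) (ℤ.*-zeroˡ (coeff f i))

scale-1 : ∀ f → scale 1ℤ f ≋ f
scale-1 f = mk λ i → ≡.trans (coeff-scale 1ℤ f i) (ℤ.*-identityˡ _)

⊗-zeroʳ : ∀ f → f ⊗ [] ≋ []
⊗-zeroʳ []      = ≋-refl
⊗-zeroʳ (a ∷ f) = ≋-trans (∷-cong refl (⊗-zeroʳ f)) 0∷[]≋[]

-- Multiplication recurses on its left factor; this is the matching recursion on the right factor,
-- from which commutativity follows.
⊗-∷ : ∀ f b g → f ⊗ (b ∷ g) ≋ scale b f ⊕ (0ℤ ∷ f ⊗ g)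
⊗-∷ []      b g = ≋-sym 0∷[]≋[]
⊗-∷ (a ∷ f) b g = ∷-cong (cong (ℤ._+ 0ℤ) (ℤ.*-comm a b))
  (≋-trans (⊕-cong (≋-refl {scale a g}) (⊗-∷ f b g))
  (≋-trans (≋-sym (⊕-assoc (scale a g) _ _))
  (≋-trans (⊕-cong (⊕-comm (scale a g) (scale b f)) (≋-refl {0ℤ ∷ f ⊗ g})) (⊕-assoc (scale b f) _ _))))

⊗-comm : ∀ f g → f ⊗ g ≋ g ⊗ f
⊗-comm []      g = ≋-sym (⊗-zeroʳ g)
⊗-comm (a ∷ f) g = ≋-trans (⊕-cong (≋-refl {scale a g}) (∷-cong refl (⊗-comm f g))) (≋-sym (⊗-∷ g a f))

⊗-congˡ : ∀ f {g g′} → g ≋ g′ → f ⊗ g ≋ f ⊗ g′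
⊗-congˡ []      e = ≋-refl
⊗-congˡ (a ∷ f) e = ⊕-cong (scale-cong a e) (∷-cong refl (⊗-congˡ f e))

⊗-cong : ∀ {f f′ g g′} → f ≋ f′ → g ≋ g′ → f ⊗ g ≋ f′ ⊗ g′
⊗-cong {f} {f′} {g} {g′} d e = ≋-trans (⊗-congˡ f e)
  (≋-trans (⊗-comm f g′) (≋-trans (⊗-congˡ g′ d) (⊗-comm g′ f′)))

⊗-distribʳ : ∀ h f g → (f ⊕ g) ⊗ h ≋ f ⊗ h ⊕ g ⊗ h
⊗-distribʳ h []      g       = ≋-refl
⊗-distribʳ h (a ∷ f) []      = ≋-sym (⊕-identityʳ _)
⊗-distribʳ h (a ∷ f) (b ∷ g) = ≋-trans (⊕-cong (scale-+ a b h) (∷-cong refl (⊗-distribʳ h f g)))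
  (⊕-interchange (scale a h) (scale b h) (0ℤ ∷ f ⊗ h) (0ℤ ∷ g ⊗ h))

scale-⊗ : ∀ a g h → scale a g ⊗ h ≋ scale a (g ⊗ h)
scale-⊗ a []      h = ≋-refl
scale-⊗ a (b ∷ g) h = ≋-trans (⊕-cong (scale-scale a b h)
  (∷-cong (≡.sym (ℤ.*-zeroʳ a)) (scale-⊗ a g h))) (≋-sym (scale-⊕ a (scale b h) (0ℤ ∷ g ⊗ h)))

0∷-⊗ : ∀ f g → (0ℤ ∷ f) ⊗ g ≋ 0ℤ ∷ f ⊗ g
0∷-⊗ f g = ⊕-cong (scale-0 g) ≋-refl

⊗-assoc : ∀ f g h → (f ⊗ g) ⊗ h ≋ f ⊗ (g ⊗ h)
⊗-assoc []      g h = ≋-refl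
⊗-assoc (a ∷ f) g h = ≋-trans (⊗-distribʳ h (scale a g) (0ℤ ∷ f ⊗ g))
  (⊕-cong (scale-⊗ a g h) (≋-trans (0∷-⊗ (f ⊗ g) h) (∷-cong refl (⊗-assoc f g h))))

-- Constants and the variable are kept abstract, so that ring identities treat `C a` and `X` as
-- symbols instead of unfolding them to lists of coefficients.
opaque
  C : ℤ → Poly
  C a = a ∷ []

  X : Poly
  X = 0ℤ ∷ 1ℤ ∷ []

  C-⊗ : ∀ a f → C a ⊗ f ≋ scale a f
  C-⊗ a f = ≋-trans (⊕-cong (≋-refl {scale a f}) 0∷[]≋[]) (⊕-identityʳ _)

  X-⊗ : ∀ f → X ⊗ f ≋ 0ℤ ∷ f
  X-⊗ f = ≋-trans (0∷-⊗ (1ℤ ∷ []) f)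
    (∷-cong refl (≋-trans (⊕-cong (scale-1 f) 0∷[]≋[]) (⊕-identityʳ f)))

  C-0 : C 0ℤ ≋ []
  C-0 = 0∷[]≋[]

  C-+ : ∀ a b → C (a ℤ.+ b) ≋ C a ⊕ C b
  C-+ a b = ≋-refl

  C-neg : ∀ a → C (ℤ.- a) ≋ ⊝ C a
  C-neg a = ≋-refl

  C-* : ∀ a b → C (a ℤ.* b) ≋ C a ⊗ C b
  C-* a b = ≋-sym (C-⊗ a (C b))

  ∷≋ : ∀ a f → a ∷ f ≋ C a ⊕ X ⊗ f
  ∷≋ a f = ≋-trans (∷-cong (≡.sym (ℤ.+-identityʳ a)) ≋-refl) (⊕-cong (≋-refl {a ∷ []}) (≋-sym (X-⊗ f)))

  coeff-C-suc : ∀ a i → coeff (C a) (suc i) ≡ 0ℤ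
  coeff-C-suc a i = refl

  coeff-C-zero : ∀ a → coeff (C a) 0 ≡ a
  coeff-C-zero a = refl

⊗-identityˡ : ∀ f → C 1ℤ ⊗ f ≋ f
⊗-identityˡ f = ≋-trans (C-⊗ 1ℤ f) (scale-1 f)

polyRing : CommutativeRing 0ℓ 0ℓ
polyRing = record
  { Carrier = Poly ; _≈_ = _≋_ ; _+_ = _⊕_ ; _*_ = _⊗_ ; -_ = ⊝_ ; 0# = [] ; 1# = C 1ℤ
  ; isCommutativeRing = record
    { isRing = record
      { +-isAbelianGroup = record
        { isGroup = record
          { isMonoid = record
            { isSemigroup = record
              { isMagma = record
                { isEquivalence = record { refl = ≋-refl ; sym = ≋-sym ; trans = ≋-trans }
                ; ∙-cong = ⊕-cong }
              ; assoc = ⊕-assoc }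
            ; identity = (λ _ → ≋-refl) , ⊕-identityʳ }
          ; inverse = ⊝-inverseˡ , λ f → ≋-trans (⊕-comm f (⊝ f)) (⊝-inverseˡ f)
          ; ⁻¹-cong = ⊝-cong }
        ; comm = ⊕-comm }
      ; *-cong = ⊗-cong
      ; *-assoc = ⊗-assoc
      ; *-identity = ⊗-identityˡ , λ f → ≋-trans (⊗-comm f (C 1ℤ)) (⊗-identityˡ f)
      ; distrib = (λ f g h → ≋-trans (⊗-comm f (g ⊕ h)) (≋-trans (⊗-distribʳ f g h) (⊕-cong (⊗-comm g f) (⊗-comm h f))))
                , ⊗-distribʳ }
    ; *-comm = ⊗-comm } }

polyACR : AlmostCommutativeRing 0ℓ 0ℓ
polyACR = fromCommutativeRing polyRing

C-morphism : CommutativeRing.rawRing ℤ.+-*-commutativeRing -Raw-AlmostCommutative⟶ polyACR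
C-morphism = record { ⟦_⟧ = C ; +-homo = C-+ ; *-homo = C-* ; -‿homo = C-neg ; 0-homo = C-0 ; 1-homo = ≋-refl }

C-≟ : ∀ a b → Maybe (C a ≋ C b)
C-≟ a b with a ℤ.≟ b
... | yes refl = just ≋-refl
... | no _     = nothing

open RingSolver (CommutativeRing.rawRing ℤ.+-*-commutativeRing) polyACR C-morphism C-≟
  using (solve; _:+_; _:*_; :-_; _:=_; con)
import Algebra.Properties.CommutativeSemiring.Binomial (CommutativeRing.commutativeSemiring polyRing) as Binomial
import Algebra.Properties.Semiring.Mult (CommutativeRing.semiring polyRing) as Mult
import Algebra.Properties.Semiring.Sum (CommutativeRing.semiring polyRing) as Sum
open import Algebra.Properties.Semiring.Exp (CommutativeRing.semiring polyRing)
  using () renaming (_^_ to infixr 8 _↑_; ^-cong to ↑-cong; ^-homo-* to ↑-+; ^-assocʳ to ↑-*)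
open import Relation.Binary.Reasoning.Setoid (CommutativeRing.setoid polyRing)

≋-reflexive : ∀ {f g} → f ≡ g → f ≋ g
≋-reflexive refl = ≋-refl

-- Division by monic polynomials

infix 4 _∣ᶜ_ _∣ₚ_

_∣ₚ_ : Poly → Poly → Set
f ∣ₚ g = ∃[ k ] k ⊗ f ≋ g

-- The value c = 0 is intended: divisibility by 0 means vanishing, so every statement modulo `c`
-- also covers exact equality over ℤ.
_∣ᶜ_ : ℤ → Poly → Set
c ∣ᶜ f = ∀ i → c ∣ᶻ coeff f i

0∣ᶜ⇒≋[] : ∀ {f} → 0ℤ ∣ᶜ f → f ≋ []
0∣ᶜ⇒≋[] d = mk λ i → ℤ.0∣⇒≡0 (d i)

≋[]⇒0∣ᶜ : ∀ {f} → f ≋ [] → 0ℤ ∣ᶜ f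
≋[]⇒0∣ᶜ e i = ℤ.∣-reflexive (≡.sym (at e i))

∣ᶜ-resp : ∀ {c f g} → f ≋ g → c ∣ᶜ f → c ∣ᶜ g
∣ᶜ-resp {c} e d i = subst (c ∣ᶻ_) (at e i) (d i)

coeff-C⊗ : ∀ a f i → coeff (C a ⊗ f) i ≡ a ℤ.* coeff f i
coeff-C⊗ a f i = ≡.trans (at (C-⊗ a f) i) (coeff-scale a f i)

C⊗⇒∣ᶜ : ∀ {c f g} → f ≋ C c ⊗ g → c ∣ᶜ f
C⊗⇒∣ᶜ {c} {f} {g} e i = dividesᶻ (coeff g i) (≡.trans (at e i) (≡.trans (coeff-C⊗ c g i) (ℤ.*-comm c _)))

∣ᶜ⇒C⊗ : ∀ {c} f → c ∣ᶜ f → ∃[ g ] f ≋ C c ⊗ g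
∣ᶜ⇒C⊗ {c} [] d = [] , ≋-sym (⊗-zeroʳ (C c))
∣ᶜ⇒C⊗ {c} (a ∷ f) d with ∣ᶜ⇒C⊗ f (λ i → d (suc i)) | d 0
... | g , e | dividesᶻ b a≡bc = b ∷ g , ≋-trans (∷-cong (≡.trans a≡bc (ℤ.*-comm b c)) (≋-trans e (C-⊗ c g))) (≋-sym (C-⊗ c (b ∷ g)))

∣ᶜ-⊗ : ∀ {c} f g → c ∣ᶜ f → c ∣ᶜ f ⊗ g
∣ᶜ-⊗ {c} f g d with ∣ᶜ⇒C⊗ f d
... | k , e = C⊗⇒∣ᶜ (≋-trans (⊗-cong e (≋-refl {g})) (⊗-assoc (C c) k g))

∣ᶜ? : ∀ c f → Dec (c ∣ᶜ f)
∣ᶜ? c []      = yes λ _ → dividesᶻ 0ℤ refl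
∣ᶜ? c (a ∷ f) with c ∣ᶻ? a | ∣ᶜ? c f
... | yes p | yes ps = yes λ { zero → p ; (suc i) → ps i }
... | no ¬p | _      = no λ d → ¬p (d 0)
... | yes _ | no ¬ps = no λ d → ¬ps (λ i → d (suc i))

Lead : ℕ → ℤ → Poly → Set
Lead d a φ = coeff φ d ≡ a × ∀ i → coeff φ (suc (d ℕ.+ i)) ≡ 0ℤ

Monic : ℕ → Poly → Set
Monic d = Lead d 1ℤ

Deg< : ℕ → Poly → Set
Deg< d r = ∀ i → coeff r (d ℕ.+ i) ≡ 0ℤ

Lead-resp : ∀ {d a f g} → f ≋ g → Lead d a f → Lead d a g
Lead-resp {d} e (p , q) = ≡.trans (≡.sym (at e d)) p , λ i → ≡.trans (≡.sym (at e _)) (q i)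

coeff-∷⊗ : ∀ a f g i → coeff ((a ∷ f) ⊗ g) i ≡ a ℤ.* coeff g i ℤ.+ coeff (0ℤ ∷ f ⊗ g) i
coeff-∷⊗ a f g i = ≡.trans (coeff-⊕ (scale a g) (0ℤ ∷ f ⊗ g) i) (cong (λ z → z ℤ.+ coeff (0ℤ ∷ f ⊗ g) i) (coeff-scale a g i))

-- Descent from the top coefficient of `k`: once the higher coefficients of `k` are multiples of
-- `c`, the next one meets only the leading coefficient of `φ` modulo `c`. For c = 0 this yields
-- cancellation and bounds on degrees.
lead-∣ : ∀ {c a d φ} → (∀ x → c ∣ᶻ a ℤ.* x → c ∣ᶻ x) → Lead d a φ → ∀ e k →
         (∀ i → c ∣ᶻ coeff (k ⊗ φ) (d ℕ.+ (e ℕ.+ i))) → ∀ i → c ∣ᶻ coeff k (e ℕ.+ i)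
lead-∣ {c} reg l e [] h i = dividesᶻ 0ℤ refl
lead-∣ {c} {a} {d} {φ} reg l e (b ∷ k) h = go e h
  where
  step : ∀ j → coeff ((b ∷ k) ⊗ φ) (d ℕ.+ suc j) ≡ coeff (k ⊗ φ) (d ℕ.+ j)
  step j rewrite ℕ.+-suc d j | coeff-∷⊗ b k φ (suc (d ℕ.+ j)) | proj₂ l j | ℤ.*-zeroʳ b = ℤ.+-identityˡ _
  go : ∀ e → (∀ i → c ∣ᶻ coeff ((b ∷ k) ⊗ φ) (d ℕ.+ (e ℕ.+ i))) → ∀ i → c ∣ᶻ coeff (b ∷ k) (e ℕ.+ i)
  go (suc e) h = lead-∣ reg l e k (λ i → subst (c ∣ᶻ_) (step (e ℕ.+ i)) (h i))
  go zero h (suc i) = lead-∣ reg l zero k (λ i → subst (c ∣ᶻ_) (step i) (h (suc i))) i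
  go zero h zero = reg b (subst (c ∣ᶻ_) (≡.trans (cong (b ℤ.*_) (proj₁ l)) (ℤ.*-comm b a))
    (ℤ.∣m+n∣n⇒∣m (subst (c ∣ᶻ_) top (h 0)) (tail d)))
    where
    tail : ∀ j → c ∣ᶻ coeff (0ℤ ∷ k ⊗ φ) j
    tail zero    = dividesᶻ 0ℤ refl
    tail (suc j) = ∣ᶜ-⊗ k φ (lead-∣ reg l zero k (λ i → subst (c ∣ᶻ_) (step i) (h (suc i)))) j
    top : coeff ((b ∷ k) ⊗ φ) (d ℕ.+ 0) ≡ b ℤ.* coeff φ d ℤ.+ coeff (0ℤ ∷ k ⊗ φ) d
    top rewrite ℕ.+-identityʳ d = coeff-∷⊗ b k φ d

1-regular : ∀ c x → c ∣ᶻ 1ℤ ℤ.* x → c ∣ᶻ x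
1-regular c x = subst (c ∣ᶻ_) (ℤ.*-identityˡ x)

-- Uniqueness of division with remainder over ℤ/c: from index `d` on, only k φ contributes to the
-- sum, which settles `k` and then `r`.
monic-∣ : ∀ {c d φ} k r → Monic d φ → Deg< d r → c ∣ᶜ k ⊗ φ ⊕ r → c ∣ᶜ k × c ∣ᶜ r
monic-∣ {c} {d} {φ} k r m r< h = hk , λ i → ℤ.∣m+n∣m⇒∣n (subst (c ∣ᶻ_) (coeff-⊕ (k ⊗ φ) r i) (h i)) (∣ᶜ-⊗ k φ hk i)
  where
  hk : c ∣ᶜ k
  hk = lead-∣ (1-regular c) m 0 k λ i → subst (c ∣ᶻ_)
    (≡.trans (coeff-⊕ (k ⊗ φ) r (d ℕ.+ i)) (≡.trans (cong (λ z → coeff (k ⊗ φ) (d ℕ.+ i) ℤ.+ z) (r< i)) (ℤ.+-identityʳ _))) (h _)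

monic-∣₀ : ∀ {c d φ} k → Monic d φ → c ∣ᶜ k ⊗ φ → c ∣ᶜ k
monic-∣₀ {φ = φ} k m h = proj₁ (monic-∣ k [] m (λ _ → refl) (∣ᶜ-resp (≋-sym (⊕-identityʳ (k ⊗ φ))) h))

≋⇒⊖≋[] : ∀ {f g} → f ≋ g → f ⊕ ⊝ g ≋ []
≋⇒⊖≋[] {f} {g} e = ≋-trans (⊕-cong e (≋-refl {⊝ g})) (CommutativeRing.-‿inverseʳ polyRing g)

⊖≋[]⇒≋ : ∀ {f g} → f ⊕ ⊝ g ≋ [] → f ≋ g
⊖≋[]⇒≋ {f} {g} e = ≋-trans (solve 2 (λ f g → f := f :+ :- g :+ g) ≋-refl f g) (⊕-cong e (≋-refl {g}))

monic-cancel : ∀ {d φ} k l → Monic d φ → k ⊗ φ ≋ l ⊗ φ → k ≋ l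
monic-cancel {d} {φ} k l m e = ⊖≋[]⇒≋ (0∣ᶜ⇒≋[] (monic-∣₀ (k ⊕ ⊝ l) m (≋[]⇒0∣ᶜ
  (≋-trans (solve 3 (λ k l φ → (k :+ :- l) :* φ := k :* φ :+ :- (l :* φ)) ≋-refl k l φ) (≋⇒⊖≋[] e)))))

monic-divMod : ∀ {d φ} → Monic d φ → ∀ f → ∃[ k ] ∃[ r ] f ≋ k ⊗ φ ⊕ r × Deg< d r
monic-divMod m [] = [] , [] , ≋-refl , λ _ → refl
monic-divMod {d} {φ} m (a ∷ f) with monic-divMod m f
... | k , r , e , r< = C t ⊕ X ⊗ k , (a ∷ r) ⊕ ⊝ (C t ⊗ φ) , eq , deg
  where
  t = coeff (a ∷ r) d
  eq : a ∷ f ≋ (C t ⊕ X ⊗ k) ⊗ φ ⊕ ((a ∷ r) ⊕ ⊝ (C t ⊗ φ))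
  eq = begin
    a ∷ f ≈⟨ ∷≋ a f ⟩
    C a ⊕ X ⊗ f ≈⟨ ⊕-cong (≋-refl {C a}) (⊗-congˡ X e) ⟩
    C a ⊕ X ⊗ (k ⊗ φ ⊕ r) ≈⟨ solve 6 (λ A x k φ r T → A :+ x :* (k :* φ :+ r) := (T :+ x :* k) :* φ :+ ((A :+ x :* r) :+ :- (T :* φ))) ≋-refl (C a) X k φ r (C t) ⟩
    (C t ⊕ X ⊗ k) ⊗ φ ⊕ ((C a ⊕ X ⊗ r) ⊕ ⊝ (C t ⊗ φ)) ≈⟨ ⊕-cong (≋-refl {(C t ⊕ X ⊗ k) ⊗ φ}) (⊕-cong (≋-sym (∷≋ a r)) (≋-refl {⊝ (C t ⊗ φ)})) ⟩
    (C t ⊕ X ⊗ k) ⊗ φ ⊕ ((a ∷ r) ⊕ ⊝ (C t ⊗ φ)) ∎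
  at-index : ∀ j → coeff ((a ∷ r) ⊕ ⊝ (C t ⊗ φ)) j ≡ coeff (a ∷ r) j ℤ.- t ℤ.* coeff φ j
  at-index j = ≡.trans (coeff-⊕ (a ∷ r) (⊝ (C t ⊗ φ)) j)
    (cong (λ z → coeff (a ∷ r) j ℤ.+ z) (≡.trans (coeff-⊝ (C t ⊗ φ) j) (cong (λ z → ℤ.- z) (coeff-C⊗ t φ j))))
  deg : Deg< d ((a ∷ r) ⊕ ⊝ (C t ⊗ φ))
  deg zero rewrite ℕ.+-identityʳ d | at-index d | proj₁ m | ℤ.*-identityʳ t = ℤ.+-inverseʳ t
  deg (suc i) rewrite ℕ.+-suc d i | at-index (suc (d ℕ.+ i)) | r< i | proj₂ m i | ℤ.*-zeroʳ t = refl

trim : ∀ f → f ≋ [] ⊎ ∃[ d ] ∃[ a ] a ≢ 0ℤ × Lead d a f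
trim [] = inj₁ ≋-refl
trim (a ∷ f) with trim f
... | inj₂ (d , b , b≢0 , p , q) = inj₂ (suc d , b , b≢0 , p , q)
... | inj₁ f≋[] with a ℤ.≟ 0ℤ
...   | yes refl = inj₁ (≋-trans (∷-cong refl f≋[]) 0∷[]≋[])
...   | no a≢0   = inj₂ (0 , a , a≢0 , refl , at f≋[])

IsUnit : ℤ → Set
IsUnit ε = ε ≡ 1ℤ ⊎ ε ≡ -1ℤ

unit-split : ∀ {a b} → a ℤ.* b ≡ 1ℤ → IsUnit a
unit-split {a} {b} e with a | ℕ.m*n≡1⇒m≡1 ℤ.∣ a ∣ ℤ.∣ b ∣ (≡.trans (≡.sym (ℤ.abs-* a b)) (cong ℤ.∣_∣ e))
... | + .1      | refl = inj₁ refl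
... | -[1+ .0 ] | refl = inj₂ refl

-- If f had positive degree, the product would have no coefficients from that degree on, and
-- `lead-∣` with c = 0 would force h = 0.
⊗≋1⇒unit : ∀ f h → f ⊗ h ≋ C 1ℤ → ∃[ ε ] IsUnit ε × f ≋ C ε
⊗≋1⇒unit f h e with trim f
... | inj₁ f≋[] = contradiction (≡.trans (≡.sym (coeff-C-zero 1ℤ)) (≡.trans (≡.sym (at e 0)) (at (⊗-cong f≋[] (≋-refl {h})) 0))) λ ()
... | inj₂ (suc d , a , a≢0 , l) = contradiction (≡.trans (≡.sym (coeff-C-zero 1ℤ)) (≡.trans (≡.sym (at e 0)) (at (≋-trans (⊗-congˡ f h≋[]) (⊗-zeroʳ f)) 0))) λ ()
  where
  reg : ∀ x → 0ℤ ∣ᶻ a ℤ.* x → 0ℤ ∣ᶻ x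
  reg x p = [ (λ a≡0 → contradiction a≡0 a≢0) , (λ x≡0 → ℤ.∣-reflexive (≡.sym x≡0)) ]′ (ℤ.i*j≡0⇒i≡0∨j≡0 a (ℤ.0∣⇒≡0 p))
  h≋[] : h ≋ []
  h≋[] = 0∣ᶜ⇒≋[] (lead-∣ reg l 0 h λ i → ℤ.∣-reflexive
    (≡.sym (≡.trans (at (≋-trans (⊗-comm h f) e) (suc (d ℕ.+ i))) (coeff-C-suc 1ℤ _))))
... | inj₂ (zero , a , a≢0 , p , q) = a , unit-split {b = coeff h 0} (≡.trans (≡.sym (coeff-C⊗ a h 0)) (≡.trans (at (≋-trans (⊗-cong (≋-sym f≋C) (≋-refl {h})) e) 0) (coeff-C-zero 1ℤ))) , f≋C
  where
  f≋C : f ≋ C a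
  f≋C = mk λ { zero → ≡.trans p (≡.sym (coeff-C-zero a)) ; (suc i) → ≡.trans (q i) (≡.sym (coeff-C-suc a i)) }

-- Substitution, and congruences modulo the ideal (u , v)

infix 4 _≈_[_,_]

sub : Poly → Poly → Poly
sub u []      = []
sub u (a ∷ f) = C a ⊕ u ⊗ sub u f

sub-≋[] : ∀ u {f} → f ≋ [] → sub u f ≋ []
sub-≋[] u {[]}    e = ≋-refl
sub-≋[] u {a ∷ f} e = begin
  C a ⊕ u ⊗ sub u f ≈⟨ ⊕-cong (≋-trans (≋-reflexive (cong C (at e 0))) C-0) (⊗-congˡ u (sub-≋[] u {f} (mk λ i → at e (suc i)))) ⟩
  u ⊗ []            ≈⟨ ⊗-zeroʳ u ⟩
  []                ∎

sub-cong : ∀ u {f g} → f ≋ g → sub u f ≋ sub u g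
sub-cong u {[]}    {g}     e = ≋-sym (sub-≋[] u (≋-sym e))
sub-cong u {a ∷ f} {[]}    e = sub-≋[] u e
sub-cong u {a ∷ f} {b ∷ g} e = ⊕-cong (≋-reflexive (cong C (at e 0))) (⊗-congˡ u (sub-cong u (∷-tail e)))

sub-C : ∀ u a → sub u (C a) ≋ C a
sub-C u a = begin
  sub u (C a)     ≈⟨ sub-cong u (≋-trans (∷≋′ a) ≋-refl) ⟩
  C a ⊕ u ⊗ []    ≈⟨ ⊕-cong (≋-refl {C a}) (⊗-zeroʳ u) ⟩
  C a ⊕ []        ≈⟨ ⊕-identityʳ (C a) ⟩
  C a             ∎
  where
  ∷≋′ : ∀ a → C a ≋ a ∷ []
  ∷≋′ a = ≋-sym (≋-trans (∷≋ a []) (≋-trans (⊕-cong (≋-refl {C a}) (⊗-zeroʳ X)) (⊕-identityʳ (C a))))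

sub-⊕ : ∀ u f g → sub u (f ⊕ g) ≋ sub u f ⊕ sub u g
sub-⊕ u []      g       = ≋-refl
sub-⊕ u (a ∷ f) []      = ≋-sym (⊕-identityʳ _)
sub-⊕ u (a ∷ f) (b ∷ g) = begin
  C (a ℤ.+ b) ⊕ u ⊗ sub u (f ⊕ g)             ≈⟨ ⊕-cong (C-+ a b) (⊗-congˡ u (sub-⊕ u f g)) ⟩
  (C a ⊕ C b) ⊕ u ⊗ (sub u f ⊕ sub u g)       ≈⟨ solve 5 (λ a b u f g → (a :+ b) :+ u :* (f :+ g) := (a :+ u :* f) :+ (b :+ u :* g)) ≋-refl (C a) (C b) u (sub u f) (sub u g) ⟩
  (C a ⊕ u ⊗ sub u f) ⊕ (C b ⊕ u ⊗ sub u g)   ∎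

sub-scale : ∀ u a f → sub u (scale a f) ≋ C a ⊗ sub u f
sub-scale u a []      = ≋-sym (⊗-zeroʳ (C a))
sub-scale u a (b ∷ f) = begin
  C (a ℤ.* b) ⊕ u ⊗ sub u (scale a f)   ≈⟨ ⊕-cong (C-* a b) (⊗-congˡ u (sub-scale u a f)) ⟩
  C a ⊗ C b ⊕ u ⊗ (C a ⊗ sub u f)       ≈⟨ solve 4 (λ a b u f → a :* b :+ u :* (a :* f) := a :* (b :+ u :* f)) ≋-refl (C a) (C b) u (sub u f) ⟩
  C a ⊗ (C b ⊕ u ⊗ sub u f)             ∎

sub-⊗ : ∀ u f g → sub u (f ⊗ g) ≋ sub u f ⊗ sub u g
sub-⊗ u []      g = ≋-refl
sub-⊗ u (a ∷ f) g = begin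
  sub u (scale a g ⊕ (0ℤ ∷ f ⊗ g))                  ≈⟨ sub-⊕ u (scale a g) (0ℤ ∷ f ⊗ g) ⟩
  sub u (scale a g) ⊕ (C 0ℤ ⊕ u ⊗ sub u (f ⊗ g))    ≈⟨ ⊕-cong (sub-scale u a g) (⊕-cong (≋-refl {C 0ℤ}) (⊗-congˡ u (sub-⊗ u f g))) ⟩
  C a ⊗ sub u g ⊕ (C 0ℤ ⊕ u ⊗ (sub u f ⊗ sub u g))  ≈⟨ solve 4 (λ a u f g → a :* g :+ (con 0ℤ :+ u :* (f :* g)) := (a :+ u :* f) :* g) ≋-refl (C a) u (sub u f) (sub u g) ⟩
  (C a ⊕ u ⊗ sub u f) ⊗ sub u g                     ∎

sub-X : ∀ u → sub u X ≋ u
sub-X u = begin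
  sub u X                                ≈⟨ sub-cong u X≋ ⟩
  C 0ℤ ⊕ u ⊗ (C 1ℤ ⊕ u ⊗ [])             ≈⟨ ⊕-cong (≋-refl {C 0ℤ}) (⊗-congˡ u (⊕-cong (≋-refl {C 1ℤ}) (⊗-zeroʳ u))) ⟩
  C 0ℤ ⊕ u ⊗ (C 1ℤ ⊕ [])                 ≈⟨ ⊕-cong (≋-refl {C 0ℤ}) (⊗-congˡ u (⊕-identityʳ (C 1ℤ))) ⟩
  C 0ℤ ⊕ u ⊗ C 1ℤ                        ≈⟨ solve 1 (λ u → con 0ℤ :+ u :* con 1ℤ := u) ≋-refl u ⟩
  u                                      ∎
  where
  X≋ : X ≋ 0ℤ ∷ 1ℤ ∷ []
  X≋ = begin
    X              ≈⟨ solve 1 (λ x → x := x :* con 1ℤ) ≋-refl X ⟩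
    X ⊗ C 1ℤ       ≈⟨ X-⊗ (C 1ℤ) ⟩
    0ℤ ∷ C 1ℤ      ≈⟨ ∷-cong refl (mk λ { zero → coeff-C-zero 1ℤ ; (suc i) → coeff-C-suc 1ℤ i }) ⟩
    0ℤ ∷ 1ℤ ∷ []   ∎

sub-↑ : ∀ u f n → sub u (f ↑ n) ≋ sub u f ↑ n
sub-↑ u f zero    = sub-C u 1ℤ
sub-↑ u f (suc n) = ≋-trans (sub-⊗ u f (f ↑ n)) (⊗-congˡ (sub u f) (sub-↑ u f n))

sub-sub : ∀ u v f → sub u (sub v f) ≋ sub (sub u v) f
sub-sub u v []      = ≋-refl
sub-sub u v (a ∷ f) = begin
  sub u (C a ⊕ v ⊗ sub v f)              ≈⟨ sub-⊕ u (C a) (v ⊗ sub v f) ⟩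
  sub u (C a) ⊕ sub u (v ⊗ sub v f)      ≈⟨ ⊕-cong (sub-C u a) (sub-⊗ u v (sub v f)) ⟩
  C a ⊕ sub u v ⊗ sub u (sub v f)        ≈⟨ ⊕-cong (≋-refl {C a}) (⊗-congˡ (sub u v) (sub-sub u v f)) ⟩
  C a ⊕ sub u v ⊗ sub (sub u v) f        ∎

sub-X-id : ∀ f → sub X f ≋ f
sub-X-id []      = ≋-refl
sub-X-id (a ∷ f) = ≋-trans (⊕-cong (≋-refl {C a}) (⊗-congˡ X (sub-X-id f))) (≋-sym (∷≋ a f))

-- Two generators suffice throughout: the ideals that occur are (P , c), (P , Φ) and principal
-- ideals, which take `[]` as one of the generators.
record _≈_[_,_] (f g u v : Poly) : Set where
  constructor mk
  field
    {k l} : Poly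
    eq    : f ≋ g ⊕ (k ⊗ u ⊕ l ⊗ v)

module _ {u v : Poly} where
  ≋⇒≈ : ∀ {f g} → f ≋ g → f ≈ g [ u , v ]
  ≋⇒≈ {f} {g} e = mk {k = []} {[]} (≋-trans e (≋-sym (⊕-identityʳ g)))

  mod-sym : ∀ {f g} → f ≈ g [ u , v ] → g ≈ f [ u , v ]
  mod-sym {f} {g} (mk {k} {l} e) = mk {k = ⊝ k} {⊝ l} (≋-trans
    (solve 5 (λ g k l u v → g := g :+ (k :* u :+ l :* v) :+ (:- k :* u :+ :- l :* v)) ≋-refl g k l u v)
    (⊕-cong (≋-sym e) (≋-refl {⊝ k ⊗ u ⊕ ⊝ l ⊗ v})))

  mod-trans : ∀ {f g h} → f ≈ g [ u , v ] → g ≈ h [ u , v ] → f ≈ h [ u , v ]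
  mod-trans {f} {g} {h} (mk {k} {l} d) (mk {k′} {l′} e) = mk {k = k ⊕ k′} {l ⊕ l′} (≋-trans d (≋-trans
    (⊕-cong e (≋-refl {k ⊗ u ⊕ l ⊗ v}))
    (solve 7 (λ h k l k′ l′ u v → h :+ (k′ :* u :+ l′ :* v) :+ (k :* u :+ l :* v) := h :+ ((k :+ k′) :* u :+ (l :+ l′) :* v)) ≋-refl h k l k′ l′ u v)))

  mod-⊕ : ∀ {f f′ g g′} → f ≈ f′ [ u , v ] → g ≈ g′ [ u , v ] → f ⊕ g ≈ f′ ⊕ g′ [ u , v ]
  mod-⊕ {f} {f′} {g} {g′} (mk {k} {l} d) (mk {k′} {l′} e) = mk {k = k ⊕ k′} {l ⊕ l′} (≋-trans (⊕-cong d e)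
    (solve 8 (λ f′ g′ k l k′ l′ u v → f′ :+ (k :* u :+ l :* v) :+ (g′ :+ (k′ :* u :+ l′ :* v)) := f′ :+ g′ :+ ((k :+ k′) :* u :+ (l :+ l′) :* v)) ≋-refl f′ g′ k l k′ l′ u v))

  mod-⊗ : ∀ {f f′ g g′} → f ≈ f′ [ u , v ] → g ≈ g′ [ u , v ] → f ⊗ g ≈ f′ ⊗ g′ [ u , v ]
  mod-⊗ {f} {f′} {g} {g′} (mk {k} {l} d) (mk {k′} {l′} e) = mk {k = k ⊗ g ⊕ k′ ⊗ f′} {l ⊗ g ⊕ l′ ⊗ f′} (begin
    f ⊗ g                                   ≈⟨ ⊗-cong d (≋-refl {g}) ⟩
    (f′ ⊕ (k ⊗ u ⊕ l ⊗ v)) ⊗ g              ≈⟨ solve 6 (λ f′ g k l u v → (f′ :+ (k :* u :+ l :* v)) :* g := f′ :* g :+ ((k :* g) :* u :+ (l :* g) :* v)) ≋-refl f′ g k l u v ⟩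
    f′ ⊗ g ⊕ ((k ⊗ g) ⊗ u ⊕ (l ⊗ g) ⊗ v)    ≈⟨ ⊕-cong (⊗-congˡ f′ e) (≋-refl {(k ⊗ g) ⊗ u ⊕ (l ⊗ g) ⊗ v}) ⟩
    f′ ⊗ (g′ ⊕ (k′ ⊗ u ⊕ l′ ⊗ v)) ⊕ ((k ⊗ g) ⊗ u ⊕ (l ⊗ g) ⊗ v)
      ≈⟨ solve 8 (λ f′ g′ kg lg k′ l′ u v → f′ :* (g′ :+ (k′ :* u :+ l′ :* v)) :+ (kg :* u :+ lg :* v) := f′ :* g′ :+ ((kg :+ k′ :* f′) :* u :+ (lg :+ l′ :* f′) :* v)) ≋-refl f′ g′ (k ⊗ g) (l ⊗ g) k′ l′ u v ⟩
    f′ ⊗ g′ ⊕ ((k ⊗ g ⊕ k′ ⊗ f′) ⊗ u ⊕ (l ⊗ g ⊕ l′ ⊗ f′) ⊗ v) ∎)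

  mod-⊗ˡ : ∀ f {g g′} → g ≈ g′ [ u , v ] → f ⊗ g ≈ f ⊗ g′ [ u , v ]
  mod-⊗ˡ f e = mod-⊗ {f = f} (≋⇒≈ ≋-refl) e

  mod-⊗ʳ : ∀ g {f f′} → f ≈ f′ [ u , v ] → f ⊗ g ≈ f′ ⊗ g [ u , v ]
  mod-⊗ʳ g e = mod-⊗ e (≋⇒≈ ≋-refl)

  mod-↑ : ∀ {f g} n → f ≈ g [ u , v ] → f ↑ n ≈ g ↑ n [ u , v ]
  mod-↑ zero    e = ≋⇒≈ ≋-refl
  mod-↑ (suc n) e = mod-⊗ e (mod-↑ n e)

  modˡ : u ≈ [] [ u , v ]
  modˡ = mk {k = C 1ℤ} {[]} (≋-sym (≋-trans (⊕-identityʳ (C 1ℤ ⊗ u)) (⊗-identityˡ u)))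

  modʳ : v ≈ [] [ u , v ]
  modʳ = mk {k = []} {C 1ℤ} (≋-sym (⊗-identityˡ v))

  mod-sub : ∀ w {f g} → f ≈ g [ u , v ] → sub w f ≈ sub w g [ sub w u , sub w v ]
  mod-sub w {f} {g} (mk {k} {l} e) = mk {k = sub w k} {sub w l} (begin
    sub w f                             ≈⟨ sub-cong w e ⟩
    sub w (g ⊕ (k ⊗ u ⊕ l ⊗ v))         ≈⟨ sub-⊕ w g (k ⊗ u ⊕ l ⊗ v) ⟩
    sub w g ⊕ sub w (k ⊗ u ⊕ l ⊗ v)     ≈⟨ ⊕-cong (≋-refl {sub w g}) (≋-trans (sub-⊕ w (k ⊗ u) (l ⊗ v)) (⊕-cong (sub-⊗ w k u) (sub-⊗ w l v))) ⟩
    sub w g ⊕ (sub w k ⊗ sub w u ⊕ sub w l ⊗ sub w v) ∎)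

  mod-mono : ∀ {u′ v′ f g} → u ≈ [] [ u′ , v′ ] → v ≈ [] [ u′ , v′ ] → f ≈ g [ u , v ] → f ≈ g [ u′ , v′ ]
  mod-mono {u′} {v′} {f} {g} (mk {a} {b} d) (mk {a′} {b′} d′) (mk {k} {l} e) = mk {k = k ⊗ a ⊕ l ⊗ a′} {k ⊗ b ⊕ l ⊗ b′} (begin
    f                        ≈⟨ e ⟩
    g ⊕ (k ⊗ u ⊕ l ⊗ v)      ≈⟨ ⊕-cong (≋-refl {g}) (⊕-cong (⊗-congˡ k d) (⊗-congˡ l d′)) ⟩
    g ⊕ (k ⊗ (a ⊗ u′ ⊕ b ⊗ v′) ⊕ l ⊗ (a′ ⊗ u′ ⊕ b′ ⊗ v′))
      ≈⟨ solve 9 (λ g k l a b a′ b′ u v → g :+ (k :* (a :* u :+ b :* v) :+ l :* (a′ :* u :+ b′ :* v)) := g :+ ((k :* a :+ l :* a′) :* u :+ (k :* b :+ l :* b′) :* v)) ≋-refl g k l a b a′ b′ u′ v′ ⟩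
    g ⊕ ((k ⊗ a ⊕ l ⊗ a′) ⊗ u′ ⊕ (k ⊗ b ⊕ l ⊗ b′) ⊗ v′) ∎)

  sub-mod : ∀ {a b} f → a ≈ b [ u , v ] → sub a f ≈ sub b f [ u , v ]
  sub-mod []      e = ≋⇒≈ ≋-refl
  sub-mod (c ∷ f) e = mod-⊕ (≋⇒≈ (≋-refl {C c})) (mod-⊗ e (sub-mod f e))

∣⇒≈ : ∀ {u v f} → u ∣ₚ f → f ≈ [] [ u , v ]
∣⇒≈ {u} (k , e) = mk {k = k} {[]} (≋-trans (≋-sym e) (≋-sym (⊕-identityʳ (k ⊗ u))))

≈⇒∣ : ∀ {u f} → f ≈ [] [ u , [] ] → u ∣ₚ f
≈⇒∣ {u} (mk {k} {l} e) = k , ≋-sym (≋-trans e (≋-trans (⊕-cong (≋-refl {k ⊗ u}) (⊗-zeroʳ l)) (⊕-identityʳ (k ⊗ u))))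

∣ₚ-trans : ∀ {f g h} → f ∣ₚ g → g ∣ₚ h → f ∣ₚ h
∣ₚ-trans {f} (k , d) (l , e) = l ⊗ k , ≋-trans (⊗-assoc l k f) (≋-trans (⊗-congˡ l d) e)

∣ₚ-resp : ∀ {f g h} → g ≋ h → f ∣ₚ g → f ∣ₚ h
∣ₚ-resp d (k , e) = k , ≋-trans e d

∣ₚ-⊗ˡ : ∀ {f g} h → f ∣ₚ g → f ∣ₚ h ⊗ g
∣ₚ-⊗ˡ {f} h (k , e) = h ⊗ k , ≋-trans (⊗-assoc h k f) (⊗-congˡ h e)

∣ₚ-⊗ʳ : ∀ {f g} h → f ∣ₚ g → f ∣ₚ g ⊗ h
∣ₚ-⊗ʳ {g = g} h d = ∣ₚ-resp (⊗-comm h g) (∣ₚ-⊗ˡ h d)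

sub-∣ : ∀ u {f g} → f ∣ₚ g → sub u f ∣ₚ sub u g
sub-∣ u {f} (k , e) = sub u k , ≋-trans (≋-sym (sub-⊗ u k f)) (sub-cong u e)

-- Divisors of xⁿ − 1 divide their own reciprocals

1ₚ : Poly
1ₚ = C 1ℤ

X^-suc : ∀ n → X ↑ suc n ≋ 0ℤ ∷ X ↑ n
X^-suc n = X-⊗ (X ↑ n)

X↑-monic : ∀ n → Monic n (X ↑ n)
X↑-monic zero    = coeff-C-zero 1ℤ , coeff-C-suc 1ℤ
X↑-monic (suc n) = Lead-resp (≋-sym (X^-suc n)) (X↑-monic n)

coeff-X^⊗-< : ∀ f {n i} → i < n → coeff (X ↑ n ⊗ f) i ≡ 0ℤ
coeff-X^⊗-< f {suc n} {zero}  _       = at (≋-trans (⊗-assoc X (X ↑ n) f) (X-⊗ _)) 0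
coeff-X^⊗-< f {suc n} {suc i} (s≤s p) = ≡.trans (at (≋-trans (⊗-assoc X (X ↑ n) f) (X-⊗ _)) (suc i)) (coeff-X^⊗-< f p)

Z : ℕ → Poly
Z n = X ↑ n ⊕ C -1ℤ

Z-monic : ∀ n → Monic (suc n) (Z (suc n))
Z-monic n = step (suc n) (proj₁ (X↑-monic (suc n))) , λ i → step (suc (suc (n ℕ.+ i))) (proj₂ (X↑-monic (suc n)) i)
  where
  step : ∀ j {a} → coeff (X ↑ suc n) j ≡ a → {{ℕ.NonZero j}} → coeff (Z (suc n)) j ≡ a
  step (suc j) p = ≡.trans (coeff-⊕ (X ↑ suc n) (C -1ℤ) (suc j)) (≡.trans (cong₂ ℤ._+_ p (coeff-C-suc -1ℤ j)) (ℤ.+-identityʳ _))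

x^≋X↑ : ∀ n → (x^ n) ≋ X ↑ n
x^≋X↑ zero    = mk λ { zero → ≡.sym (coeff-C-zero 1ℤ) ; (suc i) → ≡.sym (coeff-C-suc 1ℤ i) }
x^≋X↑ (suc n) = ≋-trans (∷-cong refl (x^≋X↑ n)) (≋-sym (X^-suc n))

xⁿ-1≋Z : ∀ n → xⁿ-1 n ≋ Z n
xⁿ-1≋Z n = ⊕-cong (x^≋X↑ n) (mk λ { zero → ≡.sym (coeff-C-zero -1ℤ) ; (suc i) → ≡.sym (coeff-C-suc -1ℤ i) })

X^n≈1 : ∀ {v} n → X ↑ n ≈ 1ₚ [ Z n , v ]
X^n≈1 {v} n = mk {k = 1ₚ} {[]} (≋-trans (solve 1 (λ x → x := con 1ℤ :+ con 1ℤ :* (x :+ con -1ℤ)) ≋-refl (X ↑ n))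
  (⊕-cong (≋-refl {1ₚ}) (≋-sym (⊕-identityʳ (1ₚ ⊗ Z n)))))

1↑ : ∀ n → 1ₚ ↑ n ≋ 1ₚ
1↑ zero    = ≋-refl
1↑ (suc n) = ≋-trans (⊗-identityˡ (1ₚ ↑ n)) (1↑ n)

⊗-↑ : ∀ f g n → (f ⊗ g) ↑ n ≋ f ↑ n ⊗ g ↑ n
⊗-↑ f g zero    = ≋-sym (⊗-identityˡ 1ₚ)
⊗-↑ f g (suc n) = ≋-trans (⊗-congˡ (f ⊗ g) (⊗-↑ f g n)) (solve 4 (λ a b c d → a :* b :* (c :* d) := a :* c :* (b :* d)) ≋-refl f g (f ↑ n) (g ↑ n))

-- List reversal depends on the representing list. It computes x^(n-1) r(1/x) only for a
-- representative of length exactly n, which padding with zeros provides.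
fit : ℕ → Poly → Poly
fit zero    r       = []
fit (suc n) []      = 0ℤ ∷ fit n []
fit (suc n) (a ∷ r) = a ∷ fit n r

fit-≋ : ∀ n r → Deg< n r → fit n r ≋ r
fit-≋ zero    r       d = mk λ i → ≡.sym (d i)
fit-≋ (suc n) []      d = ≋-trans (∷-cong refl (fit-≋ n [] λ _ → refl)) 0∷[]≋[]
fit-≋ (suc n) (a ∷ r) d = ∷-cong refl (fit-≋ n r d)

length-fit : ∀ n r → length (fit n r) ≡ n
length-fit zero    r       = refl
length-fit (suc n) []      = cong suc (length-fit n [])
length-fit (suc n) (a ∷ r) = cong suc (length-fit n r)

coeff-≥length : ∀ f {i} → length f ≤ i → coeff f i ≡ 0ℤ
coeff-≥length []      _       = refl
coeff-≥length (a ∷ f) (s≤s p) = coeff-≥length f p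

coeff-⊗-≥length : ∀ f g {i} → length f ℕ.+ length g ≤ suc i → coeff (f ⊗ g) i ≡ 0ℤ
coeff-⊗-≥length []      g         p = refl
coeff-⊗-≥length (a ∷ f) g {i} (s≤s p) = ≡.trans (coeff-∷⊗ a f g i) (cong₂ ℤ._+_
  (≡.trans (cong (a ℤ.*_) (coeff-≥length g (ℕ.≤-trans (ℕ.m≤n+m (length g) (length f)) p))) (ℤ.*-zeroʳ a))
  (shift i p))
  where
  shift : ∀ i → length f ℕ.+ length g ≤ i → coeff (0ℤ ∷ f ⊗ g) i ≡ 0ℤ
  shift zero    _ = refl
  shift (suc i) p = coeff-⊗-≥length f g p

++-≋ : ∀ f g → f ++ g ≋ f ⊕ X ↑ length f ⊗ g
++-≋ []      g = ≋-sym (⊗-identityˡ g)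
++-≋ (a ∷ f) g = ≋-trans (∷-cong (≡.sym (ℤ.+-identityʳ a)) (++-≋ f g))
  (⊕-cong (≋-refl {a ∷ f}) (≋-trans (≋-sym (X-⊗ (X ↑ length f ⊗ g))) (≋-sym (⊗-assoc X (X ↑ length f) g))))

coeff-⊗-++ : ∀ f u v {i} → i < length u → coeff (f ⊗ (u ++ v)) i ≡ coeff (f ⊗ u) i
coeff-⊗-++ f u v {i} i< = ≡.trans (at eq i) (≡.trans (coeff-⊕ (f ⊗ u) _ i)
  (≡.trans (cong (λ z → coeff (f ⊗ u) i ℤ.+ z) (coeff-X^⊗-< (f ⊗ v) i<)) (ℤ.+-identityʳ _)))
  where
  eq : f ⊗ (u ++ v) ≋ f ⊗ u ⊕ X ↑ length u ⊗ (f ⊗ v)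
  eq = ≋-trans (⊗-congˡ f (++-≋ u v)) (solve 4 (λ f u x v → f :* (u :+ x :* v) := f :* u :+ x :* (f :* v)) ≋-refl f u (X ↑ length u) v)

sumSq : Poly → ℕ
sumSq []      = 0
sumSq (a ∷ f) = ℤ.∣ a ∣ ℕ.* ℤ.∣ a ∣ ℕ.+ sumSq f

sumSq≡0⇒≋[] : ∀ f → sumSq f ≡ 0 → f ≋ []
sumSq≡0⇒≋[] []      _ = ≋-refl
sumSq≡0⇒≋[] (a ∷ f) e = ≋-trans (∷-cong a≡0 (sumSq≡0⇒≋[] f (ℕ.m+n≡0⇒n≡0 (ℤ.∣ a ∣ ℕ.* ℤ.∣ a ∣) e))) 0∷[]≋[]
  where
  a≡0 : a ≡ 0ℤ
  a≡0 = ℤ.∣i∣≡0⇒i≡0 ([ (λ p → p) , (λ p → p) ]′ (ℕ.m*n≡0⇒m≡0∨n≡0 ℤ.∣ a ∣ (ℕ.m+n≡0⇒m≡0 _ e)))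

coeff-++-length : ∀ f a → coeff (f ++ a ∷ []) (length f) ≡ a
coeff-++-length []      a = refl
coeff-++-length (b ∷ f) a = coeff-++-length f a

a*a≡∣a∣² : ∀ a → a ℤ.* a ≡ + (ℤ.∣ a ∣ ℕ.* ℤ.∣ a ∣)
a*a≡∣a∣² (+ n)    = ≡.sym (ℤ.pos-* n n)
a*a≡∣a∣² -[1+ n ] = refl

-- The head of `f` meets the last entry of the reversal, which is that head again; for the tail,
-- this last entry lies too high to contribute.
coeff-⊗-reverse : ∀ n f → length f ≡ suc n → coeff (f ⊗ reverse f) n ≡ + sumSq f
coeff-⊗-reverse n (a ∷ f) e = ≡.trans (cong (λ g → coeff ((a ∷ f) ⊗ g) n) (List.unfold-reverse a f))
  (≡.trans (coeff-∷⊗ a f (reverse f ++ a ∷ []) n)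
  (≡.trans (cong₂ ℤ._+_ (cong (a ℤ.*_) (last e)) (rest n f e)) (≡.trans (cong (λ z → z ℤ.+ + sumSq f) (a*a≡∣a∣² a)) (≡.sym (ℤ.pos-+ _ (sumSq f))))))
  where
  last : length (a ∷ f) ≡ suc n → coeff (reverse f ++ a ∷ []) n ≡ a
  last e = ≡.trans (cong (coeff (reverse f ++ a ∷ [])) (≡.trans (≡.sym (ℕ.suc-injective e)) (≡.sym (List.length-reverse f)))) (coeff-++-length (reverse f) a)
  rest : ∀ n f → length (a ∷ f) ≡ suc n → coeff (0ℤ ∷ f ⊗ (reverse f ++ a ∷ [])) n ≡ + sumSq f
  rest zero    []      e = refl
  rest (suc n) f       e = ≡.trans (coeff-⊗-++ f (reverse f) (a ∷ []) (ℕ.≤-reflexive (≡.sym (≡.trans (List.length-reverse f) (ℕ.suc-injective e)))))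
    (coeff-⊗-reverse n f (ℕ.suc-injective e))

-- Modulo x^n - 1 the power `Y` = x^(n-1) is inverse to x, so `σ` realizes f(x) ↦ f(1/x) by an
-- ordinary substitution, without Laurent polynomials.
module Reciprocal (N : ℕ) where
  n = suc N
  Y = X ↑ N

  σ : Poly → Poly
  σ = sub Y

  private
    _≈ᶻ_ : Poly → Poly → Set
    f ≈ᶻ g = f ≈ g [ Z n , [] ]
    infix 4 _≈ᶻ_

  YX≈1 : Y ⊗ X ≈ᶻ 1ₚ
  YX≈1 = mod-trans (≋⇒≈ (⊗-comm Y X)) (X^n≈1 n)

  σZ≈0 : σ (Z n) ≈ᶻ []
  σZ≈0 = mod-trans (≋⇒≈ eq) (mod-trans (mod-⊕ (mod-↑ N (X^n≈1 n)) (≋⇒≈ (≋-refl {C -1ℤ}))) (≋⇒≈ zero′))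
    where
    eq : σ (Z n) ≋ (X ↑ n) ↑ N ⊕ C -1ℤ
    eq = begin
      σ (X ↑ n ⊕ C -1ℤ)        ≈⟨ sub-⊕ Y (X ↑ n) (C -1ℤ) ⟩
      σ (X ↑ n) ⊕ σ (C -1ℤ)    ≈⟨ ⊕-cong (≋-trans (sub-↑ Y X n) (↑-cong (sub-X Y) (refl {x = n}))) (sub-C Y -1ℤ) ⟩
      Y ↑ n ⊕ C -1ℤ            ≈⟨ ⊕-cong (≋-trans (↑-* X N n) (≋-trans (≋-reflexive (cong (X ↑_) (ℕ.*-comm N n))) (≋-sym (↑-* X n N)))) (≋-refl {C -1ℤ}) ⟩
      (X ↑ n) ↑ N ⊕ C -1ℤ      ∎
    zero′ : 1ₚ ↑ N ⊕ C -1ℤ ≋ []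
    zero′ = ≋-trans (⊕-cong (1↑ N) (≋-refl {C -1ℤ})) (≋-trans (≋-sym (C-+ 1ℤ -1ℤ)) C-0)

  σ-mod : ∀ {f g} → f ≈ᶻ g → σ f ≈ᶻ σ g
  σ-mod e = mod-mono σZ≈0 modʳ (mod-sub Y e)

  σσ : ∀ f → σ (σ f) ≈ᶻ f
  σσ f = mod-trans (≋⇒≈ (sub-sub Y Y f)) (mod-trans (sub-mod f (mod-trans (≋⇒≈ (≋-trans (sub-↑ Y X N) (↑-cong (sub-X Y) (refl {x = N})))) Y^N≈X)) (≋⇒≈ (sub-X-id f)))
    where
    Y^N≈X : Y ↑ N ≈ᶻ X
    Y^N≈X = mod-trans (mod-sym (mod-trans (mod-⊗ˡ (Y ↑ N) YX≈1) (≋⇒≈ (≋-trans (⊗-comm (Y ↑ N) 1ₚ) (⊗-identityˡ (Y ↑ N))))))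
      (mod-trans (≋⇒≈ (≋-trans (≋-sym (⊗-assoc (Y ↑ N) Y X)) (⊗-cong (≋-sym (⊗-↑ Y X N)) (≋-refl {X}))))
      (mod-trans (mod-⊗ʳ X (mod-↑ N YX≈1)) (≋⇒≈ (≋-trans (⊗-cong (1↑ N) (≋-refl {X})) (⊗-identityˡ X)))))

  -- The extra factor `X` replaces an exponent length - 1, so the empty list is no exception; being
  -- invertible modulo `Z n`, it can be removed afterwards.
  X^σ≈reverse : ∀ r → X ↑ length r ⊗ σ r ≈ᶻ X ⊗ reverse r
  X^σ≈reverse []      = ≋⇒≈ (≋-trans (⊗-zeroʳ 1ₚ) (≋-sym (⊗-zeroʳ X)))
  X^σ≈reverse (a ∷ r) = mod-trans (≋⇒≈ (solve 5 (λ a x y z s → x :* z :* (a :+ y :* s) := x :* z :* a :+ (y :* x) :* (z :* s)) ≋-refl (C a) X Y (X ↑ length r) (σ r)))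
    (mod-trans (mod-⊕ (≋⇒≈ ≋-refl) (mod-⊗ YX≈1 (X^σ≈reverse r)))
    (≋⇒≈ (≋-trans (solve 4 (λ a x z s → x :* z :* a :+ con 1ℤ :* (x :* s) := x :* (s :+ z :* a)) ≋-refl (C a) X (X ↑ length r) (reverse r))
      (⊗-congˡ X (≋-sym (≋-trans (≋-reflexive (List.unfold-reverse a r)) (≋-trans (++-≋ (reverse r) (a ∷ []))
        (⊕-cong (≋-refl {reverse r}) (⊗-cong (≋-reflexive (cong (X ↑_) (List.length-reverse r))) (mk λ { zero → ≡.sym (coeff-C-zero a) ; (suc i) → ≡.sym (coeff-C-suc a i) }))))))))))

  -- The coefficient of xⁿ⁻¹ in r(x) · xⁿ⁻¹ r(1/x) is Σ rᵢ², and it vanishes in every multiple of xⁿ − 1 of degree at most 2n − 2.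
  ⊗σ≈0⇒≋[] : ∀ r → length r ≡ n → r ⊗ σ r ≈ᶻ [] → r ≋ []
  ⊗σ≈0⇒≋[] r len e = sumSq≡0⇒≋[] r (ℤ.+-injective (≡.trans (≡.sym (coeff-⊗-reverse N r len)) (≡.trans (≡.sym (at gZ N)) coeff-N)))
    where
    s = reverse r
    X⊗rs≈0 : X ⊗ (r ⊗ s) ≈ᶻ []
    X⊗rs≈0 = mod-trans (≋⇒≈ (solve 3 (λ x r s → x :* (r :* s) := r :* (x :* s)) ≋-refl X r s))
      (mod-trans (mod-⊗ˡ r (mod-sym (X^σ≈reverse r)))
      (mod-trans (≋⇒≈ (solve 3 (λ x r s → r :* (x :* s) := x :* (r :* s)) ≋-refl (X ↑ length r) r (σ r)))
      (mod-trans (mod-⊗ˡ (X ↑ length r) e) (≋⇒≈ (⊗-zeroʳ (X ↑ length r))))))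
    rs≈0 : r ⊗ s ≈ᶻ []
    rs≈0 = mod-trans (≋⇒≈ (≋-sym (⊗-identityˡ (r ⊗ s)))) (mod-trans (mod-⊗ʳ (r ⊗ s) (mod-sym YX≈1))
      (mod-trans (≋⇒≈ (⊗-assoc Y X (r ⊗ s))) (mod-trans (mod-⊗ˡ Y X⊗rs≈0) (≋⇒≈ (⊗-zeroʳ Y)))))
    g = proj₁ (≈⇒∣ rs≈0)
    gZ : g ⊗ Z n ≋ r ⊗ s
    gZ = proj₂ (≈⇒∣ rs≈0)
    -- The index n + N is 2n - 1, just beyond the degree of r s. So `g` has degree below `N`, while
    -- the coefficient of x^N in x^n g - g is minus that of `g`.
    high : ∀ i → coeff (g ⊗ Z n) (n ℕ.+ (N ℕ.+ i)) ≡ 0ℤ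
    high i = ≡.trans (at gZ _) (coeff-⊗-≥length r s (ℕ.≤-trans (ℕ.≤-reflexive (≡.trans (cong₂ ℕ._+_ len (≡.trans (List.length-reverse r) len)) (ℕ.+-suc n N)))
      (s≤s (ℕ.+-monoʳ-≤ n (ℕ.m≤m+n N i)))))
    g-N : coeff g N ≡ 0ℤ
    g-N = ≡.trans (cong (coeff g) (≡.sym (ℕ.+-identityʳ N))) (ℤ.0∣⇒≡0 (lead-∣ {c = 0ℤ} (1-regular 0ℤ) (Z-monic N) N g (λ i → ℤ.∣-reflexive (≡.sym (high i))) 0))
    coeff-N : coeff (g ⊗ Z n) N ≡ 0ℤ
    coeff-N = ≡.trans (at (solve 2 (λ g x → g :* (x :+ con -1ℤ) := x :* g :+ :- g) ≋-refl g (X ↑ n)) N)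
      (≡.trans (coeff-⊕ (X ↑ n ⊗ g) (⊝ g) N) (cong₂ ℤ._+_ (coeff-X^⊗-< g (ℕ.n<1+n N)) (≡.trans (coeff-⊝ g N) (cong (λ z → ℤ.- z) g-N))))

  -- Put w = σf · h. Then w · σw is a multiple of f · h, so w vanishes modulo xⁿ − 1 = f · h.
  ∣Z⇒∣σ : ∀ {f} → f ∣ₚ Z n → f ∣ₚ σ f
  ∣Z⇒∣σ {f} (h , hf≋Z) = proj₁ w≈0 , monic-cancel (proj₁ w≈0 ⊗ f) (σ f) (Z-monic N) (begin
      (k ⊗ f) ⊗ Z n    ≈⟨ solve 3 (λ k f z → k :* f :* z := (k :* z) :* f) ≋-refl k f (Z n) ⟩
      (k ⊗ Z n) ⊗ f    ≈⟨ ⊗-cong (proj₂ w≈0) (≋-refl {f}) ⟩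
      (σ f ⊗ h) ⊗ f    ≈⟨ ⊗-assoc (σ f) h f ⟩
      σ f ⊗ (h ⊗ f)    ≈⟨ ⊗-congˡ (σ f) hf≋Z ⟩
      σ f ⊗ Z n        ∎)
    where
    w = σ f ⊗ h
    div = monic-divMod (Z-monic N) w
    r = fit n (proj₁ (proj₂ div))
    w≈r : w ≈ᶻ r
    w≈r = mk {k = proj₁ div} {[]} (≋-trans (proj₁ (proj₂ (proj₂ div))) (≋-trans (⊕-comm (proj₁ div ⊗ Z n) _)
      (⊕-cong (≋-sym (fit-≋ n _ (proj₂ (proj₂ (proj₂ div))))) (≋-sym (⊕-identityʳ (proj₁ div ⊗ Z n))))))
    fh≈0 : h ⊗ f ≈ᶻ []
    fh≈0 = mod-trans (≋⇒≈ hf≋Z) modˡ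
    wσw≈0 : w ⊗ σ w ≈ᶻ []
    wσw≈0 = mod-trans (mod-⊗ˡ w (mod-trans (≋⇒≈ (sub-⊗ Y (σ f) h)) (mod-⊗ʳ (σ h) (σσ f))))
      (mod-trans (≋⇒≈ (solve 4 (λ a h f b → a :* h :* (f :* b) := (a :* b) :* (h :* f)) ≋-refl (σ f) h f (σ h)))
      (mod-trans (mod-⊗ˡ (σ f ⊗ σ h) fh≈0) (≋⇒≈ (⊗-zeroʳ (σ f ⊗ σ h)))))
    r≋[] : r ≋ []
    r≋[] = ⊗σ≈0⇒≋[] r (length-fit n (proj₁ (proj₂ div))) (mod-trans (mod-sym (mod-⊗ w≈r (σ-mod w≈r))) wσw≈0)
    w≈0 : Z n ∣ₚ w
    w≈0 = ≈⇒∣ (mod-trans w≈r (≋⇒≈ r≋[]))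
    k = proj₁ w≈0

-- The Frobenius congruence

[k+1]*[n+1]C[k+1]≡[n+1]*nCk : ∀ n k → suc k ℕ.* (suc n Comb.C suc k) ≡ suc n ℕ.* (n Comb.C k)
[k+1]*[n+1]C[k+1]≡[n+1]*nCk zero    zero    = refl
[k+1]*[n+1]C[k+1]≡[n+1]*nCk zero    (suc k) = ≡.trans (cong (suc (suc k) ℕ.*_) (Comb.k>n⇒nCk≡0 {1} {suc (suc k)} (s≤s (s≤s z≤n)))) (≡.trans (ℕ.*-zeroʳ k)
  (≡.sym (≡.trans (ℕ.*-identityˡ _) (Comb.k>n⇒nCk≡0 {0} {suc k} (s≤s z≤n)))))
[k+1]*[n+1]C[k+1]≡[n+1]*nCk (suc n) zero    = ≡.trans (ℕ.*-identityˡ _) (≡.trans (Comb.nC1≡n (suc (suc n))) (≡.sym (ℕ.*-identityʳ _)))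
[k+1]*[n+1]C[k+1]≡[n+1]*nCk (suc n) (suc k) =
  ≡.trans (cong (suc (suc k) ℕ.*_) (≡.sym (Comb.nCk+nC[k+1]≡[n+1]C[k+1] (suc n) (suc k))))
  (≡.trans (ℕ.*-distribˡ-+ (suc (suc k)) e _)
  (≡.trans (cong₂ (λ s t → e ℕ.+ s ℕ.+ t) ([k+1]*[n+1]C[k+1]≡[n+1]*nCk n k) ([k+1]*[n+1]C[k+1]≡[n+1]*nCk n (suc k)))
  (≡.trans (ℕ.+-assoc e _ _) (cong (e ℕ.+_) (≡.trans (≡.sym (ℕ.*-distribˡ-+ (suc n) c d)) (cong (suc n ℕ.*_) (Comb.nCk+nC[k+1]≡[n+1]C[k+1] n k)))))))
  where
  c = n Comb.C k
  d = n Comb.C suc k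
  e = suc n Comb.C suc k

-- The absorption identity makes (k+1) · C(q , k+1) a multiple of q, and k + 1 < q is not one.
prime∣nCk : ∀ {q} → Prime q → ∀ k → suc k < q → q ∣ (q Comb.C suc k)
prime∣nCk {suc m} pr k k<q = [ (λ q∣k → contradiction (∣⇒≤ q∣k) (ℕ.<⇒≱ k<q)) , (λ d → d) ]′
  (euclidsLemma (suc k) (suc m Comb.C suc k) pr (divides (m Comb.C k) (≡.trans ([k+1]*[n+1]C[k+1]≡[n+1]*nCk m k) (ℕ.*-comm (suc m) _))))

×≋C⊗ : ∀ n f → n Mult.× f ≋ C (+ n) ⊗ f
×≋C⊗ zero    f = ≋-sym (⊗-cong C-0 (≋-refl {f}))
×≋C⊗ (suc n) f = ≋-trans (⊕-cong (≋-refl {f}) (×≋C⊗ n f)) (≋-trans (solve 2 (λ f n → f :+ n :* f := (con 1ℤ :+ n) :* f) ≋-refl f (C (+ n)))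
  (⊗-cong (≋-sym (C-+ 1ℤ (+ n))) (≋-refl {f})))

∣×⇒≈0 : ∀ {q n v} f → q ∣ n → n Mult.× f ≈ [] [ C (+ q) , v ]
∣×⇒≈0 {q} f (divides m refl) = mod-trans (≋⇒≈ (≋-trans (×≋C⊗ (m ℕ.* q) f) (≋-trans (⊗-cong (≋-trans (≋-reflexive (cong C (ℤ.pos-* m q))) (C-* (+ m) (+ q))) (≋-refl {f}))
  (solve 3 (λ m q f → m :* q :* f := m :* f :* q) ≋-refl (C (+ m)) (C (+ q)) f)))) (mod-trans (mod-⊗ˡ (C (+ m) ⊗ f) modˡ) (≋⇒≈ (⊗-zeroʳ (C (+ m) ⊗ f))))

sum≈0 : ∀ {u v n} (t : Fin n → Poly) → (∀ i → t i ≈ [] [ u , v ]) → Sum.sum t ≈ [] [ u , v ]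
sum≈0 {n = zero}  t h = ≋⇒≈ ≋-refl
sum≈0 {n = suc n} t h = mod-⊕ (h zero) (sum≈0 (λ i → t (suc i)) (λ i → h (suc i)))

freshman : ∀ {q v} → Prime q → ∀ f g → (f ⊕ g) ↑ q ≈ f ↑ q ⊕ g ↑ q [ C (+ q) , v ]
freshman {suc m} {v} pr f g = mod-trans (≋⇒≈ (≋-trans (Binomial.theorem q f g) (⊕-cong first (≋-trans (Sum.sum-init-last rest) (⊕-cong (≋-refl {Sum.sum middle}) last′)))))
  (mod-trans (mod-⊕ (≋⇒≈ (≋-refl {g ↑ q})) (mod-⊕ (sum≈0 middle middle≈0) (≋⇒≈ (≋-refl {f ↑ q})))) (≋⇒≈ (⊕-comm (g ↑ q) (f ↑ q))))
  where
  q = suc m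
  term : Fin (suc q) → Poly
  term = Binomial.binomialTerm f g q
  rest : Fin (suc m) → Poly
  rest i = term (suc i)
  middle : Fin m → Poly
  middle i = rest (inject₁ i)
  first : term zero ≋ g ↑ q
  first = ≋-trans (×≋C⊗ (q Comb.C 0) (1ₚ ⊗ g ↑ q)) (≋-trans (⊗-cong (≋-reflexive (cong (λ z → C (+ z)) (≡.trans (Comb.nCk≡nC[n∸k] {0} {q} z≤n) (Comb.nCn≡1 q)))) (⊗-identityˡ (g ↑ q))) (⊗-identityˡ (g ↑ q)))
  last′ : rest (fromℕ m) ≋ f ↑ q
  last′ = ≋-trans (×≋C⊗ _ _) (≋-trans (⊗-cong (≋-reflexive (cong (λ z → C (+ z)) (≡.trans (cong (q Comb.C_) (cong suc (Fin.toℕ-fromℕ m))) (Comb.nCn≡1 q))))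
      (⊗-cong (≋-reflexive (cong (f ↑_) (cong suc (Fin.toℕ-fromℕ m)))) (≋-reflexive (cong (g ↑_) (≡.trans (cong (m ∸_) (Fin.toℕ-fromℕ m)) (ℕ.n∸n≡0 m))))))
      (solve 1 (λ f → con 1ℤ :* (f :* con 1ℤ) := f) ≋-refl (f ↑ q)))
  middle≈0 : ∀ i → middle i ≈ [] [ C (+ q) , v ]
  middle≈0 i = ∣×⇒≈0 (Binomial.binomial f g q (suc (inject₁ i))) (prime∣nCk pr (toℕ (inject₁ i)) (s≤s (ℕ.≤-trans (s≤s (ℕ.≤-reflexive (Fin.toℕ-inject₁ i))) (Fin.toℕ<n i))))

-- Fermat's congruence is a hypothesis on the coefficients because the polynomials in question have
-- only coefficients 1 and -1, for which it is immediate when q is odd.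
frobenius : ∀ {q v} → Prime q → ∀ f → All (λ a → C a ↑ q ≈ C a [ C (+ q) , v ]) f → f ↑ q ≈ sub (X ↑ q) f [ C (+ q) , v ]
frobenius {suc m} pr []      []       = ≋⇒≈ ≋-refl
frobenius {q}     pr (a ∷ f) (pa ∷ pf) = mod-trans (≋⇒≈ (↑-cong (∷≋ a f) (refl {x = q})))
  (mod-trans (freshman pr (C a) (X ⊗ f)) (mod-⊕ pa (mod-trans (≋⇒≈ (⊗-↑ X f q)) (mod-⊗ˡ (X ↑ q) (frobenius pr f pf)))))

sub-X^-X^ : ∀ m n → sub (X ↑ m) (X ↑ n) ≋ X ↑ (m ℕ.* n)
sub-X^-X^ m n = ≋-trans (sub-↑ (X ↑ m) X n) (≋-trans (↑-cong (sub-X (X ↑ m)) (refl {x = n})) (↑-* X m n))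

subᵘ-cong : ∀ {u w} f → u ≋ w → sub u f ≋ sub w f
subᵘ-cong []      e = ≋-refl
subᵘ-cong (a ∷ f) e = ⊕-cong (≋-refl {C a}) (⊗-cong e (subᵘ-cong f e))

sub-X^-sub-X^ : ∀ m n f → sub (X ↑ m) (sub (X ↑ n) f) ≋ sub (X ↑ (m ℕ.* n)) f
sub-X^-sub-X^ m n f = ≋-trans (sub-sub (X ↑ m) (X ↑ n) f) (subᵘ-cong f (sub-X^-X^ m n))

sub-X^1 : ∀ f → sub (X ↑ 1) f ≋ f
sub-X^1 f = ≋-trans (subᵘ-cong f (solve 1 (λ x → x :* con 1ℤ := x) ≋-refl X)) (sub-X-id f)

-- The congruence for Q = q^j is raised to the q-th power, and x^Q is substituted into `h`;
-- substitution fixes the constant q, so the modulus survives.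
frobenius-iterate : ∀ {q} P → P ↑ q ≈ sub (X ↑ q) P [ C (+ q) , [] ] → ∀ j → P ↑ (q ℕ.^ j) ≈ sub (X ↑ (q ℕ.^ j)) P [ C (+ q) , [] ]
frobenius-iterate     P h zero    = ≋⇒≈ (≋-trans (solve 1 (λ x → x :* con 1ℤ := x) ≋-refl P) (≋-sym (sub-X^1 P)))
frobenius-iterate {q} P h (suc j) = mod-trans (≋⇒≈ (≋-trans (≋-reflexive (cong (P ↑_) (ℕ.*-comm q Q))) (≋-sym (↑-* P Q q))))
  (mod-trans (mod-↑ q (frobenius-iterate P h j))
  (mod-trans (≋⇒≈ (≋-sym (sub-↑ (X ↑ Q) P q)))
  (mod-trans (mod-mono (mod-trans (≋⇒≈ (sub-C (X ↑ Q) (+ q))) modˡ) modʳ (mod-sub (X ↑ Q) h))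
  (≋⇒≈ (≋-trans (sub-X^-sub-X^ Q q P) (subᵘ-cong P (≋-reflexive (cong (X ↑_) (ℕ.*-comm Q q)))))))))
  where Q = q ℕ.^ j

-- Irreducibility of the cyclotomic factors

Lead-⊗ : ∀ {d e a b} f g → Lead d a f → Lead e b g → Lead (d ℕ.+ e) (a ℤ.* b) (f ⊗ g)
Lead-⊗ {zero}  {e} {a} {b} f g (p , q) (r , s) = ≡.trans (at eq e) (≡.trans (coeff-C⊗ a g e) (cong (a ℤ.*_) r)) ,
  λ i → ≡.trans (at eq (suc (e ℕ.+ i))) (≡.trans (coeff-C⊗ a g _) (≡.trans (cong (a ℤ.*_) (s i)) (ℤ.*-zeroʳ a)))
  where
  eq : f ⊗ g ≋ C a ⊗ g
  eq = ⊗-cong {f} {C a} (mk λ { zero → ≡.trans p (≡.sym (coeff-C-zero a)) ; (suc i) → ≡.trans (q i) (≡.sym (coeff-C-suc a i)) }) (≋-refl {g})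
Lead-⊗ {suc d} {e} {a} {b} []      g (p , q) l = ≡.sym (cong (ℤ._* b) (≡.sym p)) , λ _ → refl
Lead-⊗ {suc d} {e} {a} {b} (c ∷ f) g (p , q) (r , s) = lower (d ℕ.+ e) (d , ℕ.+-comm d e) (proj₁ ih) ,
  λ i → lower (suc (d ℕ.+ e ℕ.+ i)) (suc (d ℕ.+ i) , ≡.trans (cong (λ z → suc (z ℕ.+ i)) (ℕ.+-comm d e)) (≡.trans (cong suc (ℕ.+-assoc e d i)) (≡.sym (ℕ.+-suc e (d ℕ.+ i))))) (proj₂ ih i)
  where
  ih = Lead-⊗ f g (p , q) (r , s)
  lower : ∀ j {x} → ∃[ i ] j ≡ e ℕ.+ i → coeff (f ⊗ g) j ≡ x → coeff ((c ∷ f) ⊗ g) (suc j) ≡ x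
  lower _ (i , refl) h = ≡.trans (coeff-∷⊗ c f g _) (≡.trans (cong₂ ℤ._+_ (≡.trans (cong (c ℤ.*_) (s i)) (ℤ.*-zeroʳ c)) h) (ℤ.+-identityˡ _))

Lead-unique : ∀ {d e a b f g} → f ≋ g → a ≢ 0ℤ → b ≢ 0ℤ → Lead d a f → Lead e b g → a ≡ b
Lead-unique {d} {e} {f = f} {g} f≋g a≢0 b≢0 (p , q) (r , s) with ℕ.<-cmp d e
... | tri< d<e _ _ = contradiction (≡.trans (≡.sym r) (≡.trans (≡.sym (at f≋g e)) (≡.trans (cong (coeff f) (≡.sym (ℕ.m+[n∸m]≡n d<e))) (q (e ∸ suc d))))) b≢0
... | tri≈ _ refl _ = ≡.trans (≡.sym p) (≡.trans (at f≋g d) r)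
... | tri> _ _ e<d = contradiction (≡.trans (≡.sym p) (≡.trans (at f≋g d) (≡.trans (cong (coeff g) (≡.sym (ℕ.m+[n∸m]≡n e<d))) (s (d ∸ suc e))))) a≢0

Monic⇒≢[] : ∀ {d f} → Monic d f → ¬ f ≋ []
Monic⇒≢[] {d} (p , _) e = contradiction (≡.trans (≡.sym p) (at e d)) λ ()

monic-factor : ∀ {d e} f g {h} → f ⊗ g ≋ h → Monic d g → Monic e h → ∃[ k ] Monic k f
monic-factor f g eq mg mh with trim f
... | inj₁ f≋[] = contradiction (≋-trans (≋-sym eq) (⊗-cong f≋[] (≋-refl {g}))) (Monic⇒≢[] mh)
... | inj₂ (k , a , a≢0 , l) = k , subst (λ z → Lead k z f) (≡.trans (≡.sym (ℤ.*-identityʳ a))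
  (Lead-unique eq (λ z → a≢0 (≡.trans (≡.sym (ℤ.*-identityʳ a)) z)) (λ ()) (Lead-⊗ f g l mg) mh)) l

↑-monic : ∀ {d} f n → Monic d f → ∃[ e ] Monic e (f ↑ n)
↑-monic f zero    m = 0 , X↑-monic 0
↑-monic f (suc n) m = _ , Lead-⊗ f (f ↑ n) m (proj₂ (↑-monic f n m))

sub-X^-monic : ∀ {d} Q f → Monic d f → ∃[ e ] Monic e (sub (X ↑ suc Q) f)
sub-X^-monic         Q []      (() , _)
sub-X^-monic {zero}  Q (a ∷ f) (p , q) = 0 , Lead-resp (≋-sym (≋-trans (sub-cong (X ↑ suc Q) {a ∷ f} {C 1ℤ}
  (mk λ { zero → ≡.trans p (≡.sym (coeff-C-zero 1ℤ)) ; (suc i) → ≡.trans (q i) (≡.sym (coeff-C-suc 1ℤ i)) })) (sub-C (X ↑ suc Q) 1ℤ))) (X↑-monic 0)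
sub-X^-monic {suc d} Q (a ∷ f) (p , q) with sub-X^-monic {d} Q f (p , q)
... | e , m = suc Q ℕ.+ e , ≡.trans (high (Q ℕ.+ e)) (proj₁ top) , λ i → ≡.trans (high _) (proj₂ top i)
  where
  top = Lead-⊗ (X ↑ suc Q) (sub (X ↑ suc Q) f) (X↑-monic (suc Q)) m
  high : ∀ j → coeff (C a ⊕ X ↑ suc Q ⊗ sub (X ↑ suc Q) f) (suc j) ≡ coeff (X ↑ suc Q ⊗ sub (X ↑ suc Q) f) (suc j)
  high j = ≡.trans (coeff-⊕ (C a) (X ↑ suc Q ⊗ sub (X ↑ suc Q) f) (suc j)) (≡.trans (cong (λ z → z ℤ.+ coeff (X ↑ suc Q ⊗ sub (X ↑ suc Q) f) (suc j)) (coeff-C-suc a j)) (ℤ.+-identityˡ _))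

∣coeff∣≤H : ∀ f i → ℤ.∣ coeff f i ∣ ≤ H f
∣coeff∣≤H []      i       = z≤n
∣coeff∣≤H (a ∷ f) zero    = ℕ.m≤m⊔n ℤ.∣ a ∣ (H f)
∣coeff∣≤H (a ∷ f) (suc i) = ℕ.≤-trans (∣coeff∣≤H f i) (ℕ.m≤n⊔m ℤ.∣ a ∣ (H f))

-- Used with n the height of a polynomial: coefficients divisible by q^n must then vanish.
n<m^n : ∀ {m} → 1 < m → ∀ n → n < m ℕ.^ n
n<m^n         1<m zero    = s≤s z≤n
n<m^n {m}     1<m (suc n) = ℕ.≤-trans (s≤s (n<m^n 1<m n)) (ℕ.≤-trans (ℕ.≤-trans (ℕ.+-monoˡ-≤ M (ℕ.≤-trans (s≤s z≤n) (n<m^n 1<m n))) (ℕ.≤-reflexive (cong (M ℕ.+_) (≡.sym (ℕ.+-identityʳ M))))) (ℕ.*-monoˡ-≤ M 1<m))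
  where M = m ℕ.^ n

C-↑ : ∀ a n → C a ↑ n ≋ C (a ℤ.^ n)
C-↑ a zero    = ≋-refl
C-↑ a (suc n) = ≋-trans (⊗-congˡ (C a) (C-↑ a n)) (≋-sym (C-* a (a ℤ.^ n)))

mem⇒∣ᶜ : ∀ {c d P} r → Monic d P → Deg< d r → r ≈ [] [ P , C c ] → c ∣ᶜ r
mem⇒∣ᶜ {c} {d} {P} r m r< (mk {k} {l} e) = proj₂ (monic-∣ (⊝ k) r m r< (C⊗⇒∣ᶜ {g = l}
  (≋-trans (⊕-cong (≋-refl {⊝ k ⊗ P}) e) (solve 4 (λ k P l c → :- k :* P :+ (k :* P :+ l :* c) := c :* l) ≋-refl k P l (C c)))))

∣ᶜ⇒mem : ∀ {c P} r → c ∣ᶜ r → r ≈ [] [ P , C c ]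
∣ᶜ⇒mem {c} r d with ∣ᶜ⇒C⊗ r d
... | g , e = mod-trans (≋⇒≈ (≋-trans e (⊗-comm (C c) g))) (mod-trans (mod-⊗ˡ g modʳ) (≋⇒≈ (⊗-zeroʳ g)))

remainder : ∀ {d P v} → Monic d P → ∀ f → ∃[ r ] f ≈ r [ P , v ] × Deg< d r
remainder {P = P} m f with monic-divMod m f
... | k , r , e , r< = r , mk {k = k} {[]} (≋-trans e (≋-trans (⊕-comm (k ⊗ P) r) (⊕-cong (≋-refl {r}) (≋-sym (⊕-identityʳ (k ⊗ P)))))) , r<

-- The remainder modulo the monic `P` is a normal form, so membership is divisibility of finitely
-- many coefficients. It decides constructively whether another factor `P` can be split off in
-- `expand-to`.
mem? : ∀ {d P} → Monic d P → ∀ c f → Dec (f ≈ [] [ P , C c ])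
mem? m c f with remainder m f
... | r , f≈r , r< with ∣ᶜ? c r
...   | yes c∣r = yes (mod-trans f≈r (∣ᶜ⇒mem r c∣r))
...   | no c∤r  = no λ f≈0 → c∤r (mem⇒∣ᶜ r m r< (mod-trans (mod-sym f≈r) f≈0))

-- A substitute for primality of the ideal (P , c), which holds even if Z[x]/(P , c) is only reduced.
Separates : (Poly → Poly) → Poly → ℤ → Set
Separates σ P c = ∀ f h → f ⊗ h ≈ [] [ P , C c ] → σ f ⊗ h ≈ [] [ P , C c ] → f ≈ [] [ P , C c ] ⊎ h ≈ [] [ P , C c ]

-- Primality with one more premise, which reciprocity supplies whenever `f` divides x^n - 1.
PrimeUpTo : (Poly → Poly) → Poly → Set
PrimeUpTo σ φ = ∀ f h → φ ∣ₚ f ⊗ h → φ ∣ₚ σ f ⊗ h → φ ∣ₚ f ⊎ φ ∣ₚ h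

mem₀⇒∣ : ∀ {P f} → f ≈ [] [ P , C 0ℤ ] → P ∣ₚ f
mem₀⇒∣ e = ≈⇒∣ (mod-mono modˡ (≋⇒≈ C-0) e)

separates₀⇒prime : ∀ σ {P} → Separates σ P 0ℤ → PrimeUpTo σ P
separates₀⇒prime σ s f h d d′ = [ (λ e → inj₁ (mem₀⇒∣ e)) , (λ e → inj₂ (mem₀⇒∣ e)) ]′ (s f h (∣⇒≈ d) (∣⇒≈ d′))

-- In A = Z[x]/(φ) the prime q equals a unit times a power of the nonzerodivisor P, and ⋂ qᵏ A = 0.
-- So every nonzero f ∈ A is P ↑ a · f′ with f′ ∉ (P , q), which reduces primality of φ to the residue ring A/(P) = Z[x]/(P , q).
module Eisenstein {dP dφ M : ℕ} {P φ : Poly} (q N : ℕ) (1<q : 1 < q) (P-monic : Monic dP P) (φ-monic : Monic dφ φ)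
  (q∈ : C (+ q) ≈ [] [ P , φ ]) (φ≈P^M : φ ≈ P ↑ suc M [ C (+ q) , [] ]) where
  private
    σ = sub (X ↑ N)
    open _≈_[_,_] q∈ using () renaming (k to α; l to β; eq to q≋)

  φ∈ : φ ≈ [] [ P , C (+ q) ]
  φ∈ = mod-trans (mod-mono modʳ (≋⇒≈ ≋-refl) φ≈P^M) (mod-trans (mod-⊗ʳ (P ↑ M) modˡ) (≋⇒≈ ≋-refl))

  cancel-q : ∀ f → C (+ q) ⊗ f ≋ [] → f ≋ []
  cancel-q f e = mk λ i → ℤ.*-cancelˡ-≡ (+ q) _ _ {{ℕ.>-nonZero (ℕ.<-trans (s≤s z≤n) 1<q)}} (≡.trans (≡.sym (coeff-C⊗ (+ q) f i)) (≡.trans (at e i) (≡.sym (ℤ.*-zeroʳ (+ q)))))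

  -- Modulo φ the constant q is a multiple of P, so P f ≡ 0 gives q f = n φ. As φ is monic, q
  -- divides n and cancels.
  cancel-P : ∀ f → P ⊗ f ≈ [] [ φ , [] ] → f ≈ [] [ φ , [] ]
  cancel-P f Pf with ≈⇒∣ Pf
  ... | m , mφ≋Pf = ∣⇒≈ (g , ≋-sym (⊖≋[]⇒≋ (cancel-q _ (begin
      C (+ q) ⊗ (f ⊕ ⊝ (g ⊗ φ))                  ≈⟨ solve 4 (λ q f g φ → q :* (f :+ :- (g :* φ)) := q :* f :+ :- ((q :* g) :* φ)) ≋-refl (C (+ q)) f g φ ⟩
      C (+ q) ⊗ f ⊕ ⊝ ((C (+ q) ⊗ g) ⊗ φ)        ≈⟨ ⊕-cong qf≋nφ (⊝-cong (⊗-cong (≋-sym n≋qg) (≋-refl {φ}))) ⟩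
      n ⊗ φ ⊕ ⊝ (n ⊗ φ)                          ≈⟨ ≋⇒⊖≋[] (≋-refl {n ⊗ φ}) ⟩
      []                                         ∎))))
    where
    n = α ⊗ m ⊕ β ⊗ f
    qf≋nφ : C (+ q) ⊗ f ≋ n ⊗ φ
    qf≋nφ = begin
      C (+ q) ⊗ f              ≈⟨ ⊗-cong q≋ (≋-refl {f}) ⟩
      (α ⊗ P ⊕ β ⊗ φ) ⊗ f      ≈⟨ solve 5 (λ k P l φ f → (k :* P :+ l :* φ) :* f := k :* (P :* f) :+ l :* f :* φ) ≋-refl α P β φ f ⟩
      α ⊗ (P ⊗ f) ⊕ β ⊗ f ⊗ φ  ≈⟨ ⊕-cong (⊗-congˡ α (≋-sym mφ≋Pf)) (≋-refl {β ⊗ f ⊗ φ}) ⟩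
      α ⊗ (m ⊗ φ) ⊕ β ⊗ f ⊗ φ  ≈⟨ solve 5 (λ k m l φ f → k :* (m :* φ) :+ l :* f :* φ := (k :* m :+ l :* f) :* φ) ≋-refl α m β φ f ⟩
      n ⊗ φ                    ∎
    division = ∣ᶜ⇒C⊗ n (monic-∣₀ n φ-monic (C⊗⇒∣ᶜ (≋-sym qf≋nφ)))
    g = proj₁ division
    n≋qg = proj₂ division

  cancel-P↑ : ∀ a f → P ↑ a ⊗ f ≈ [] [ φ , [] ] → f ≈ [] [ φ , [] ]
  cancel-P↑ zero    f e = mod-trans (≋⇒≈ (≋-sym (⊗-identityˡ f))) e
  cancel-P↑ (suc a) f e = cancel-P↑ a f (cancel-P (P ↑ a ⊗ f) (mod-trans (≋⇒≈ (≋-sym (⊗-assoc P (P ↑ a) f))) e))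

  -- Modulo φ the constant q is itself α P, so the ideal (P , q) is generated by P alone.
  peel : ∀ {f} → f ≈ [] [ P , C (+ q) ] → ∃[ g ] f ≈ P ⊗ g [ φ , [] ]
  peel {f} (mk {k} {l} e) = k ⊕ l ⊗ α , mk {k = l ⊗ β} {[]} (begin
    f                                     ≈⟨ e ⟩
    k ⊗ P ⊕ l ⊗ C (+ q)                   ≈⟨ ⊕-cong (≋-refl {k ⊗ P}) (⊗-congˡ l q≋) ⟩
    k ⊗ P ⊕ l ⊗ (α ⊗ P ⊕ β ⊗ φ)         ≈⟨ solve 6 (λ k l α β P φ → k :* P :+ l :* (α :* P :+ β :* φ) := P :* (k :+ l :* α) :+ l :* β :* φ) ≋-refl k l α β P φ ⟩
    P ⊗ (k ⊕ l ⊗ α) ⊕ l ⊗ β ⊗ φ         ≈⟨ ⊕-cong (≋-refl {P ⊗ (k ⊕ l ⊗ α)}) (≋-sym (⊕-identityʳ (l ⊗ β ⊗ φ))) ⟩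
    P ⊗ (k ⊕ l ⊗ α) ⊕ (l ⊗ β ⊗ φ ⊕ [])  ∎)

  Expansion : Poly → Set
  Expansion f = ∃[ a ] ∃[ g ] f ≈ P ↑ a ⊗ g [ φ , [] ] × ¬ g ≈ [] [ P , C (+ q) ]

  expand-to : ∀ k f → Expansion f ⊎ ∃[ g ] f ≈ P ↑ k ⊗ g [ φ , [] ]
  expand-to zero    f = inj₂ (f , ≋⇒≈ (≋-sym (⊗-identityˡ f)))
  expand-to (suc k) f with expand-to k f
  ... | inj₁ x = inj₁ x
  ... | inj₂ (g , e) with mem? P-monic (+ q) g
  ...   | no ¬m = inj₁ (k , g , e , ¬m)
  ...   | yes m with peel m
  ...     | g′ , e′ = inj₂ (g′ , mod-trans e (mod-trans (mod-⊗ˡ (P ↑ k) e′) (≋⇒≈ (solve 3 (λ p x g → x :* (p :* g) := p :* x :* g) ≋-refl P (P ↑ k) g′))))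

  P^∈qᵏ : ∀ k → ∃[ g ] P ↑ (suc M ℕ.* k) ≈ C (+ (q ℕ.^ k)) ⊗ g [ φ , [] ]
  P^∈qᵏ k with mod-sym φ≈P^M
  ... | mk {g} {l} e = g ↑ k , mod-trans (≋⇒≈ (≋-sym (↑-* P (suc M) k))) (mod-trans (mod-↑ k P^≈) (≋⇒≈ (≋-trans (⊗-↑ g (C (+ q)) k)
      (≋-trans (⊗-comm (g ↑ k) (C (+ q) ↑ k)) (⊗-cong (≋-trans (C-↑ (+ q) k) (≋-reflexive (cong C (pos-^ k)))) (≋-refl {g ↑ k}))))))
    where
    pos-^ : ∀ k → (+ q) ℤ.^ k ≡ + (q ℕ.^ k)
    pos-^ zero    = refl
    pos-^ (suc k) = ≡.trans (cong (λ z → (+ q) ℤ.* z) (pos-^ k)) (≡.sym (ℤ.pos-* q (q ℕ.^ k)))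
    P^≈ : P ↑ suc M ≈ g ⊗ C (+ q) [ φ , [] ]
    P^≈ = mod-trans (≋⇒≈ e) (mod-trans (mod-⊕ modˡ (≋⇒≈ (≋-trans (⊕-cong (≋-refl {g ⊗ C (+ q)}) (⊗-zeroʳ l)) (⊕-identityʳ (g ⊗ C (+ q)))))) (≋⇒≈ ≋-refl))

  expand : ∀ f → Expansion f ⊎ f ≈ [] [ φ , [] ]
  expand f with monic-divMod φ-monic f
  -- Each `suc M` factors P amount to a factor q modulo φ. After this many, the remainder `r` is
  -- divisible by q^(H r), which exceeds every coefficient of `r`, so r = 0.
  ... | k , r , e , r< with expand-to (suc M ℕ.* H r) f
  ...   | inj₁ x = inj₁ x
  ...   | inj₂ (g , f≈) = inj₂ (∣⇒≈ (k , ≋-sym (≋-trans e (≋-trans (⊕-cong (≋-refl {k ⊗ φ}) r≋[]) (⊕-identityʳ (k ⊗ φ))))))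
    where
    qᴴ = q ℕ.^ H r
    r≈ : r ≈ C (+ qᴴ) ⊗ (proj₁ (P^∈qᵏ (H r)) ⊗ g) [ φ , [] ]
    r≈ = mod-trans (mod-sym (mk {k = k} {[]} (≋-trans e (≋-trans (⊕-comm (k ⊗ φ) r) (⊕-cong (≋-refl {r}) (≋-sym (⊕-identityʳ (k ⊗ φ))))))))
      (mod-trans f≈ (mod-trans (mod-⊗ʳ g (proj₂ (P^∈qᵏ (H r)))) (≋⇒≈ (⊗-assoc (C (+ qᴴ)) (proj₁ (P^∈qᵏ (H r))) g))))
    qᴴ∣r : (+ qᴴ) ∣ᶜ r
    qᴴ∣r = mem⇒∣ᶜ r φ-monic r< (mod-trans (mod-mono modˡ (≋⇒≈ ≋-refl) r≈) (mod-trans (mod-⊗ʳ _ modʳ) (≋⇒≈ ≋-refl)))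
    r≋[] : r ≋ []
    r≋[] = mk λ i → small (coeff r i) (∣coeff∣≤H r i) (qᴴ∣r i)
      where
      small : ∀ a → ℤ.∣ a ∣ ≤ H r → + qᴴ ∣ᶻ a → a ≡ 0ℤ
      small a a≤ d with ℤ.∣ a ∣ in eq | ℤ.∣⇒∣ᵤ d
      ... | zero  | _ = ℤ.∣i∣≡0⇒i≡0 eq
      ... | suc m | d′ = contradiction (∣⇒≤ d′) (ℕ.<⇒≱ (ℕ.≤-<-trans a≤ (n<m^n 1<q (H r))))

  -- After the powers of P are stripped from f and h, the parts f′ and h′ lie outside (P , q). The
  -- factor σ(P)^a of σf is turned back into P^a by κ^a and then cancelled, so f′ and h′ contradict
  -- `sep`.
  prime : Separates σ P (+ q) → φ ∣ₚ σ φ → ∃[ κ ] σ P ⊗ κ ≈ P [ φ , [] ] → PrimeUpTo σ φ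
  prime sep φ∣σφ (κ , κ-eq) f h φ∣fh φ∣σfh with expand f | expand h
  ... | inj₂ f≈0 | _ = inj₁ (≈⇒∣ f≈0)
  ... | inj₁ _   | inj₂ h≈0 = inj₂ (≈⇒∣ h≈0)
  ... | inj₁ (a , f′ , f≈ , f′∉) | inj₁ (b , h′ , h≈ , h′∉) = ⊥-elim ([ f′∉ , h′∉ ]′ (sep f′ h′ (mod-mono φ∈ (≋⇒≈ ≋-refl) f′h′≈0) (mod-mono φ∈ (≋⇒≈ ≋-refl) σf′h′≈0)))
    where
    f′h′≈0 : f′ ⊗ h′ ≈ [] [ φ , [] ]
    f′h′≈0 = cancel-P↑ a _ (cancel-P↑ b _ (mod-trans (≋⇒≈ (solve 4 (λ x f y h → y :* (x :* (f :* h)) := (x :* f) :* (y :* h)) ≋-refl (P ↑ a) f′ (P ↑ b) h′))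
      (mod-trans (mod-sym (mod-⊗ f≈ h≈)) (∣⇒≈ φ∣fh))))
    σf≈ : σ f ≈ σ P ↑ a ⊗ σ f′ [ φ , [] ]
    σf≈ = mod-trans (mod-mono (∣⇒≈ φ∣σφ) modʳ (mod-sub (X ↑ N) f≈)) (≋⇒≈ (≋-trans (sub-⊗ (X ↑ N) (P ↑ a) f′) (⊗-cong (sub-↑ (X ↑ N) P a) (≋-refl {σ f′}))))
    κᵃσf≈ : κ ↑ a ⊗ σ f ≈ P ↑ a ⊗ σ f′ [ φ , [] ]
    κᵃσf≈ = mod-trans (mod-⊗ˡ (κ ↑ a) σf≈) (mod-trans (≋⇒≈ (≋-trans (solve 3 (λ k p f → k :* (p :* f) := p :* k :* f) ≋-refl (κ ↑ a) (σ P ↑ a) (σ f′)) (⊗-cong (≋-sym (⊗-↑ (σ P) κ a)) (≋-refl {σ f′}))))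
      (mod-⊗ʳ (σ f′) (mod-↑ a κ-eq)))
    σf′h′≈0 : σ f′ ⊗ h′ ≈ [] [ φ , [] ]
    σf′h′≈0 = cancel-P↑ a _ (cancel-P↑ b _ (mod-trans (≋⇒≈ (solve 4 (λ x f y h → y :* (x :* (f :* h)) := (x :* f) :* (y :* h)) ≋-refl (P ↑ a) (σ f′) (P ↑ b) h′))
      (mod-trans (mod-sym (mod-⊗ κᵃσf≈ h≈)) (mod-trans (≋⇒≈ (⊗-assoc (κ ↑ a) (σ f) h)) (mod-trans (mod-⊗ˡ (κ ↑ a) (∣⇒≈ φ∣σfh)) (≋⇒≈ (⊗-zeroʳ (κ ↑ a))))))))

-- Residues modulo monic linear polynomials and modulo x² + x + 1

EuclidsLemma : ℤ → Set
EuclidsLemma c = ∀ a b → c ∣ᶻ a ℤ.* b → c ∣ᶻ a ⊎ c ∣ᶻ b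

euclid-0 : EuclidsLemma 0ℤ
euclid-0 a b d = [ (λ a≡0 → inj₁ (ℤ.∣-reflexive (≡.sym a≡0))) , (λ b≡0 → inj₂ (ℤ.∣-reflexive (≡.sym b≡0))) ]′ (ℤ.i*j≡0⇒i≡0∨j≡0 a (ℤ.0∣⇒≡0 d))

euclid-prime : ∀ {q} → Prime q → EuclidsLemma (+ q)
euclid-prime {q} pr a b d = [ (λ e → inj₁ (ℤ.∣ᵤ⇒∣ e)) , (λ e → inj₂ (ℤ.∣ᵤ⇒∣ e)) ]′
  (euclidsLemma ℤ.∣ a ∣ ℤ.∣ b ∣ pr (subst (q ∣_) (ℤ.abs-* a b) (ℤ.∣⇒∣ᵤ d)))

euclid-content : ∀ {c} → EuclidsLemma c → ∀ m r → c ∣ᶜ C m ⊗ r → c ∣ᶻ m ⊎ c ∣ᶜ r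
euclid-content {c} euclid m r d with c ∣ᶻ? m
... | yes c∣m = inj₁ c∣m
... | no c∤m  = inj₂ λ i → [ (λ c∣m → contradiction c∣m c∤m) , (λ c∣ri → c∣ri) ]′ (euclid m (coeff r i) (subst (c ∣ᶻ_) (coeff-C⊗ m r i) (d i)))

Deg<-C⊗ : ∀ {d} a r → Deg< d r → Deg< d (C a ⊗ r)
Deg<-C⊗ {d} a r r< i = ≡.trans (coeff-C⊗ a r (d ℕ.+ i)) (≡.trans (cong (a ℤ.*_) (r< i)) (ℤ.*-zeroʳ a))

Deg<1⇒C : ∀ r → Deg< 1 r → r ≋ C (coeff r 0)
Deg<1⇒C r r< = mk λ { zero → ≡.sym (coeff-C-zero _) ; (suc i) → ≡.trans (r< i) (≡.sym (coeff-C-suc (coeff r 0) i)) }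

Deg<2⇒linear : ∀ r → Deg< 2 r → r ≋ C (coeff r 0) ⊕ X ⊗ C (coeff r 1)
Deg<2⇒linear r r< = ≋-trans (mk λ { zero → refl ; (suc zero) → ≡.sym (coeff-C-zero _) ; (suc (suc i)) → ≡.trans (r< i) (≡.sym (coeff-C-suc (coeff r 1) i)) })
  (∷≋ (coeff r 0) (C (coeff r 1)))

C-∣ᶜ : ∀ {c a} → c ∣ᶻ a → c ∣ᶜ C a
C-∣ᶜ {c} {a} d zero    = subst (c ∣ᶻ_) (≡.sym (coeff-C-zero a)) d
C-∣ᶜ {c} {a} d (suc i) = ℤ.∣-trans (dividesᶻ 0ℤ refl) (ℤ.∣-reflexive (≡.sym (coeff-C-suc a i)))

-- Residues modulo a monic linear polynomial are constants, so (P , c) inherits Euclid's lemma from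
-- `c`.
separates-linear : ∀ {P c} σ → EuclidsLemma c → Monic 1 P → Separates σ P c
separates-linear {P} {c} σ euclid m f h fh≈0 _ with remainder m f | remainder m h
... | r , f≈r , r< | s , h≈s , s< = [ (λ c∣a → inj₁ (mod-trans f≈r (mod-trans (≋⇒≈ r≋C) (∣ᶜ⇒mem (C a) (C-∣ᶜ c∣a)))))
                                    , (λ c∣s → inj₂ (mod-trans h≈s (∣ᶜ⇒mem s c∣s))) ]′ (euclid-content euclid a s c∣as)
  where
  a = coeff r 0
  r≋C = Deg<1⇒C r r<
  c∣as : c ∣ᶜ C a ⊗ s
  c∣as = mem⇒∣ᶜ (C a ⊗ s) m (Deg<-C⊗ a s s<) (mod-trans (mod-⊗ (mod-sym (mod-trans f≈r (≋⇒≈ r≋C))) (mod-sym h≈s)) fh≈0)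

X²+X+1 : Poly
X²+X+1 = X ⊗ X ⊕ X ⊕ 1ₚ

module _ {c : ℤ} (N : ℕ) (euclid : EuclidsLemma c) (c∤3 : ¬ c ∣ᶻ + 3) (m : Monic 2 X²+X+1) (Ψ∣Z : X²+X+1 ∣ₚ Z (suc N)) where
  open Reciprocal N using (Y; σ; ∣Z⇒∣σ)
  private
    Ψ = X²+X+1

  X³≈1 : X ⊗ (X ⊗ X) ≈ 1ₚ [ Ψ , C c ]
  X³≈1 = mk {k = X ⊕ C -1ℤ} {[]} (≋-trans (solve 1 (λ x → x :* (x :* x) := con 1ℤ :+ (x :+ con -1ℤ) :* (x :* x :+ x :+ con 1ℤ)) ≋-refl X)
    (⊕-cong (≋-refl {1ₚ}) (≋-sym (⊕-identityʳ _))))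

  -- Modulo x² + x + 1 the inverse of x is x², so `σ` acts as complex conjugation on Z[ω].
  Y≈X² : Y ≈ X ⊗ X [ Ψ , C c ]
  Y≈X² = mod-trans (mod-sym (mod-trans (mod-⊗ˡ Y X³≈1) (≋⇒≈ (≋-trans (⊗-comm Y 1ₚ) (⊗-identityˡ Y)))))
    (mod-trans (≋⇒≈ (solve 2 (λ y x → y :* (x :* (x :* x)) := (x :* y) :* (x :* x)) ≋-refl Y X))
    (mod-trans (mod-⊗ʳ (X ⊗ X) (mod-mono (∣⇒≈ Ψ∣Z) (≋⇒≈ ≋-refl) (X^n≈1 {[]} (suc N)))) (≋⇒≈ (⊗-identityˡ (X ⊗ X)))))

  conjugate-linear : ∀ {f} a b → f ≈ C a ⊕ X ⊗ C b [ Ψ , C c ] → σ f ≈ C a ⊕ (X ⊗ X) ⊗ C b [ Ψ , C c ]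
  conjugate-linear a b f≈ = mod-trans (mod-mono (∣⇒≈ (∣Z⇒∣σ Ψ∣Z)) (mod-trans (≋⇒≈ (sub-C Y c)) modʳ) (mod-sub Y f≈))
    (mod-trans (≋⇒≈ (≋-trans (sub-⊕ Y (C a) (X ⊗ C b)) (⊕-cong (sub-C Y a) (≋-trans (sub-⊗ Y X (C b)) (⊗-cong (sub-X Y) (sub-C Y b))))))
    (mod-⊕ (≋⇒≈ (≋-refl {C a})) (mod-⊗ʳ (C b) Y≈X²)))

  trace₁ : ∀ {f g} a b → f ≈ C a ⊕ X ⊗ C b [ Ψ , C c ] → g ≈ C a ⊕ (X ⊗ X) ⊗ C b [ Ψ , C c ] → 1ₚ ⊗ f ⊕ 1ₚ ⊗ g ≈ C (a ℤ.+ a ℤ.- b) [ Ψ , C c ]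
  trace₁ a b f≈ g≈ = mod-trans (mod-⊕ (mod-⊗ˡ 1ₚ f≈) (mod-⊗ˡ 1ₚ g≈))
    (mk {k = C b} {[]} (≋-trans (solve 3 (λ a b x → con 1ℤ :* (a :+ x :* b) :+ con 1ℤ :* (a :+ x :* x :* b) := a :+ a :+ :- b :+ b :* (x :* x :+ x :+ con 1ℤ)) ≋-refl (C a) (C b) X)
      (⊕-cong (≋-sym (≋-trans (C-+ (a ℤ.+ a) (ℤ.- b)) (⊕-cong (C-+ a a) (C-neg b)))) (≋-sym (⊕-identityʳ _)))))

  trace₂ : ∀ {f g} a b → f ≈ C a ⊕ X ⊗ C b [ Ψ , C c ] → g ≈ C a ⊕ (X ⊗ X) ⊗ C b [ Ψ , C c ] → X ⊗ f ⊕ (X ⊗ X) ⊗ g ≈ C (ℤ.- (a ℤ.+ b)) [ Ψ , C c ]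
  trace₂ a b f≈ g≈ = mod-trans (mod-⊕ (mod-⊗ˡ X f≈) (mod-⊗ˡ (X ⊗ X) g≈))
    (mk {k = C a ⊕ (X ⊗ X ⊕ ⊝ X ⊕ 1ₚ) ⊗ C b} {[]} (≋-trans (solve 3 (λ a b x → x :* (a :+ x :* b) :+ x :* x :* (a :+ x :* x :* b)
        := :- (a :+ b) :+ (a :+ (x :* x :+ :- x :+ con 1ℤ) :* b) :* (x :* x :+ x :+ con 1ℤ)) ≋-refl (C a) (C b) X)
      (⊕-cong (≋-sym (≋-trans (C-neg (a ℤ.+ b)) (⊝-cong (C-+ a b)))) (≋-sym (⊕-identityʳ _)))))

  -- Since f h and g h vanish, the integer t ≡ u f + v g kills `s`. Degrees below 2 turn this into
  -- divisibility of coefficients, where Euclid's lemma for `c` applies.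
  annihilates : ∀ {f g h s t} u v → Deg< 2 s → h ≈ s [ Ψ , C c ] → f ⊗ h ≈ [] [ Ψ , C c ] → g ⊗ h ≈ [] [ Ψ , C c ] →
                u ⊗ f ⊕ v ⊗ g ≈ C t [ Ψ , C c ] → c ∣ᶻ t ⊎ c ∣ᶜ s
  annihilates {f} {g} {h} {s} {t} u v s< h≈s fh≈0 gh≈0 e = euclid-content euclid t s (mem⇒∣ᶜ (C t ⊗ s) m (Deg<-C⊗ t s s<) (mod-trans (mod-⊗ (mod-sym e) (mod-sym h≈s))
    (mod-trans (≋⇒≈ (solve 5 (λ u v f g h → (u :* f :+ v :* g) :* h := u :* (f :* h) :+ v :* (g :* h)) ≋-refl u v f g h))
    (mod-trans (mod-⊕ (mod-⊗ˡ u fh≈0) (mod-⊗ˡ v gh≈0)) (≋⇒≈ (⊕-cong (⊗-zeroʳ u) (⊗-zeroʳ v)))))))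

  -- The two linear forms have determinant -3; this is where `c∤3` enters.
  traces-vanish : ∀ {a b} → c ∣ᶻ a ℤ.+ a ℤ.- b → c ∣ᶻ ℤ.- (a ℤ.+ b) → c ∣ᶻ a × c ∣ᶻ b
  traces-vanish {a} {b} d₁ d₂ = c∣a , subst (c ∣ᶻ_) (eq′ a b) (ℤ.∣m∣n⇒∣m-n (ℤ.∣m⇒∣-m d₂) c∣a)
    where
    eq : ∀ a b → (a ℤ.+ a ℤ.- b) ℤ.- (ℤ.- (a ℤ.+ b)) ≡ + 3 ℤ.* a
    eq = solve-∀
    eq′ : ∀ a b → (ℤ.- (ℤ.- (a ℤ.+ b))) ℤ.- a ≡ b
    eq′ = solve-∀
    c∣a : c ∣ᶻ a
    c∣a = [ (λ c∣3 → contradiction c∣3 c∤3) , (λ d → d) ]′ (euclid (+ 3) a (subst (c ∣ᶻ_) (eq a b) (ℤ.∣m∣n⇒∣m-n d₁ d₂)))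

  -- For f ≡ a + bX, the traces f + f̄ = 2a − b and Xf + X̄f̄ = −(a + b) of Z[ω] annihilate h modulo (Ψ , c).
  separates-quadratic : Separates σ Ψ c
  separates-quadratic f h fh≈0 σfh≈0 with remainder {v = C c} m f | remainder {v = C c} m h
  ... | r , f≈r , r< | s , h≈s , s< = combine (annihilates 1ₚ 1ₚ s< h≈s fh≈0 σfh≈0 (trace₁ a b f≈ σf≈)) (annihilates X (X ⊗ X) s< h≈s fh≈0 σfh≈0 (trace₂ a b f≈ σf≈))
    where
    a = coeff r 0
    b = coeff r 1
    f≈ : f ≈ C a ⊕ X ⊗ C b [ Ψ , C c ]
    f≈ = mod-trans f≈r (≋⇒≈ (Deg<2⇒linear r r<))
    σf≈ = conjugate-linear a b f≈
    h∈ : c ∣ᶜ s → h ≈ [] [ Ψ , C c ]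
    h∈ c∣s = mod-trans h≈s (∣ᶜ⇒mem s c∣s)
    c∣r : c ∣ᶻ a × c ∣ᶻ b → c ∣ᶜ r
    c∣r (c∣a , c∣b) zero          = c∣a
    c∣r (c∣a , c∣b) (suc zero)    = c∣b
    c∣r (c∣a , c∣b) (suc (suc i)) = ℤ.∣-trans (dividesᶻ 0ℤ refl) (ℤ.∣-reflexive (≡.sym (r< i)))
    combine : c ∣ᶻ a ℤ.+ a ℤ.- b ⊎ c ∣ᶜ s → c ∣ᶻ ℤ.- (a ℤ.+ b) ⊎ c ∣ᶜ s → f ≈ [] [ Ψ , C c ] ⊎ h ≈ [] [ Ψ , C c ]
    combine (inj₂ c∣s) _          = inj₂ (h∈ c∣s)
    combine (inj₁ _)   (inj₂ c∣s) = inj₂ (h∈ c∣s)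
    combine (inj₁ d₁)  (inj₁ d₂)  = inj₁ (mod-trans f≈r (∣ᶜ⇒mem r (c∣r (traces-vanish d₁ d₂))))

-- The Eisenstein property of Φ(x^(q^j)) for Φ = P(x^q) / P

monic-cancel-mod : ∀ {d c} f f′ g → Monic d g → f ⊗ g ≈ f′ ⊗ g [ C c , [] ] → f ≈ f′ [ C c , [] ]
monic-cancel-mod {c = c} f f′ g m (mk {k} {l} e) with ∣ᶜ⇒C⊗ (f ⊕ ⊝ f′) (monic-∣₀ (f ⊕ ⊝ f′) m (C⊗⇒∣ᶜ {g = k} (begin
    (f ⊕ ⊝ f′) ⊗ g                                  ≈⟨ solve 3 (λ f f′ g → (f :+ :- f′) :* g := f :* g :+ :- (f′ :* g)) ≋-refl f f′ g ⟩
    f ⊗ g ⊕ ⊝ (f′ ⊗ g)                              ≈⟨ ⊕-cong e (≋-refl {⊝ (f′ ⊗ g)}) ⟩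
    f′ ⊗ g ⊕ (k ⊗ C c ⊕ l ⊗ []) ⊕ ⊝ (f′ ⊗ g)        ≈⟨ solve 4 (λ p k c z → p :+ (k :* c :+ z) :+ :- p := c :* k :+ z) ≋-refl (f′ ⊗ g) k (C c) (l ⊗ []) ⟩
    C c ⊗ k ⊕ l ⊗ []                                ≈⟨ ⊕-cong (≋-refl {C c ⊗ k}) (⊗-zeroʳ l) ⟩
    C c ⊗ k ⊕ []                                    ≈⟨ ⊕-identityʳ (C c ⊗ k) ⟩
    C c ⊗ k                                         ∎)))
... | h , e′ = mk {k = h} {[]} (≋-trans (solve 2 (λ f f′ → f := f′ :+ (f :+ :- f′)) ≋-refl f f′)
    (⊕-cong (≋-refl {f′}) (≋-trans e′ (≋-trans (⊗-comm (C c) h) (≋-sym (⊕-identityʳ (h ⊗ C c)))))))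

-- What x - 1 and 1 + ... + x^(p-1) have in common: `q∈` makes q a multiple of P modulo Φ, and the
-- Frobenius congruence `P↑q≈` makes Φ congruent to P^(q-1) modulo q. This is total ramification at
-- q.
record Ramified (q : ℕ) : Set where
  field
    {degree} : ℕ
    P Φ      : Poly
    P-monic  : Monic degree P
    Φ⊗P≋     : Φ ⊗ P ≋ sub (X ↑ q) P
    q∈       : C (+ q) ≈ [] [ P , Φ ]
    P↑q≈     : P ↑ q ≈ sub (X ↑ q) P [ C (+ q) , [] ]

  -- For P = x - 1 this is the cyclotomic polynomial of order q^(j+1), for P = 1 + ... + x^(p-1)
  -- that of order p q^(j+1).
  Φ[_] : ℕ → Poly
  Φ[ j ] = sub (X ↑ (q ℕ.^ j)) Φ

-- The exponent is M + 1 = (q - 1) Q, phrased without subtraction and as a successor, the form that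
-- `Eisenstein` expects.
exponent : ∀ {q} Q → 1 < q → 0 < Q → ∃[ M ] suc M ℕ.+ Q ≡ q ℕ.* Q
exponent {suc (suc r)} (suc Q) _ _ = Q ℕ.+ r ℕ.* suc Q , ℕ.+-comm (suc Q ℕ.+ r ℕ.* suc Q) (suc Q)
exponent {suc zero}    Q (s≤s ()) _

module _ {q : ℕ} (1<q : 1 < q) (L : Ramified q) where
  open Ramified L
  private
    positive : ∀ j → ∃[ k ] q ℕ.^ j ≡ suc k
    positive j with q ℕ.^ j | n<m^n 1<q j
    ... | suc k | _ = k , refl

  sub-X^q^-monic : ∀ {d} f j → Monic d f → ∃[ e ] Monic e (sub (X ↑ (q ℕ.^ j)) f)
  sub-X^q^-monic f j m with q ℕ.^ j | positive j
  ... | _ | k , refl = sub-X^-monic k f m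

  Φ-monic : ∃[ d ] Monic d Φ
  Φ-monic with sub-X^q^-monic P 1 P-monic
  ... | e , m = monic-factor Φ P Φ⊗P≋ P-monic (Lead-resp (subᵘ-cong P (≋-reflexive (cong (X ↑_) (ℕ.*-identityʳ q)))) m)

  Φ[]-monic : ∀ j → ∃[ d ] Monic d Φ[ j ]
  Φ[]-monic j = sub-X^q^-monic Φ j (proj₂ Φ-monic)

  Φ[]⊗P : ∀ j → Φ[ j ] ⊗ sub (X ↑ (q ℕ.^ j)) P ≋ sub (X ↑ (q ℕ.^ suc j)) P
  Φ[]⊗P j = ≋-trans (≋-sym (sub-⊗ y Φ P)) (≋-trans (sub-cong y Φ⊗P≋) (≋-trans (sub-X^-sub-X^ (q ℕ.^ j) q P) (subᵘ-cong P (≋-reflexive (cong (X ↑_) (ℕ.*-comm (q ℕ.^ j) q))))))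
    where y = X ↑ (q ℕ.^ j)

  P∣P[] : ∀ j → P ∣ₚ sub (X ↑ (q ℕ.^ j)) P
  P∣P[] zero    = 1ₚ , ≋-trans (⊗-identityˡ P) (≋-sym (sub-X^1 P))
  P∣P[] (suc j) = ∣ₚ-resp (Φ[]⊗P j) (∣ₚ-⊗ˡ Φ[ j ] (P∣P[] j))

  -- Substituting x^(q^j) into `q∈` puts q into the ideal of P(x^(q^j)) and Φ(x^(q^j)), and the
  -- former is a multiple of P.
  q∈[] : ∀ j → C (+ q) ≈ [] [ P , Φ[ j ] ]
  q∈[] j = mod-mono (∣⇒≈ (P∣P[] j)) modʳ (mod-trans (≋⇒≈ (≋-sym (sub-C y (+ q)))) (mod-sub y q∈))
    where y = X ↑ (q ℕ.^ j)

  -- With Q = q^j, the product Φ(x^Q) P^Q is congruent to Φ(x^Q) P(x^Q) = P(x^(qQ)), hence to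
  -- P^(qQ); the monic P^Q cancels.
  Φ[]≈P↑ : ∀ j → ∃[ M ] Φ[ j ] ≈ P ↑ suc M [ C (+ q) , [] ]
  Φ[]≈P↑ j with exponent (q ℕ.^ j) 1<q (ℕ.≤-trans (s≤s z≤n) (n<m^n 1<q j))
  ... | M , eq = M , monic-cancel-mod Φ[ j ] (P ↑ suc M) (P ↑ (q ℕ.^ j)) (proj₂ (↑-monic P (q ℕ.^ j) P-monic))
    (mod-trans (mod-⊗ˡ Φ[ j ] (frobenius-iterate P P↑q≈ j))
    (mod-trans (≋⇒≈ (Φ[]⊗P j))
    (mod-trans (mod-sym (frobenius-iterate P P↑q≈ (suc j)))
    (≋⇒≈ (≋-trans (≋-reflexive (cong (P ↑_) (≡.sym eq))) (↑-+ P (suc M) (q ℕ.^ j)))))))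

  ramified-prime : ∀ N → P ∣ₚ Z (suc N) → Separates (sub (X ↑ N)) P (+ q) → ∀ j → Φ[ j ] ∣ₚ Z (suc N) → PrimeUpTo (sub (X ↑ N)) Φ[ j ]
  ramified-prime N P∣Z sep j φ∣Z = Eisenstein.prime {M = proj₁ (Φ[]≈P↑ j)} q N 1<q P-monic (proj₂ (Φ[]-monic j)) (q∈[] j) (proj₂ (Φ[]≈P↑ j)) sep (∣Z⇒∣σ φ∣Z)
    -- The witness κ is σσP / σP: applying `σ` to P | σP gives σP | σσP, and σσP ≡ P.
    (proj₁ σP∣σσP , mod-trans (≋⇒≈ (≋-trans (⊗-comm (σ P) _) (proj₂ σP∣σσP))) (mod-mono (∣⇒≈ φ∣Z) (≋⇒≈ ≋-refl) (σσ P)))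
    where
    open Reciprocal N
    σP∣σσP : σ P ∣ₚ σ (σ P)
    σP∣σσP = sub-∣ Y (∣Z⇒∣σ P∣Z)

-- Factorization of divisors

data SubProduct : List Poly → Poly → Set where
  done : SubProduct [] 1ₚ
  keep : ∀ {φ L g} → SubProduct L g → SubProduct (φ ∷ L) (φ ⊗ g)
  drop : ∀ {φ L g} → SubProduct L g → SubProduct (φ ∷ L) g

prod : List Poly → Poly
prod []      = 1ₚ
prod (φ ∷ L) = φ ⊗ prod L

subProduct∣prod : ∀ {L g} → SubProduct L g → g ∣ₚ prod L
subProduct∣prod done               = 1ₚ , ⊗-identityˡ 1ₚ
subProduct∣prod (keep {φ} {L} {g} s) with subProduct∣prod s
... | k , e = k , ≋-trans (solve 3 (λ k φ g → k :* (φ :* g) := φ :* (k :* g)) ≋-refl k φ g) (⊗-congˡ φ e)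
subProduct∣prod (drop {φ} s) = ∣ₚ-⊗ˡ φ (subProduct∣prod s)

module _ (N : ℕ) where
  open Reciprocal N using (n; σ; ∣Z⇒∣σ)

  MonicPrime : Poly → Set
  MonicPrime φ = (∃[ d ] Monic d φ) × PrimeUpTo σ φ

  Factorization : List Poly → Poly → Set
  Factorization L f = ∃[ ε ] ∃[ g ] IsUnit ε × SubProduct L g × f ≋ C ε ⊗ g

  keep-factor : ∀ {φ L f k} → k ⊗ φ ≋ f → Factorization L k → Factorization (φ ∷ L) f
  keep-factor {φ} kφ≋f (ε , g , unit , s , k≋) = ε , φ ⊗ g , unit , keep s ,
    ≋-trans (≋-sym kφ≋f) (≋-trans (⊗-cong k≋ (≋-refl {φ})) (solve 3 (λ c g φ → c :* g :* φ := c :* (φ :* g)) ≋-refl (C ε) g φ))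

  drop-factor : ∀ {φ L f} → Factorization L f → Factorization (φ ∷ L) f
  drop-factor (ε , g , unit , s , f≋) = ε , g , unit , drop s , f≋

  cancel-left : ∀ {d φ f} h k {p} → Monic d φ → f ⊗ h ≋ φ ⊗ p → k ⊗ φ ≋ f → k ⊗ h ≋ p
  cancel-left {φ = φ} {f} h k {p} m e kφ≋f = monic-cancel (k ⊗ h) p m (begin
    (k ⊗ h) ⊗ φ  ≈⟨ solve 3 (λ k h φ → k :* h :* φ := (k :* φ) :* h) ≋-refl k h φ ⟩
    (k ⊗ φ) ⊗ h  ≈⟨ ⊗-cong kφ≋f (≋-refl {h}) ⟩
    f ⊗ h        ≈⟨ e ⟩
    φ ⊗ p        ≈⟨ ⊗-comm φ p ⟩
    p ⊗ φ        ∎)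

  cancel-right : ∀ {d φ} f {h} k {p} → Monic d φ → f ⊗ h ≋ φ ⊗ p → k ⊗ φ ≋ h → f ⊗ k ≋ p
  cancel-right f {h} k m e kφ≋h = ≋-trans (⊗-comm f k) (cancel-left f k m (≋-trans (⊗-comm h f) e) kφ≋h)

  -- Here f divides φ p and hence x^n - 1, so f | σf by reciprocity, and φ | f h implies φ | σf h.
  split-prime : ∀ {φ p} f h → MonicPrime φ → φ ⊗ p ∣ₚ Z n → f ⊗ h ≋ φ ⊗ p → φ ∣ₚ f ⊎ φ ∣ₚ h
  split-prime {φ} {p} f h (_ , φ-prime) φp∣Z e = φ-prime f h φ∣fh (φ∣σfh (∣Z⇒∣σ (∣ₚ-trans (h , ≋-trans (⊗-comm h f) e) φp∣Z)))
    where
    φ∣fh : φ ∣ₚ f ⊗ h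
    φ∣fh = p , ≋-trans (⊗-comm p φ) (≋-sym e)
    φ∣σfh : f ∣ₚ σ f → φ ∣ₚ σ f ⊗ h
    φ∣σfh (k , kf≋σf) = ∣ₚ-resp (≋-trans (≋-sym (⊗-assoc k f h)) (⊗-cong {k ⊗ f} {σ f} kf≋σf (≋-refl {h}))) (∣ₚ-⊗ˡ k φ∣fh)

  -- Every listed φ goes to f or to its cofactor h and is cancelled there; what is left of f at the
  -- end is a unit. Primality is assumed only under φ | x^n - 1, because its proof uses reciprocity
  -- for φ.
  classify : ∀ L → All (λ φ → φ ∣ₚ Z n → MonicPrime φ) L → prod L ∣ₚ Z n → ∀ f h → f ⊗ h ≋ prod L → Factorization L f
  classify [] [] _ f h e = constant (⊗≋1⇒unit f h e)
    where
    constant : ∃[ ε ] IsUnit ε × f ≋ C ε → Factorization [] f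
    constant (ε , unit , f≋C) = ε , 1ₚ , unit , done , ≋-trans f≋C (≋-trans (≋-sym (⊗-identityˡ (C ε))) (⊗-comm 1ₚ (C ε)))
  classify (φ ∷ L) (good ∷ goods) L∣Z f h e = [ left , right ]′ (split-prime f h φ-good L∣Z e)
    where
    φ-good = good (∣ₚ-trans (∣ₚ-⊗ʳ (prod L) (1ₚ , ⊗-identityˡ φ)) L∣Z)
    φ-monic = proj₂ (proj₁ φ-good)
    rest∣Z = ∣ₚ-trans (∣ₚ-⊗ˡ φ (1ₚ , ⊗-identityˡ (prod L))) L∣Z
    left : φ ∣ₚ f → Factorization (φ ∷ L) f
    left (k , kφ≋f) = keep-factor kφ≋f (classify L goods rest∣Z k h (cancel-left h k φ-monic e kφ≋f))
    right : φ ∣ₚ h → Factorization (φ ∷ L) f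
    right (k , kφ≋h) = drop-factor (classify L goods rest∣Z f k (cancel-right f k φ-monic e kφ≋h))

PrimeUpTo-resp : ∀ σ {φ φ′} → φ ≋ φ′ → PrimeUpTo σ φ → PrimeUpTo σ φ′
PrimeUpTo-resp σ {φ} {φ′} e p f h d d′ = [ (λ x → inj₁ (change x)) , (λ x → inj₂ (change x)) ]′ (p f h (change⁻ d) (change⁻ d′))
  where
  change : ∀ {f} → φ ∣ₚ f → φ′ ∣ₚ f
  change (k , x) = k , ≋-trans (⊗-congˡ k (≋-sym e)) x
  change⁻ : ∀ {f} → φ′ ∣ₚ f → φ ∣ₚ f
  change⁻ (k , x) = k , ≋-trans (⊗-congˡ k e) x

∣ₚ-respˡ : ∀ {f f′ g} → f ≋ f′ → f ∣ₚ g → f′ ∣ₚ g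
∣ₚ-respˡ e (k , x) = k , ≋-trans (⊗-congˡ k (≋-sym e)) x

Z-⊗ : ∀ m k → sub (X ↑ m) (Z k) ≋ Z (m ℕ.* k)
Z-⊗ m k = ≋-trans (sub-⊕ (X ↑ m) (X ↑ k) (C -1ℤ)) (⊕-cong (sub-X^-X^ m k) (sub-C (X ↑ m) -1ℤ))

prod-map-sub : ∀ u L → prod (map (sub u) L) ≋ sub u (prod L)
prod-map-sub u []      = ≋-sym (sub-C u 1ℤ)
prod-map-sub u (φ ∷ L) = ≋-trans (⊗-congˡ (sub u φ) (prod-map-sub u L)) (≋-sym (sub-⊗ u φ (prod L)))

subProduct-map-sub : ∀ u L {g} → SubProduct (map (sub u) L) g → ∃[ g′ ] SubProduct L g′ × g ≋ sub u g′
subProduct-map-sub u []      done     = 1ₚ , done , ≋-sym (sub-C u 1ℤ)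
subProduct-map-sub u (φ ∷ L) (keep s) with subProduct-map-sub u L s
... | g′ , s′ , e = φ ⊗ g′ , keep s′ , ≋-trans (⊗-congˡ (sub u φ) e) (≋-sym (sub-⊗ u φ g′))
subProduct-map-sub u (φ ∷ L) (drop s) with subProduct-map-sub u L s
... | g′ , s′ , e = g′ , drop s′ , e

subProduct-map-sub⁻ : ∀ u {L g} → SubProduct L g → ∃[ g′ ] SubProduct (map (sub u) L) g′ × g′ ≋ sub u g
subProduct-map-sub⁻ u done     = 1ₚ , done , ≋-sym (sub-C u 1ℤ)
subProduct-map-sub⁻ u (keep {φ} {g = g} s) with subProduct-map-sub⁻ u s
... | g′ , s′ , e = sub u φ ⊗ g′ , keep s′ , ≋-trans (⊗-congˡ (sub u φ) e) (≋-sym (sub-⊗ u φ g))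
subProduct-map-sub⁻ u (drop s) with subProduct-map-sub⁻ u s
... | g′ , s′ , e = g′ , drop s′ , e

module Tower {q : ℕ} (p : ℕ) (1<q : 1 < q) (L₁ L₂ : Ramified q) (base : Ramified.P L₁ ⊗ Ramified.P L₂ ≋ Z p) where
  open Ramified L₁ renaming (P to P₁; Φ to Φ₁; Φ[_] to Φ₁[_]; P-monic to P₁-monic; Φ⊗P≋ to Φ₁⊗P₁≋) using ()
  open Ramified L₂ renaming (P to P₂; Φ to Φ₂; Φ[_] to Φ₂[_]; P-monic to P₂-monic; Φ⊗P≋ to Φ₂⊗P₂≋) using ()

  -- The new factors come first and x becomes x^q in the old ones, so a product over a subset has
  -- the form A(x) g(x^q) with g of the previous level.
  cofactors : ℕ → List Poly
  cofactors zero    = []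
  cofactors (suc b) = Φ₁ ∷ Φ₂ ∷ map (sub (X ↑ q)) (cofactors b)

  factors : ℕ → List Poly
  factors b = P₁ ∷ P₂ ∷ cofactors b

  -- The new factors combine with `P₁` and `P₂` by Φᵢ Pᵢ = Pᵢ(x^q), so the whole product is the
  -- previous one at x^q.
  prod-factors : ∀ b → prod (factors b) ≋ Z (p ℕ.* q ℕ.^ b)
  prod-factors zero    = ≋-trans (≋-trans (solve 2 (λ a b → a :* (b :* con 1ℤ) := a :* b) ≋-refl P₁ P₂) base) (≋-reflexive (cong Z (≡.sym (ℕ.*-identityʳ p))))
  prod-factors (suc b) = begin
    P₁ ⊗ (P₂ ⊗ (Φ₁ ⊗ (Φ₂ ⊗ prod (map (sub y) (cofactors b)))))
      ≈⟨ ⊗-congˡ P₁ (⊗-congˡ P₂ (⊗-congˡ Φ₁ (⊗-congˡ Φ₂ (prod-map-sub y (cofactors b))))) ⟩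
    P₁ ⊗ (P₂ ⊗ (Φ₁ ⊗ (Φ₂ ⊗ sub y c)))
      ≈⟨ solve 5 (λ a b c d e → a :* (b :* (c :* (d :* e))) := (c :* a) :* ((d :* b) :* e)) ≋-refl P₁ P₂ Φ₁ Φ₂ (sub y c) ⟩
    (Φ₁ ⊗ P₁) ⊗ ((Φ₂ ⊗ P₂) ⊗ sub y c)
      ≈⟨ ⊗-cong Φ₁⊗P₁≋ (⊗-cong Φ₂⊗P₂≋ (≋-refl {sub y c})) ⟩
    sub y P₁ ⊗ (sub y P₂ ⊗ sub y c)
      ≈⟨ ≋-sym (≋-trans (sub-⊗ y P₁ (P₂ ⊗ c)) (⊗-congˡ (sub y P₁) (sub-⊗ y P₂ c))) ⟩
    sub y (prod (factors b))
      ≈⟨ sub-cong y (prod-factors b) ⟩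
    sub y (Z (p ℕ.* q ℕ.^ b))
      ≈⟨ Z-⊗ q (p ℕ.* q ℕ.^ b) ⟩
    Z (q ℕ.* (p ℕ.* q ℕ.^ b))
      ≈⟨ ≋-reflexive (cong Z (≡.trans (≡.sym (ℕ.*-assoc q p _)) (≡.trans (cong (ℕ._* q ℕ.^ b) (ℕ.*-comm q p)) (ℕ.*-assoc p q _)))) ⟩
    Z (p ℕ.* q ℕ.^ suc b) ∎
    where
    y = X ↑ q
    c = prod (cofactors b)

  Conjugate : Poly → Set
  Conjugate φ = (∃[ j ] Φ₁[ j ] ≋ φ) ⊎ (∃[ j ] Φ₂[ j ] ≋ φ)

  cofactors-conjugate : ∀ b → All Conjugate (cofactors b)
  cofactors-conjugate zero    = []
  cofactors-conjugate (suc b) = inj₁ (0 , sub-X^1 Φ₁) ∷ inj₂ (0 , sub-X^1 Φ₂) ∷ AllP.map⁺ (All.map raise (cofactors-conjugate b))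
    where
    raise : ∀ {φ} → Conjugate φ → Conjugate (sub (X ↑ q) φ)
    raise (inj₁ (j , e)) = inj₁ (suc j , ≋-trans (≋-sym (sub-X^-sub-X^ q (q ℕ.^ j) Φ₁)) (sub-cong (X ↑ q) e))
    raise (inj₂ (j , e)) = inj₂ (suc j , ≋-trans (≋-sym (sub-X^-sub-X^ q (q ℕ.^ j) Φ₂)) (sub-cong (X ↑ q) e))

  -- The value c = 0 yields primality of `P₁` and `P₂` themselves, c = q that of all factors
  -- Φ(x^(q^j)).
  factorization : ∀ b N → suc N ≡ p ℕ.* q ℕ.^ b → (∀ c → c ≡ 0ℤ ⊎ c ≡ + q → P₁ ∣ₚ Z (suc N) → P₂ ∣ₚ Z (suc N) →
                  Separates (sub (X ↑ N)) P₁ c × Separates (sub (X ↑ N)) P₂ c) →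
                  ∀ f → f ∣ₚ Z (suc N) → Factorization N (factors b) f
  factorization b N eq sep f (h , hf≋Z) = classify N (factors b) good (1ₚ , ≋-trans (⊗-identityˡ _) Z≋) f h (≋-trans (⊗-comm f h) (≋-trans hf≋Z (≋-sym Z≋)))
    where
    Z≋ : prod (factors b) ≋ Z (suc N)
    Z≋ = ≋-trans (prod-factors b) (≋-reflexive (cong Z (≡.sym eq)))
    P₁∣Z : P₁ ∣ₚ Z (suc N)
    P₁∣Z = ∣ₚ-resp Z≋ (∣ₚ-⊗ʳ (prod (P₂ ∷ cofactors b)) (1ₚ , ⊗-identityˡ P₁))
    P₂∣Z : P₂ ∣ₚ Z (suc N)
    P₂∣Z = ∣ₚ-resp Z≋ (∣ₚ-⊗ˡ P₁ (∣ₚ-⊗ʳ (prod (cofactors b)) (1ₚ , ⊗-identityˡ P₂)))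
    seps₀ = sep 0ℤ (inj₁ refl) P₁∣Z P₂∣Z
    seps = sep (+ q) (inj₂ refl) P₁∣Z P₂∣Z
    conjugate-good : ∀ {φ} → Conjugate φ → φ ∣ₚ Z (suc N) → MonicPrime N φ
    conjugate-good (inj₁ (j , e)) φ∣Z = (_ , Lead-resp e (proj₂ (Φ[]-monic 1<q L₁ j))) , PrimeUpTo-resp (sub (X ↑ N)) e (ramified-prime 1<q L₁ N P₁∣Z (proj₁ seps) j (∣ₚ-respˡ (≋-sym e) φ∣Z))
    conjugate-good (inj₂ (j , e)) φ∣Z = (_ , Lead-resp e (proj₂ (Φ[]-monic 1<q L₂ j))) , PrimeUpTo-resp (sub (X ↑ N)) e (ramified-prime 1<q L₂ N P₂∣Z (proj₂ seps) j (∣ₚ-respˡ (≋-sym e) φ∣Z))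
    good : All (λ φ → φ ∣ₚ Z (suc N) → MonicPrime N φ) (factors b)
    good = (λ _ → (_ , P₁-monic) , separates₀⇒prime (sub (X ↑ N)) (proj₁ seps₀)) ∷ (λ _ → (_ , P₂-monic) , separates₀⇒prime (sub (X ↑ N)) (proj₂ seps₀)) ∷ All.map conjugate-good (cofactors-conjugate b)

  Φ₁⊗Φ₂≋ : ∀ g → g ⊗ Z p ≋ Z (p ℕ.* q) → ∃[ d ] Monic d (Z p) → Φ₁ ⊗ Φ₂ ≋ g
  Φ₁⊗Φ₂≋ g e (d , m) = monic-cancel (Φ₁ ⊗ Φ₂) g m (begin
    (Φ₁ ⊗ Φ₂) ⊗ Z p              ≈⟨ ⊗-congˡ (Φ₁ ⊗ Φ₂) (≋-sym base) ⟩
    (Φ₁ ⊗ Φ₂) ⊗ (P₁ ⊗ P₂)        ≈⟨ solve 4 (λ a b c d → a :* b :* (c :* d) := (a :* c) :* (b :* d)) ≋-refl Φ₁ Φ₂ P₁ P₂ ⟩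
    (Φ₁ ⊗ P₁) ⊗ (Φ₂ ⊗ P₂)        ≈⟨ ⊗-cong Φ₁⊗P₁≋ Φ₂⊗P₂≋ ⟩
    sub (X ↑ q) P₁ ⊗ sub (X ↑ q) P₂  ≈⟨ ≋-sym (sub-⊗ (X ↑ q) P₁ P₂) ⟩
    sub (X ↑ q) (P₁ ⊗ P₂)        ≈⟨ sub-cong (X ↑ q) base ⟩
    sub (X ↑ q) (Z p)            ≈⟨ Z-⊗ q p ⟩
    Z (q ℕ.* p)                  ≈⟨ ≋-reflexive (cong Z (ℕ.*-comm q p)) ⟩
    Z (p ℕ.* q)                  ≈⟨ ≋-sym e ⟩
    g ⊗ Z p                      ∎)

-- Multiplication of g(x^q) by a polynomial given in blocks of length q

-- A triple (u , v , w) describes the coefficient u gₛ + v gₛ₋₁ + w gₛ₋₂.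
Triple : Set
Triple = ℤ × ℤ × ℤ

combine : ℤ → ℤ → ℤ → Triple → ℤ
combine a b c (u , v , w) = u ℤ.* a ℤ.+ v ℤ.* b ℤ.+ w ℤ.* c

block : List Triple → ℤ → ℤ → ℤ → Poly
block T a b c = map (combine a b c) T

-- `b` and `c` are the two coefficients preceding the list. Two closing blocks are emitted because a
-- triple looks back two places beyond the end of `g`.
run : List Triple → ℤ → ℤ → Poly → Poly
run T b c []      = block T 0ℤ b c ++ block T 0ℤ 0ℤ b
run T b c (a ∷ g) = block T a b c ++ run T a b g

-- A block with polynomial entries: facts about all blocks at once become linear identities in `α`,
-- `β`, `γ`.
blockₚ : List Triple → Poly → Poly → Poly → Poly
blockₚ []                α β γ = []
blockₚ ((u , v , w) ∷ T) α β γ = (C u ⊗ α ⊕ C v ⊗ β ⊕ C w ⊗ γ) ⊕ X ⊗ blockₚ T α β γ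

blockₚ-cong : ∀ T {α α′ β β′ γ γ′} → α ≋ α′ → β ≋ β′ → γ ≋ γ′ → blockₚ T α β γ ≋ blockₚ T α′ β′ γ′
blockₚ-cong []                d e f = ≋-refl
blockₚ-cong ((u , v , w) ∷ T) d e f = ⊕-cong (⊕-cong (⊕-cong (⊗-congˡ (C u) d) (⊗-congˡ (C v) e)) (⊗-congˡ (C w) f)) (⊗-congˡ X (blockₚ-cong T d e f))

blockₚ-⊕ : ∀ T α β γ α′ β′ γ′ → blockₚ T (α ⊕ α′) (β ⊕ β′) (γ ⊕ γ′) ≋ blockₚ T α β γ ⊕ blockₚ T α′ β′ γ′
blockₚ-⊕ []                α β γ α′ β′ γ′ = ≋-refl
blockₚ-⊕ ((u , v , w) ∷ T) α β γ α′ β′ γ′ = ≋-trans (⊕-cong (≋-refl {t}) (⊗-congˡ X (blockₚ-⊕ T α β γ α′ β′ γ′)))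
  (≋-trans (⊕-cong (solve 9 (λ a b c a′ b′ c′ u v w → u :* (a :+ a′) :+ v :* (b :+ b′) :+ w :* (c :+ c′) := (u :* a :+ v :* b :+ w :* c) :+ (u :* a′ :+ v :* b′ :+ w :* c′)) ≋-refl α β γ α′ β′ γ′ (C u) (C v) (C w)) (≋-refl {X ⊗ (s ⊕ s′)}))
  (solve 5 (λ t t′ x s s′ → (t :+ t′) :+ x :* (s :+ s′) := (t :+ x :* s) :+ (t′ :+ x :* s′)) ≋-refl (C u ⊗ α ⊕ C v ⊗ β ⊕ C w ⊗ γ) (C u ⊗ α′ ⊕ C v ⊗ β′ ⊕ C w ⊗ γ′) X s s′))
  where
  t = C u ⊗ (α ⊕ α′) ⊕ C v ⊗ (β ⊕ β′) ⊕ C w ⊗ (γ ⊕ γ′)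
  s = blockₚ T α β γ
  s′ = blockₚ T α′ β′ γ′

blockₚ-⊗ : ∀ T y α β γ → blockₚ T (y ⊗ α) (y ⊗ β) (y ⊗ γ) ≋ y ⊗ blockₚ T α β γ
blockₚ-⊗ []                y α β γ = ≋-sym (⊗-zeroʳ y)
blockₚ-⊗ ((u , v , w) ∷ T) y α β γ = ≋-trans (⊕-cong (≋-refl {C u ⊗ (y ⊗ α) ⊕ C v ⊗ (y ⊗ β) ⊕ C w ⊗ (y ⊗ γ)}) (⊗-congˡ X (blockₚ-⊗ T y α β γ)))
  (solve 9 (λ u v w y α β γ x s → (u :* (y :* α) :+ v :* (y :* β) :+ w :* (y :* γ)) :+ x :* (y :* s) := y :* ((u :* α :+ v :* β :+ w :* γ) :+ x :* s)) ≋-refl (C u) (C v) (C w) y α β γ X (blockₚ T α β γ))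

block≋blockₚ : ∀ T a b c → block T a b c ≋ blockₚ T (C a) (C b) (C c)
block≋blockₚ []                a b c = ≋-refl
block≋blockₚ ((u , v , w) ∷ T) a b c = ≋-trans (∷≋ _ _) (⊕-cong (begin
  C (u ℤ.* a ℤ.+ v ℤ.* b ℤ.+ w ℤ.* c)             ≈⟨ C-+ (u ℤ.* a ℤ.+ v ℤ.* b) (w ℤ.* c) ⟩
  C (u ℤ.* a ℤ.+ v ℤ.* b) ⊕ C (w ℤ.* c)           ≈⟨ ⊕-cong (C-+ (u ℤ.* a) (v ℤ.* b)) (C-* w c) ⟩
  (C (u ℤ.* a) ⊕ C (v ℤ.* b)) ⊕ C w ⊗ C c         ≈⟨ ⊕-cong (⊕-cong (C-* u a) (C-* v b)) (≋-refl {C w ⊗ C c}) ⟩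
  C u ⊗ C a ⊕ C v ⊗ C b ⊕ C w ⊗ C c               ∎) (⊗-congˡ X (block≋blockₚ T a b c)))

length-block : ∀ T a b c → length (block T a b c) ≡ length T
length-block T a b c = List.length-map (combine a b c) T

-- The three arguments on the right are the generating series, in y = x^q, of gₛ, gₛ₋₁ and gₛ₋₂,
-- with `b` and `c` as the terms before the start.
run≋ : ∀ {q} T → length T ≡ q → ∀ b c g → let y = X ↑ q ; ĝ = sub y g in
       run T b c g ≋ blockₚ T ĝ (C b ⊕ y ⊗ ĝ) (C c ⊕ y ⊗ (C b ⊕ y ⊗ ĝ))
run≋ {q} T len b c [] = begin
  block T 0ℤ b c ++ block T 0ℤ 0ℤ b                      ≈⟨ ++-≋ (block T 0ℤ b c) (block T 0ℤ 0ℤ b) ⟩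
  block T 0ℤ b c ⊕ X ↑ length (block T 0ℤ b c) ⊗ block T 0ℤ 0ℤ b
    ≈⟨ ⊕-cong (block≋blockₚ T 0ℤ b c) (⊗-cong (≋-reflexive (cong (X ↑_) (≡.trans (length-block T 0ℤ b c) len))) (block≋blockₚ T 0ℤ 0ℤ b)) ⟩
  blockₚ T (C 0ℤ) (C b) (C c) ⊕ y ⊗ blockₚ T (C 0ℤ) (C 0ℤ) (C b)
    ≈⟨ ⊕-cong (≋-refl {blockₚ T (C 0ℤ) (C b) (C c)}) (≋-sym (blockₚ-⊗ T y (C 0ℤ) (C 0ℤ) (C b))) ⟩
  blockₚ T (C 0ℤ) (C b) (C c) ⊕ blockₚ T (y ⊗ C 0ℤ) (y ⊗ C 0ℤ) (y ⊗ C b)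
    ≈⟨ ≋-sym (blockₚ-⊕ T (C 0ℤ) (C b) (C c) (y ⊗ C 0ℤ) (y ⊗ C 0ℤ) (y ⊗ C b)) ⟩
  blockₚ T (C 0ℤ ⊕ y ⊗ C 0ℤ) (C b ⊕ y ⊗ C 0ℤ) (C c ⊕ y ⊗ C b)
    ≈⟨ blockₚ-cong T (≋-trans (solve 1 (λ y → con 0ℤ :+ y :* con 0ℤ := con 0ℤ) ≋-refl y) C-0) (⊕-cong (≋-refl {C b}) (⊗-congˡ y C-0))
         (⊕-cong (≋-refl {C c}) (⊗-congˡ y (≋-sym (≋-trans (⊕-cong (≋-refl {C b}) (⊗-zeroʳ y)) (⊕-identityʳ (C b)))))) ⟩
  blockₚ T [] (C b ⊕ y ⊗ []) (C c ⊕ y ⊗ (C b ⊕ y ⊗ [])) ∎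
  where y = X ↑ q
run≋ {q} T len b c (a ∷ g) = begin
  block T a b c ++ run T a b g                           ≈⟨ ++-≋ (block T a b c) (run T a b g) ⟩
  block T a b c ⊕ X ↑ length (block T a b c) ⊗ run T a b g
    ≈⟨ ⊕-cong (block≋blockₚ T a b c) (⊗-cong (≋-reflexive (cong (X ↑_) (≡.trans (length-block T a b c) len))) (run≋ T len a b g)) ⟩
  blockₚ T (C a) (C b) (C c) ⊕ y ⊗ blockₚ T ĝ (C a ⊕ y ⊗ ĝ) (C b ⊕ y ⊗ (C a ⊕ y ⊗ ĝ))
    ≈⟨ ⊕-cong (≋-refl {blockₚ T (C a) (C b) (C c)}) (≋-sym (blockₚ-⊗ T y ĝ (C a ⊕ y ⊗ ĝ) (C b ⊕ y ⊗ (C a ⊕ y ⊗ ĝ)))) ⟩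
  blockₚ T (C a) (C b) (C c) ⊕ blockₚ T (y ⊗ ĝ) (y ⊗ (C a ⊕ y ⊗ ĝ)) (y ⊗ (C b ⊕ y ⊗ (C a ⊕ y ⊗ ĝ)))
    ≈⟨ ≋-sym (blockₚ-⊕ T (C a) (C b) (C c) (y ⊗ ĝ) (y ⊗ (C a ⊕ y ⊗ ĝ)) (y ⊗ (C b ⊕ y ⊗ (C a ⊕ y ⊗ ĝ)))) ⟩
  blockₚ T (C a ⊕ y ⊗ ĝ) (C b ⊕ y ⊗ (C a ⊕ y ⊗ ĝ)) (C c ⊕ y ⊗ (C b ⊕ y ⊗ (C a ⊕ y ⊗ ĝ))) ∎
  where
  y = X ↑ q
  ĝ = sub y g

-- The multiplier A(x): its first block of coefficients is read off the entries u, its second off v,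
-- its third off w.
⟦_⟧ : List Triple → Poly
⟦ T ⟧ = blockₚ T 1ₚ y (y ⊗ y)
  where y = X ↑ length T

run≋⟦⟧⊗ : ∀ {q} T → length T ≡ q → ∀ g → run T 0ℤ 0ℤ g ≋ ⟦ T ⟧ ⊗ sub (X ↑ q) g
run≋⟦⟧⊗ T refl g = begin
  run T 0ℤ 0ℤ g                                             ≈⟨ run≋ T refl 0ℤ 0ℤ g ⟩
  blockₚ T ĝ (C 0ℤ ⊕ y ⊗ ĝ) (C 0ℤ ⊕ y ⊗ (C 0ℤ ⊕ y ⊗ ĝ))     ≈⟨ blockₚ-cong T (solve 1 (λ g → g := g :* con 1ℤ) ≋-refl ĝ)
      (solve 2 (λ y g → con 0ℤ :+ y :* g := g :* y) ≋-refl y ĝ) (solve 2 (λ y g → con 0ℤ :+ y :* (con 0ℤ :+ y :* g) := g :* (y :* y)) ≋-refl y ĝ) ⟩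
  blockₚ T (ĝ ⊗ 1ₚ) (ĝ ⊗ y) (ĝ ⊗ (y ⊗ y))                   ≈⟨ blockₚ-⊗ T ĝ 1ₚ y (y ⊗ y) ⟩
  ĝ ⊗ ⟦ T ⟧                                                 ≈⟨ ⊗-comm ĝ ⟦ T ⟧ ⟩
  ⟦ T ⟧ ⊗ ĝ                                                 ∎
  where
  y = X ↑ length T
  ĝ = sub y g

-- Block descriptions of the multipliers and their closed forms

ones : ℕ → List Triple
ones q = replicate q (1ℤ , 0ℤ , 0ℤ)

spread : ℕ → List Triple
spread r = (1ℤ , 0ℤ , 0ℤ) ∷ replicate r (0ℤ , 0ℤ , 0ℤ)

-- The multiplier x - 1 for q = r + 2, as `spread` is the multiplier 1 for q = r + 1. In a block of
-- length at least 2 the terms -gₛ and gₛ stay apart, so x - 1 does not raise the height of g(x^q).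
difference : ℕ → List Triple
difference r = (-1ℤ , 0ℤ , 0ℤ) ∷ (1ℤ , 0ℤ , 0ℤ) ∷ replicate r (0ℤ , 0ℤ , 0ℤ)

-- The blocks of Φ_{2q} and of Φ_q Φ_{2q} for q = 2t + 1.
alternating select₂ : ℕ → List Triple
alternating zero    = (1ℤ , 0ℤ , 0ℤ) ∷ []
alternating (suc t) = (1ℤ , 0ℤ , 0ℤ) ∷ (-1ℤ , 0ℤ , 0ℤ) ∷ alternating t
select₂ zero    = (1ℤ , 0ℤ , 0ℤ) ∷ []
select₂ (suc t) = (1ℤ , 0ℤ , 0ℤ) ∷ (0ℤ , 1ℤ , 0ℤ) ∷ select₂ t

-- The blocks of Φ_{3q} and of Φ_q Φ_{3q}, for q = 3t + 1 and q = 3t + 2.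
cycle₁ cycle₂ select₃₁ select₃₂ : ℕ → List Triple
cycle₁ zero    = (1ℤ , 0ℤ , 0ℤ) ∷ []
cycle₁ (suc t) = (1ℤ , 0ℤ , 0ℤ) ∷ (-1ℤ , -1ℤ , 0ℤ) ∷ (0ℤ , 1ℤ , 0ℤ) ∷ cycle₁ t
cycle₂ zero    = (1ℤ , 1ℤ , 0ℤ) ∷ (-1ℤ , 0ℤ , 0ℤ) ∷ []
cycle₂ (suc t) = (1ℤ , 1ℤ , 0ℤ) ∷ (-1ℤ , 0ℤ , 0ℤ) ∷ (0ℤ , -1ℤ , 0ℤ) ∷ cycle₂ t
select₃₁ zero    = (1ℤ , 0ℤ , 0ℤ) ∷ []
select₃₁ (suc t) = (1ℤ , 0ℤ , 0ℤ) ∷ (0ℤ , 0ℤ , 1ℤ) ∷ (0ℤ , 1ℤ , 0ℤ) ∷ select₃₁ t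
select₃₂ zero    = (1ℤ , 0ℤ , 0ℤ) ∷ (0ℤ , 1ℤ , 0ℤ) ∷ []
select₃₂ (suc t) = (1ℤ , 0ℤ , 0ℤ) ∷ (0ℤ , 1ℤ , 0ℤ) ∷ (0ℤ , 0ℤ , 1ℤ) ∷ select₃₂ t

X+1 X²-1 X³-1 : Poly
X+1 = X ⊕ 1ₚ
X²-1 = X ⊗ X ⊕ C -1ℤ
X³-1 = X ⊗ X ⊗ X ⊕ C -1ℤ

replicate-0 : ∀ r α β γ → blockₚ (replicate r (0ℤ , 0ℤ , 0ℤ)) α β γ ≋ []
replicate-0 zero    α β γ = ≋-refl
replicate-0 (suc r) α β γ = ≋-trans (⊕-cong (≋-refl {C 0ℤ ⊗ α ⊕ C 0ℤ ⊗ β ⊕ C 0ℤ ⊗ γ}) (≋-trans (⊗-congˡ X (replicate-0 r α β γ)) (≋-trans (⊗-zeroʳ X) (≋-sym C-0))))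
  (≋-trans (solve 3 (λ a b c → (con 0ℤ :* a :+ con 0ℤ :* b :+ con 0ℤ :* c) :+ con 0ℤ := con 0ℤ) ≋-refl α β γ) C-0)

spread≋ : ∀ r α β γ → blockₚ (spread r) α β γ ≋ α
spread≋ r α β γ = ≋-trans (⊕-cong (≋-refl {C 1ℤ ⊗ α ⊕ C 0ℤ ⊗ β ⊕ C 0ℤ ⊗ γ}) (⊗-congˡ X (≋-trans (replicate-0 r α β γ) (≋-sym C-0))))
  (solve 4 (λ a b c x → (con 1ℤ :* a :+ con 0ℤ :* b :+ con 0ℤ :* c) :+ x :* con 0ℤ := a) ≋-refl α β γ X)

difference≋ : ∀ r α β γ → blockₚ (difference r) α β γ ≋ (X ⊕ C -1ℤ) ⊗ α
difference≋ r α β γ = ≋-trans (⊕-cong (≋-refl {C -1ℤ ⊗ α ⊕ C 0ℤ ⊗ β ⊕ C 0ℤ ⊗ γ}) (⊗-congˡ X (spread≋ r α β γ)))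
  (solve 4 (λ a b c x → (con -1ℤ :* a :+ con 0ℤ :* b :+ con 0ℤ :* c) :+ x :* a := (x :+ con -1ℤ) :* a) ≋-refl α β γ X)

ones≋ : ∀ q α β γ → (X ⊕ C -1ℤ) ⊗ blockₚ (ones q) α β γ ≋ Z q ⊗ α
ones≋ zero    α β γ = ≋-trans (⊗-zeroʳ (X ⊕ C -1ℤ)) (≋-trans (≋-sym C-0) (solve 1 (λ a → con 0ℤ := (con 1ℤ :+ con -1ℤ) :* a) ≋-refl α))
ones≋ (suc q) α β γ = begin
  D ⊗ ((C 1ℤ ⊗ α ⊕ C 0ℤ ⊗ β ⊕ C 0ℤ ⊗ γ) ⊕ X ⊗ s)
    ≈⟨ solve 5 (λ x s a b c → (x :+ con -1ℤ) :* ((con 1ℤ :* a :+ con 0ℤ :* b :+ con 0ℤ :* c) :+ x :* s) := (x :+ con -1ℤ) :* a :+ x :* ((x :+ con -1ℤ) :* s)) ≋-refl X s α β γ ⟩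
  D ⊗ α ⊕ X ⊗ (D ⊗ s)
    ≈⟨ ⊕-cong (≋-refl {D ⊗ α}) (⊗-congˡ X (ones≋ q α β γ)) ⟩
  D ⊗ α ⊕ X ⊗ (Z q ⊗ α)
    ≈⟨ solve 3 (λ x y a → (x :+ con -1ℤ) :* a :+ x :* ((y :+ con -1ℤ) :* a) := (x :* y :+ con -1ℤ) :* a) ≋-refl X (X ↑ q) α ⟩
  Z (suc q) ⊗ α ∎
  where
  D = X ⊕ C -1ℤ
  s = blockₚ (ones q) α β γ

-- As in the closed forms below, the entries stay variables: they later become powers of x^q for the
-- full length q, whereas the power of `X` on the right belongs to the shorter list of the
-- induction.
alternating≋ : ∀ t α β γ → X+1 ⊗ blockₚ (alternating t) α β γ ≋ (1ₚ ⊕ X ↑ length (alternating t)) ⊗ α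
alternating≋ zero    α β γ = ≋-trans (⊗-congˡ X+1 (⊕-cong (≋-refl {C 1ℤ ⊗ α ⊕ C 0ℤ ⊗ β ⊕ C 0ℤ ⊗ γ}) (⊗-congˡ X (≋-sym C-0))))
  (solve 4 (λ x a b c → (x :+ con 1ℤ) :* ((con 1ℤ :* a :+ con 0ℤ :* b :+ con 0ℤ :* c) :+ x :* con 0ℤ) := (con 1ℤ :+ x :* con 1ℤ) :* a) ≋-refl X α β γ)
alternating≋ (suc t) α β γ = begin
  X+1 ⊗ ((C 1ℤ ⊗ α ⊕ C 0ℤ ⊗ β ⊕ C 0ℤ ⊗ γ) ⊕ X ⊗ ((C -1ℤ ⊗ α ⊕ C 0ℤ ⊗ β ⊕ C 0ℤ ⊗ γ) ⊕ X ⊗ s))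
    ≈⟨ solve 5 (λ x s a b c → (x :+ con 1ℤ) :* ((con 1ℤ :* a :+ con 0ℤ :* b :+ con 0ℤ :* c) :+ x :* ((con -1ℤ :* a :+ con 0ℤ :* b :+ con 0ℤ :* c) :+ x :* s))
         := (con 1ℤ :+ :- (x :* x)) :* a :+ x :* x :* ((x :+ con 1ℤ) :* s)) ≋-refl X s α β γ ⟩
  (1ₚ ⊕ ⊝ (X ⊗ X)) ⊗ α ⊕ X ⊗ X ⊗ (X+1 ⊗ s)
    ≈⟨ ⊕-cong (≋-refl {(1ₚ ⊕ ⊝ (X ⊗ X)) ⊗ α}) (⊗-congˡ (X ⊗ X) (alternating≋ t α β γ)) ⟩
  (1ₚ ⊕ ⊝ (X ⊗ X)) ⊗ α ⊕ X ⊗ X ⊗ ((1ₚ ⊕ y) ⊗ α)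
    ≈⟨ solve 3 (λ x y a → (con 1ℤ :+ :- (x :* x)) :* a :+ x :* x :* ((con 1ℤ :+ y) :* a) := (con 1ℤ :+ x :* (x :* y)) :* a) ≋-refl X y α ⟩
  (1ₚ ⊕ X ⊗ (X ⊗ y)) ⊗ α ∎
  where
  s = blockₚ (alternating t) α β γ
  y = X ↑ length (alternating t)

-- The multiplier is 1 + x² + ... + x^(2(q-1)). As q is odd, the even exponents below 2q meet each
-- residue modulo q once, so each triple selects a single coefficient.
select₂≋ : ∀ t α β γ → let y = X ↑ length (select₂ t) in X²-1 ⊗ blockₚ (select₂ t) α β γ ≋ (X ⊗ y ⊕ C -1ℤ) ⊗ α ⊕ (y ⊕ ⊝ X) ⊗ β
select₂≋ zero    α β γ = ≋-trans (⊗-congˡ X²-1 (⊕-cong (≋-refl {C 1ℤ ⊗ α ⊕ C 0ℤ ⊗ β ⊕ C 0ℤ ⊗ γ}) (⊗-congˡ X (≋-sym C-0))))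
  (solve 4 (λ x a b c → (x :* x :+ con -1ℤ) :* ((con 1ℤ :* a :+ con 0ℤ :* b :+ con 0ℤ :* c) :+ x :* con 0ℤ) := (x :* (x :* con 1ℤ) :+ con -1ℤ) :* a :+ (x :* con 1ℤ :+ :- x) :* b) ≋-refl X α β γ)
select₂≋ (suc t) α β γ = begin
  X²-1 ⊗ ((C 1ℤ ⊗ α ⊕ C 0ℤ ⊗ β ⊕ C 0ℤ ⊗ γ) ⊕ X ⊗ ((C 0ℤ ⊗ α ⊕ C 1ℤ ⊗ β ⊕ C 0ℤ ⊗ γ) ⊕ X ⊗ s))
    ≈⟨ solve 5 (λ x s a b c → (x :* x :+ con -1ℤ) :* ((con 1ℤ :* a :+ con 0ℤ :* b :+ con 0ℤ :* c) :+ x :* ((con 0ℤ :* a :+ con 1ℤ :* b :+ con 0ℤ :* c) :+ x :* s))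
         := (x :* x :+ con -1ℤ) :* (a :+ x :* b) :+ x :* x :* ((x :* x :+ con -1ℤ) :* s)) ≋-refl X s α β γ ⟩
  X²-1 ⊗ (α ⊕ X ⊗ β) ⊕ X ⊗ X ⊗ (X²-1 ⊗ s)
    ≈⟨ ⊕-cong (≋-refl {X²-1 ⊗ (α ⊕ X ⊗ β)}) (⊗-congˡ (X ⊗ X) (select₂≋ t α β γ)) ⟩
  X²-1 ⊗ (α ⊕ X ⊗ β) ⊕ X ⊗ X ⊗ ((X ⊗ y ⊕ C -1ℤ) ⊗ α ⊕ (y ⊕ ⊝ X) ⊗ β)
    ≈⟨ solve 4 (λ x y a b → (x :* x :+ con -1ℤ) :* (a :+ x :* b) :+ x :* x :* ((x :* y :+ con -1ℤ) :* a :+ (y :+ :- x) :* b) := (x :* (x :* (x :* y)) :+ con -1ℤ) :* a :+ (x :* (x :* y) :+ :- x) :* b) ≋-refl X y α β ⟩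
  (X ⊗ (X ⊗ (X ⊗ y)) ⊕ C -1ℤ) ⊗ α ⊕ (X ⊗ (X ⊗ y) ⊕ ⊝ X) ⊗ β ∎
  where
  s = blockₚ (select₂ t) α β γ
  y = X ↑ length (select₂ t)

-- The entries come from (1 + y + y²) / (1 + x + x²) with y = x^q. The series 1 / (1 + x + x²) has
-- coefficients 1, -1, 0 repeated; the second block adds two shifted copies of it, and in the third
-- block three copies cancel because 3 does not divide q. The residue of q modulo 3 fixes the shift,
-- hence the variant `cycle₂`.
cycle₁≋ : ∀ t α β γ → let y = X ↑ length (cycle₁ t) in X²+X+1 ⊗ blockₚ (cycle₁ t) α β γ ≋ (1ₚ ⊕ y ⊕ X ⊗ y) ⊗ α ⊕ (y ⊕ ⊝ X) ⊗ β
cycle₁≋ zero    α β γ = ≋-trans (⊗-congˡ X²+X+1 (⊕-cong (≋-refl {C 1ℤ ⊗ α ⊕ C 0ℤ ⊗ β ⊕ C 0ℤ ⊗ γ}) (⊗-congˡ X (≋-sym C-0))))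
  (solve 4 (λ x a b c → (x :* x :+ x :+ con 1ℤ) :* ((con 1ℤ :* a :+ con 0ℤ :* b :+ con 0ℤ :* c) :+ x :* con 0ℤ) := (con 1ℤ :+ (x :* con 1ℤ) :+ x :* (x :* con 1ℤ)) :* a :+ ((x :* con 1ℤ) :+ :- x) :* b) ≋-refl X α β γ)
cycle₁≋ (suc t) α β γ = begin
  X²+X+1 ⊗ ((C 1ℤ ⊗ α ⊕ C 0ℤ ⊗ β ⊕ C 0ℤ ⊗ γ) ⊕ X ⊗ ((C -1ℤ ⊗ α ⊕ C -1ℤ ⊗ β ⊕ C 0ℤ ⊗ γ) ⊕ X ⊗ ((C 0ℤ ⊗ α ⊕ C 1ℤ ⊗ β ⊕ C 0ℤ ⊗ γ) ⊕ X ⊗ s)))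
    ≈⟨ solve 5 (λ x s a b c → (x :* x :+ x :+ con 1ℤ) :* ((con 1ℤ :* a :+ con 0ℤ :* b :+ con 0ℤ :* c) :+ x :* ((con -1ℤ :* a :+ con -1ℤ :* b :+ con 0ℤ :* c) :+ x :* ((con 0ℤ :* a :+ con 1ℤ :* b :+ con 0ℤ :* c) :+ x :* s)))
         := (x :* x :+ x :+ con 1ℤ) :* (a :+ x :* (:- a :+ :- b) :+ x :* x :* b) :+ x :* x :* x :* ((x :* x :+ x :+ con 1ℤ) :* s)) ≋-refl X s α β γ ⟩
  X²+X+1 ⊗ (α ⊕ X ⊗ (⊝ α ⊕ ⊝ β) ⊕ X ⊗ X ⊗ β) ⊕ X ⊗ X ⊗ X ⊗ (X²+X+1 ⊗ s)
    ≈⟨ ⊕-cong (≋-refl {X²+X+1 ⊗ (α ⊕ X ⊗ (⊝ α ⊕ ⊝ β) ⊕ X ⊗ X ⊗ β)}) (⊗-congˡ (X ⊗ X ⊗ X) (cycle₁≋ t α β γ)) ⟩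
  X²+X+1 ⊗ (α ⊕ X ⊗ (⊝ α ⊕ ⊝ β) ⊕ X ⊗ X ⊗ β) ⊕ X ⊗ X ⊗ X ⊗ ((1ₚ ⊕ y ⊕ X ⊗ y) ⊗ α ⊕ (y ⊕ ⊝ X) ⊗ β)
    ≈⟨ solve 5 (λ x y a b c → (x :* x :+ x :+ con 1ℤ) :* (a :+ x :* (:- a :+ :- b) :+ x :* x :* b) :+ x :* x :* x :* ((con 1ℤ :+ y :+ x :* y) :* a :+ (y :+ :- x) :* b) := (con 1ℤ :+ (x :* (x :* (x :* y))) :+ x :* (x :* (x :* (x :* y)))) :* a :+ ((x :* (x :* (x :* y))) :+ :- x) :* b) ≋-refl X y α β γ ⟩
  (1ₚ ⊕ (X ⊗ (X ⊗ (X ⊗ y))) ⊕ X ⊗ (X ⊗ (X ⊗ (X ⊗ y)))) ⊗ α ⊕ ((X ⊗ (X ⊗ (X ⊗ y))) ⊕ ⊝ X) ⊗ β ∎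
  where
  s = blockₚ (cycle₁ t) α β γ
  y = X ↑ length (cycle₁ t)

cycle₂≋ : ∀ t α β γ → let y = X ↑ length (cycle₂ t) in X²+X+1 ⊗ blockₚ (cycle₂ t) α β γ ≋ (1ₚ ⊕ ⊝ (X ⊗ y)) ⊗ α ⊕ (1ₚ ⊕ X ⊕ y) ⊗ β
cycle₂≋ zero    α β γ = ≋-trans (⊗-congˡ X²+X+1 (⊕-cong (≋-refl {C 1ℤ ⊗ α ⊕ C 1ℤ ⊗ β ⊕ C 0ℤ ⊗ γ}) (⊗-congˡ X (⊕-cong (≋-refl {C -1ℤ ⊗ α ⊕ C 0ℤ ⊗ β ⊕ C 0ℤ ⊗ γ}) (⊗-congˡ X (≋-sym C-0))))))
  (solve 4 (λ x a b c → (x :* x :+ x :+ con 1ℤ) :* ((con 1ℤ :* a :+ con 1ℤ :* b :+ con 0ℤ :* c) :+ x :* ((con -1ℤ :* a :+ con 0ℤ :* b :+ con 0ℤ :* c) :+ x :* con 0ℤ)) := (con 1ℤ :+ :- (x :* (x :* (x :* con 1ℤ)))) :* a :+ (con 1ℤ :+ x :+ (x :* (x :* con 1ℤ))) :* b) ≋-refl X α β γ)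
cycle₂≋ (suc t) α β γ = begin
  X²+X+1 ⊗ ((C 1ℤ ⊗ α ⊕ C 1ℤ ⊗ β ⊕ C 0ℤ ⊗ γ) ⊕ X ⊗ ((C -1ℤ ⊗ α ⊕ C 0ℤ ⊗ β ⊕ C 0ℤ ⊗ γ) ⊕ X ⊗ ((C 0ℤ ⊗ α ⊕ C -1ℤ ⊗ β ⊕ C 0ℤ ⊗ γ) ⊕ X ⊗ s)))
    ≈⟨ solve 5 (λ x s a b c → (x :* x :+ x :+ con 1ℤ) :* ((con 1ℤ :* a :+ con 1ℤ :* b :+ con 0ℤ :* c) :+ x :* ((con -1ℤ :* a :+ con 0ℤ :* b :+ con 0ℤ :* c) :+ x :* ((con 0ℤ :* a :+ con -1ℤ :* b :+ con 0ℤ :* c) :+ x :* s)))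
         := (x :* x :+ x :+ con 1ℤ) :* ((a :+ b) :+ x :* (:- a) :+ x :* x :* (:- b)) :+ x :* x :* x :* ((x :* x :+ x :+ con 1ℤ) :* s)) ≋-refl X s α β γ ⟩
  X²+X+1 ⊗ ((α ⊕ β) ⊕ X ⊗ (⊝ α) ⊕ X ⊗ X ⊗ (⊝ β)) ⊕ X ⊗ X ⊗ X ⊗ (X²+X+1 ⊗ s)
    ≈⟨ ⊕-cong (≋-refl {X²+X+1 ⊗ ((α ⊕ β) ⊕ X ⊗ (⊝ α) ⊕ X ⊗ X ⊗ (⊝ β))}) (⊗-congˡ (X ⊗ X ⊗ X) (cycle₂≋ t α β γ)) ⟩
  X²+X+1 ⊗ ((α ⊕ β) ⊕ X ⊗ (⊝ α) ⊕ X ⊗ X ⊗ (⊝ β)) ⊕ X ⊗ X ⊗ X ⊗ ((1ₚ ⊕ ⊝ (X ⊗ y)) ⊗ α ⊕ (1ₚ ⊕ X ⊕ y) ⊗ β)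
    ≈⟨ solve 5 (λ x y a b c → (x :* x :+ x :+ con 1ℤ) :* ((a :+ b) :+ x :* (:- a) :+ x :* x :* (:- b)) :+ x :* x :* x :* ((con 1ℤ :+ :- (x :* y)) :* a :+ (con 1ℤ :+ x :+ y) :* b) := (con 1ℤ :+ :- (x :* (x :* (x :* (x :* y))))) :* a :+ (con 1ℤ :+ x :+ (x :* (x :* (x :* y)))) :* b) ≋-refl X y α β γ ⟩
  (1ₚ ⊕ ⊝ (X ⊗ (X ⊗ (X ⊗ (X ⊗ y))))) ⊗ α ⊕ (1ₚ ⊕ X ⊕ (X ⊗ (X ⊗ (X ⊗ y)))) ⊗ β ∎
  where
  s = blockₚ (cycle₂ t) α β γ
  y = X ↑ length (cycle₂ t)

-- The multiplier is 1 + x³ + ... + x^(3(q-1)); as 3 does not divide q, the multiples of 3 below 3q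
-- meet each residue modulo q once. The order of the selected blocks depends on q modulo 3.
select₃₁≋ : ∀ t α β γ → let y = X ↑ length (select₃₁ t) in X³-1 ⊗ blockₚ (select₃₁ t) α β γ ≋ (X ⊗ X ⊗ y ⊕ C -1ℤ) ⊗ α ⊕ (X ⊗ y ⊕ ⊝ (X ⊗ X)) ⊗ β ⊕ (y ⊕ ⊝ X) ⊗ γ
select₃₁≋ zero    α β γ = ≋-trans (⊗-congˡ X³-1 (⊕-cong (≋-refl {C 1ℤ ⊗ α ⊕ C 0ℤ ⊗ β ⊕ C 0ℤ ⊗ γ}) (⊗-congˡ X (≋-sym C-0))))
  (solve 4 (λ x a b c → (x :* x :* x :+ con -1ℤ) :* ((con 1ℤ :* a :+ con 0ℤ :* b :+ con 0ℤ :* c) :+ x :* con 0ℤ) := (x :* x :* (x :* con 1ℤ) :+ con -1ℤ) :* a :+ (x :* (x :* con 1ℤ) :+ :- (x :* x)) :* b :+ ((x :* con 1ℤ) :+ :- x) :* c) ≋-refl X α β γ)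
select₃₁≋ (suc t) α β γ = begin
  X³-1 ⊗ ((C 1ℤ ⊗ α ⊕ C 0ℤ ⊗ β ⊕ C 0ℤ ⊗ γ) ⊕ X ⊗ ((C 0ℤ ⊗ α ⊕ C 0ℤ ⊗ β ⊕ C 1ℤ ⊗ γ) ⊕ X ⊗ ((C 0ℤ ⊗ α ⊕ C 1ℤ ⊗ β ⊕ C 0ℤ ⊗ γ) ⊕ X ⊗ s)))
    ≈⟨ solve 5 (λ x s a b c → (x :* x :* x :+ con -1ℤ) :* ((con 1ℤ :* a :+ con 0ℤ :* b :+ con 0ℤ :* c) :+ x :* ((con 0ℤ :* a :+ con 0ℤ :* b :+ con 1ℤ :* c) :+ x :* ((con 0ℤ :* a :+ con 1ℤ :* b :+ con 0ℤ :* c) :+ x :* s)))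
         := (x :* x :* x :+ con -1ℤ) :* (a :+ x :* c :+ x :* x :* b) :+ x :* x :* x :* ((x :* x :* x :+ con -1ℤ) :* s)) ≋-refl X s α β γ ⟩
  X³-1 ⊗ (α ⊕ X ⊗ γ ⊕ X ⊗ X ⊗ β) ⊕ X ⊗ X ⊗ X ⊗ (X³-1 ⊗ s)
    ≈⟨ ⊕-cong (≋-refl {X³-1 ⊗ (α ⊕ X ⊗ γ ⊕ X ⊗ X ⊗ β)}) (⊗-congˡ (X ⊗ X ⊗ X) (select₃₁≋ t α β γ)) ⟩
  X³-1 ⊗ (α ⊕ X ⊗ γ ⊕ X ⊗ X ⊗ β) ⊕ X ⊗ X ⊗ X ⊗ ((X ⊗ X ⊗ y ⊕ C -1ℤ) ⊗ α ⊕ (X ⊗ y ⊕ ⊝ (X ⊗ X)) ⊗ β ⊕ (y ⊕ ⊝ X) ⊗ γ)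
    ≈⟨ solve 5 (λ x y a b c → (x :* x :* x :+ con -1ℤ) :* (a :+ x :* c :+ x :* x :* b) :+ x :* x :* x :* ((x :* x :* y :+ con -1ℤ) :* a :+ (x :* y :+ :- (x :* x)) :* b :+ (y :+ :- x) :* c) := (x :* x :* (x :* (x :* (x :* y))) :+ con -1ℤ) :* a :+ (x :* (x :* (x :* (x :* y))) :+ :- (x :* x)) :* b :+ ((x :* (x :* (x :* y))) :+ :- x) :* c) ≋-refl X y α β γ ⟩
  (X ⊗ X ⊗ (X ⊗ (X ⊗ (X ⊗ y))) ⊕ C -1ℤ) ⊗ α ⊕ (X ⊗ (X ⊗ (X ⊗ (X ⊗ y))) ⊕ ⊝ (X ⊗ X)) ⊗ β ⊕ ((X ⊗ (X ⊗ (X ⊗ y))) ⊕ ⊝ X) ⊗ γ ∎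
  where
  s = blockₚ (select₃₁ t) α β γ
  y = X ↑ length (select₃₁ t)

select₃₂≋ : ∀ t α β γ → let y = X ↑ length (select₃₂ t) in X³-1 ⊗ blockₚ (select₃₂ t) α β γ ≋ (X ⊗ y ⊕ C -1ℤ) ⊗ α ⊕ (X ⊗ X ⊗ y ⊕ ⊝ X) ⊗ β ⊕ (y ⊕ ⊝ (X ⊗ X)) ⊗ γ
select₃₂≋ zero    α β γ = ≋-trans (⊗-congˡ X³-1 (⊕-cong (≋-refl {C 1ℤ ⊗ α ⊕ C 0ℤ ⊗ β ⊕ C 0ℤ ⊗ γ}) (⊗-congˡ X (⊕-cong (≋-refl {C 0ℤ ⊗ α ⊕ C 1ℤ ⊗ β ⊕ C 0ℤ ⊗ γ}) (⊗-congˡ X (≋-sym C-0))))))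
  (solve 4 (λ x a b c → (x :* x :* x :+ con -1ℤ) :* ((con 1ℤ :* a :+ con 0ℤ :* b :+ con 0ℤ :* c) :+ x :* ((con 0ℤ :* a :+ con 1ℤ :* b :+ con 0ℤ :* c) :+ x :* con 0ℤ)) := (x :* (x :* (x :* con 1ℤ)) :+ con -1ℤ) :* a :+ (x :* x :* (x :* (x :* con 1ℤ)) :+ :- x) :* b :+ ((x :* (x :* con 1ℤ)) :+ :- (x :* x)) :* c) ≋-refl X α β γ)
select₃₂≋ (suc t) α β γ = begin
  X³-1 ⊗ ((C 1ℤ ⊗ α ⊕ C 0ℤ ⊗ β ⊕ C 0ℤ ⊗ γ) ⊕ X ⊗ ((C 0ℤ ⊗ α ⊕ C 1ℤ ⊗ β ⊕ C 0ℤ ⊗ γ) ⊕ X ⊗ ((C 0ℤ ⊗ α ⊕ C 0ℤ ⊗ β ⊕ C 1ℤ ⊗ γ) ⊕ X ⊗ s)))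
    ≈⟨ solve 5 (λ x s a b c → (x :* x :* x :+ con -1ℤ) :* ((con 1ℤ :* a :+ con 0ℤ :* b :+ con 0ℤ :* c) :+ x :* ((con 0ℤ :* a :+ con 1ℤ :* b :+ con 0ℤ :* c) :+ x :* ((con 0ℤ :* a :+ con 0ℤ :* b :+ con 1ℤ :* c) :+ x :* s)))
         := (x :* x :* x :+ con -1ℤ) :* (a :+ x :* b :+ x :* x :* c) :+ x :* x :* x :* ((x :* x :* x :+ con -1ℤ) :* s)) ≋-refl X s α β γ ⟩
  X³-1 ⊗ (α ⊕ X ⊗ β ⊕ X ⊗ X ⊗ γ) ⊕ X ⊗ X ⊗ X ⊗ (X³-1 ⊗ s)
    ≈⟨ ⊕-cong (≋-refl {X³-1 ⊗ (α ⊕ X ⊗ β ⊕ X ⊗ X ⊗ γ)}) (⊗-congˡ (X ⊗ X ⊗ X) (select₃₂≋ t α β γ)) ⟩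
  X³-1 ⊗ (α ⊕ X ⊗ β ⊕ X ⊗ X ⊗ γ) ⊕ X ⊗ X ⊗ X ⊗ ((X ⊗ y ⊕ C -1ℤ) ⊗ α ⊕ (X ⊗ X ⊗ y ⊕ ⊝ X) ⊗ β ⊕ (y ⊕ ⊝ (X ⊗ X)) ⊗ γ)
    ≈⟨ solve 5 (λ x y a b c → (x :* x :* x :+ con -1ℤ) :* (a :+ x :* b :+ x :* x :* c) :+ x :* x :* x :* ((x :* y :+ con -1ℤ) :* a :+ (x :* x :* y :+ :- x) :* b :+ (y :+ :- (x :* x)) :* c) := (x :* (x :* (x :* (x :* y))) :+ con -1ℤ) :* a :+ (x :* x :* (x :* (x :* (x :* y))) :+ :- x) :* b :+ ((x :* (x :* (x :* y))) :+ :- (x :* x)) :* c) ≋-refl X y α β γ ⟩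
  (X ⊗ (X ⊗ (X ⊗ (X ⊗ y))) ⊕ C -1ℤ) ⊗ α ⊕ (X ⊗ X ⊗ (X ⊗ (X ⊗ (X ⊗ y))) ⊕ ⊝ X) ⊗ β ⊕ ((X ⊗ (X ⊗ (X ⊗ y))) ⊕ ⊝ (X ⊗ X)) ⊗ γ ∎
  where
  s = blockₚ (select₃₂ t) α β γ
  y = X ↑ length (select₃₂ t)

-- Heights

Bounded : ℕ → Poly → Set
Bounded h f = ∀ i → ℤ.∣ coeff f i ∣ ≤ h

Bounded-resp : ∀ {h f g} → f ≋ g → Bounded h f → Bounded h g
Bounded-resp {h} e b i = subst (λ z → ℤ.∣ z ∣ ≤ h) (at e i) (b i)

Bounded-mono : ∀ {h k f} → h ≤ k → Bounded h f → Bounded k f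
Bounded-mono h≤k b i = ℕ.≤-trans (b i) h≤k

Bounded-⊕ : ∀ {h k} f g → Bounded h f → Bounded k g → Bounded (h ℕ.+ k) (f ⊕ g)
Bounded-⊕ {h} {k} f g b c i = subst (λ z → ℤ.∣ z ∣ ≤ h ℕ.+ k) (≡.sym (coeff-⊕ f g i)) (ℕ.≤-trans (ℤ.∣i+j∣≤∣i∣+∣j∣ (coeff f i) (coeff g i)) (ℕ.+-mono-≤ (b i) (c i)))

Bounded-⊝ : ∀ {h} f → Bounded h f → Bounded h (⊝ f)
Bounded-⊝ {h} f b i = subst (_≤ h) (≡.sym (≡.trans (cong ℤ.∣_∣ (coeff-⊝ f i)) (ℤ.∣-i∣≡∣i∣ (coeff f i)))) (b i)

Bounded-X⊗ : ∀ {h} f → Bounded h f → Bounded h (X ⊗ f)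
Bounded-X⊗ {h} f b = Bounded-resp (≋-sym (X-⊗ f)) λ { zero → z≤n ; (suc i) → b i }

Bounded-unit⊗ : ∀ {h ε f} → IsUnit ε → Bounded h f → Bounded h (C ε ⊗ f)
Bounded-unit⊗ {f = f} (inj₁ refl) b = Bounded-resp (≋-sym (⊗-identityˡ f)) b
Bounded-unit⊗ {f = f} (inj₂ refl) b = Bounded-resp (solve 1 (λ f → :- f := con -1ℤ :* f) ≋-refl f) (Bounded-⊝ f b)

Bounded⇒H≤ : ∀ {h} f → Bounded h f → H f ≤ h
Bounded⇒H≤ []      b = z≤n
Bounded⇒H≤ (a ∷ f) b = ℕ.⊔-lub (b 0) (Bounded⇒H≤ f λ i → b (suc i))

Bounded-++ : ∀ {h} f g → Bounded h f → Bounded h g → Bounded h (f ++ g)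
Bounded-++ []      g b c i       = c i
Bounded-++ (a ∷ f) g b c zero    = b 0
Bounded-++ (a ∷ f) g b c (suc i) = Bounded-++ f g (λ j → b (suc j)) c i

-- Satisfied by triples with at most one non-zero entry, equal to 1 or -1; steps built from such
-- triples keep the height.
Selecting : Triple → Set
Selecting t = ∀ {h} a b c → ℤ.∣ a ∣ ≤ h → ℤ.∣ b ∣ ≤ h → ℤ.∣ c ∣ ≤ h → ℤ.∣ combine a b c t ∣ ≤ h

combine-100 : ∀ a b c → combine a b c (1ℤ , 0ℤ , 0ℤ) ≡ a
combine-100 a b c = lemma a b c
  where
  lemma : ∀ a b c → 1ℤ ℤ.* a ℤ.+ 0ℤ ℤ.* b ℤ.+ 0ℤ ℤ.* c ≡ a
  lemma = solve-∀

combine-010 : ∀ a b c → combine a b c (0ℤ , 1ℤ , 0ℤ) ≡ b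
combine-010 a b c = lemma a b c
  where
  lemma : ∀ a b c → 0ℤ ℤ.* a ℤ.+ 1ℤ ℤ.* b ℤ.+ 0ℤ ℤ.* c ≡ b
  lemma = solve-∀

combine-001 : ∀ a b c → combine a b c (0ℤ , 0ℤ , 1ℤ) ≡ c
combine-001 a b c = lemma a b c
  where
  lemma : ∀ a b c → 0ℤ ℤ.* a ℤ.+ 0ℤ ℤ.* b ℤ.+ 1ℤ ℤ.* c ≡ c
  lemma = solve-∀

combine-000 : ∀ a b c → combine a b c (0ℤ , 0ℤ , 0ℤ) ≡ 0ℤ
combine-000 a b c = lemma a b c
  where
  lemma : ∀ a b c → 0ℤ ℤ.* a ℤ.+ 0ℤ ℤ.* b ℤ.+ 0ℤ ℤ.* c ≡ 0ℤ
  lemma = solve-∀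

combine--100 : ∀ a b c → combine a b c (-1ℤ , 0ℤ , 0ℤ) ≡ ℤ.- a
combine--100 a b c = lemma a b c
  where
  lemma : ∀ a b c → -1ℤ ℤ.* a ℤ.+ 0ℤ ℤ.* b ℤ.+ 0ℤ ℤ.* c ≡ ℤ.- a
  lemma = solve-∀

combine-0-10 : ∀ a b c → combine a b c (0ℤ , -1ℤ , 0ℤ) ≡ ℤ.- b
combine-0-10 a b c = lemma a b c
  where
  lemma : ∀ a b c → 0ℤ ℤ.* a ℤ.+ -1ℤ ℤ.* b ℤ.+ 0ℤ ℤ.* c ≡ ℤ.- b
  lemma = solve-∀

combine-110 : ∀ a b c → combine a b c (1ℤ , 1ℤ , 0ℤ) ≡ a ℤ.+ b
combine-110 a b c = lemma a b c
  where
  lemma : ∀ a b c → 1ℤ ℤ.* a ℤ.+ 1ℤ ℤ.* b ℤ.+ 0ℤ ℤ.* c ≡ a ℤ.+ b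
  lemma = solve-∀

combine--1-10 : ∀ a b c → combine a b c (-1ℤ , -1ℤ , 0ℤ) ≡ ℤ.- (a ℤ.+ b)
combine--1-10 a b c = lemma a b c
  where
  lemma : ∀ a b c → -1ℤ ℤ.* a ℤ.+ -1ℤ ℤ.* b ℤ.+ 0ℤ ℤ.* c ≡ ℤ.- (a ℤ.+ b)
  lemma = solve-∀

selecting-100 : Selecting (1ℤ , 0ℤ , 0ℤ)
selecting-100 {h} a b c pa pb pc = subst (λ z → ℤ.∣ z ∣ ≤ h) (≡.sym (combine-100 a b c)) pa

selecting-010 : Selecting (0ℤ , 1ℤ , 0ℤ)
selecting-010 {h} a b c pa pb pc = subst (λ z → ℤ.∣ z ∣ ≤ h) (≡.sym (combine-010 a b c)) pb

selecting-001 : Selecting (0ℤ , 0ℤ , 1ℤ)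
selecting-001 {h} a b c pa pb pc = subst (λ z → ℤ.∣ z ∣ ≤ h) (≡.sym (combine-001 a b c)) pc

selecting-000 : Selecting (0ℤ , 0ℤ , 0ℤ)
selecting-000 {h} a b c pa pb pc = subst (λ z → ℤ.∣ z ∣ ≤ h) (≡.sym (combine-000 a b c)) z≤n

selecting--100 : Selecting (-1ℤ , 0ℤ , 0ℤ)
selecting--100 {h} a b c pa pb pc = subst (λ z → ℤ.∣ z ∣ ≤ h) (≡.sym (combine--100 a b c)) (ℕ.≤-trans (ℕ.≤-reflexive (ℤ.∣-i∣≡∣i∣ a)) pa)

ones-selecting : ∀ q → All Selecting (ones q)
ones-selecting q = AllP.replicate⁺ q selecting-100

spread-selecting : ∀ r → All Selecting (spread r)
spread-selecting r = selecting-100 ∷ AllP.replicate⁺ r selecting-000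

difference-selecting : ∀ r → All Selecting (difference r)
difference-selecting r = selecting--100 ∷ selecting-100 ∷ AllP.replicate⁺ r selecting-000

alternating-selecting : ∀ t → All Selecting (alternating t)
alternating-selecting zero    = selecting-100 ∷ []
alternating-selecting (suc t) = selecting-100 ∷ selecting--100 ∷ alternating-selecting t

select₂-selecting : ∀ t → All Selecting (select₂ t)
select₂-selecting zero    = selecting-100 ∷ []
select₂-selecting (suc t) = selecting-100 ∷ selecting-010 ∷ select₂-selecting t

select₃₁-selecting : ∀ t → All Selecting (select₃₁ t)
select₃₁-selecting zero    = selecting-100 ∷ []
select₃₁-selecting (suc t) = selecting-100 ∷ selecting-001 ∷ selecting-010 ∷ select₃₁-selecting t

select₃₂-selecting : ∀ t → All Selecting (select₃₂ t)
select₃₂-selecting zero    = selecting-100 ∷ selecting-010 ∷ []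
select₃₂-selecting (suc t) = selecting-100 ∷ selecting-010 ∷ selecting-001 ∷ select₃₂-selecting t

Bounded-block : ∀ {h T a b c} → All Selecting T → ℤ.∣ a ∣ ≤ h → ℤ.∣ b ∣ ≤ h → ℤ.∣ c ∣ ≤ h → Bounded h (block T a b c)
Bounded-block []       pa pb pc i       = z≤n
Bounded-block (s ∷ ss) pa pb pc zero    = s _ _ _ pa pb pc
Bounded-block (s ∷ ss) pa pb pc (suc i) = Bounded-block ss pa pb pc i

Bounded-run : ∀ {h T b c} g → All Selecting T → ℤ.∣ b ∣ ≤ h → ℤ.∣ c ∣ ≤ h → Bounded h g → Bounded h (run T b c g)
Bounded-run {T = T} {b} {c} []      ss pb pc pg = Bounded-++ (block T 0ℤ b c) (block T 0ℤ 0ℤ b) (Bounded-block ss z≤n pb pc) (Bounded-block ss z≤n z≤n pb)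
Bounded-run {T = T} {b} {c} (a ∷ g) ss pb pc pg = Bounded-++ (block T a b c) (run T a b g) (Bounded-block ss (pg 0) pb pc) (Bounded-run g ss (pg 0) pb λ i → pg (suc i))

Bounded-selecting : ∀ {h q φ} T g → length T ≡ q → All Selecting T → ⟦ T ⟧ ≋ φ → Bounded h g → Bounded h (φ ⊗ sub (X ↑ q) g)
Bounded-selecting {q = q} T g len ss e b = Bounded-resp (≋-trans (run≋⟦⟧⊗ T len g) (⊗-cong e (≋-refl {sub (X ↑ q) g}))) (Bounded-run g ss z≤n z≤n b)

Bounded-sub : ∀ {h q} g → 1 < q → Bounded h g → Bounded h (sub (X ↑ q) g)
Bounded-sub {q = suc r} g _ b = Bounded-resp (⊗-identityˡ _) (Bounded-selecting (spread r) g (cong suc (List.length-replicate r)) (spread-selecting r) (spread≋ r _ _ _) b)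

Bounded-difference-sub : ∀ {h q} g → 1 < q → Bounded h g → Bounded h ((X ⊕ C -1ℤ) ⊗ sub (X ↑ q) g)
Bounded-difference-sub {q = suc zero}    g (s≤s ()) b
Bounded-difference-sub {q = suc (suc r)} g _        b = Bounded-selecting (difference r) g (cong (λ z → suc (suc z)) (List.length-replicate r)) (difference-selecting r)
  (≋-trans (difference≋ r _ _ _) (≋-trans (⊗-comm (X ⊕ C -1ℤ) 1ₚ) (⊗-identityˡ (X ⊕ C -1ℤ)))) b

Bounded-[X-1]⊗ : ∀ {h} g → Bounded h g → Bounded (h ℕ.+ h) ((X ⊕ C -1ℤ) ⊗ g)
Bounded-[X-1]⊗ g b = Bounded-resp (solve 2 (λ x g → x :* g :+ :- g := (x :+ con -1ℤ) :* g) ≋-refl X g) (Bounded-⊕ (X ⊗ g) (⊝ g) (Bounded-X⊗ g b) (Bounded-⊝ g b))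

Bounded-[X+1]⊗ : ∀ {h} g → Bounded h g → Bounded (h ℕ.+ h) (X+1 ⊗ g)
Bounded-[X+1]⊗ g b = Bounded-resp (solve 2 (λ x g → x :* g :+ g := (x :+ con 1ℤ) :* g) ≋-refl X g) (Bounded-⊕ (X ⊗ g) g (Bounded-X⊗ g b) b)

Bounded-[X²+X+1]⊗ : ∀ {h} g → Bounded h g → Bounded (h ℕ.+ h ℕ.+ h) (X²+X+1 ⊗ g)
Bounded-[X²+X+1]⊗ g b = Bounded-resp (solve 2 (λ x g → x :* (x :* g) :+ x :* g :+ g := (x :* x :+ x :+ con 1ℤ) :* g) ≋-refl X g)
  (Bounded-⊕ (X ⊗ (X ⊗ g) ⊕ X ⊗ g) g (Bounded-⊕ (X ⊗ (X ⊗ g)) (X ⊗ g) (Bounded-X⊗ (X ⊗ g) (Bounded-X⊗ g b)) (Bounded-X⊗ g b)) b)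

Bounded-[X²-1]⊗ : ∀ {h} g → Bounded h g → Bounded (h ℕ.+ h) (X²-1 ⊗ g)
Bounded-[X²-1]⊗ g b = Bounded-resp (solve 2 (λ x g → x :* (x :* g) :+ :- g := (x :* x :+ con -1ℤ) :* g) ≋-refl X g)
  (Bounded-⊕ (X ⊗ (X ⊗ g)) (⊝ g) (Bounded-X⊗ (X ⊗ g) (Bounded-X⊗ g b)) (Bounded-⊝ g b))

Bounded-[X³-1]⊗ : ∀ {h} g → Bounded h g → Bounded (h ℕ.+ h) (X³-1 ⊗ g)
Bounded-[X³-1]⊗ g b = Bounded-resp (solve 2 (λ x g → x :* (x :* (x :* g)) :+ :- g := (x :* x :* x :+ con -1ℤ) :* g) ≋-refl X g)
  (Bounded-⊕ (X ⊗ (X ⊗ (X ⊗ g))) (⊝ g) (Bounded-X⊗ (X ⊗ (X ⊗ g)) (Bounded-X⊗ (X ⊗ g) (Bounded-X⊗ g b))) (Bounded-⊝ g b))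

-- Neighbouring coefficients under multiplication by Φ_{3q}

record Adjacent (R : ℤ → ℤ → Set) (x : ℤ) (f : Poly) : Set where
  constructor adj
  -- `x` is the coefficient just before `f`, which lets the relation pass the border between two
  -- blocks.
  field pair : ∀ i → R (coeff (x ∷ f) i) (coeff f i)
open Adjacent

adj-∷ : ∀ {R x y y′ f} → y′ ≡ y → R x y → Adjacent R y f → Adjacent R x (y′ ∷ f)
adj-∷ refl r a = adj λ { zero → r ; (suc i) → pair a i }

adj-[] : ∀ {R x} → R x 0ℤ → R 0ℤ 0ℤ → Adjacent R x []
adj-[] r s = adj λ { zero → r ; (suc i) → s }

record In (h m : ℕ) (x y : ℤ) : Set where
  constructor in-bounds
  field
    ∣x∣≤   : ℤ.∣ x ∣ ≤ h
    ∣y∣≤   : ℤ.∣ y ∣ ≤ h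
    ∣y+x∣≤ : ℤ.∣ y ℤ.+ x ∣ ≤ m

-- The bound on differences is 3h rather than 2m: a final factor x - 1 must stay within three times
-- the height before the step, whereas m may be 2h.
record Out (h m : ℕ) (x y : ℤ) : Set where
  constructor out-bounds
  field
    ∣y∣≤   : ℤ.∣ y ∣ ≤ m
    ∣y+x∣≤ : ℤ.∣ y ℤ.+ x ∣ ≤ m
    ∣y-x∣≤ : ℤ.∣ y ℤ.- x ∣ ≤ h ℕ.+ h ℕ.+ h

∣+∣≤ : ∀ {m n} x y → ℤ.∣ x ∣ ≤ m → ℤ.∣ y ∣ ≤ n → ℤ.∣ x ℤ.+ y ∣ ≤ m ℕ.+ n
∣+∣≤ x y p r = ℕ.≤-trans (ℤ.∣i+j∣≤∣i∣+∣j∣ x y) (ℕ.+-mono-≤ p r)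

∣-∣≤ : ∀ {m} x → ℤ.∣ x ∣ ≤ m → ℤ.∣ ℤ.- x ∣ ≤ m
∣-∣≤ {m} x = subst (_≤ m) (≡.sym (ℤ.∣-i∣≡∣i∣ x))

module _ {h m : ℕ} (h≤m : h ≤ m) where
  private
    bound : ∀ {n x y} → x ≡ y → ℤ.∣ y ∣ ≤ n → ℤ.∣ x ∣ ≤ n
    bound refl p = p

  module _ {a b : ℤ} (i : In h m b a) where
    private
      pb = In.∣x∣≤ i
      pa = In.∣y∣≤ i
      ps = In.∣y+x∣≤ i
      a≤m = ℕ.≤-trans pa h≤m
      b≤m = ℕ.≤-trans pb h≤m

    -- These are the transitions of the cycles a, -(a+b), b for q ≡ 1 and a+b, -a, -b for q ≡ 2
    -- modulo 3. In both, sums of neighbours are up to sign a, b or a + b again, so the bound `m`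
    -- persists.
    out-b-a : Out h m b a
    out-b-a = out-bounds a≤m ps (ℕ.≤-trans (∣+∣≤ a (ℤ.- b) pa (∣-∣≤ b pb)) (ℕ.m≤m+n (h ℕ.+ h) h))

    out-a-−[a+b] : Out h m a (ℤ.- (a ℤ.+ b))
    out-a-−[a+b] = out-bounds (∣-∣≤ (a ℤ.+ b) ps) (bound (e₁ a b) (∣-∣≤ b b≤m)) (bound (e₂ a b) (∣-∣≤ (a ℤ.+ a ℤ.+ b) (∣+∣≤ (a ℤ.+ a) b (∣+∣≤ a a pa pa) pb)))
      where
      e₁ : ∀ a b → ℤ.- (a ℤ.+ b) ℤ.+ a ≡ ℤ.- b
      e₁ = solve-∀
      e₂ : ∀ a b → ℤ.- (a ℤ.+ b) ℤ.- a ≡ ℤ.- (a ℤ.+ a ℤ.+ b)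
      e₂ = solve-∀

    out-−[a+b]-b : Out h m (ℤ.- (a ℤ.+ b)) b
    out-−[a+b]-b = out-bounds b≤m (bound (e₁ a b) (∣-∣≤ a a≤m)) (bound (e₂ a b) (∣+∣≤ (a ℤ.+ b) b (∣+∣≤ a b pa pb) pb))
      where
      e₁ : ∀ a b → b ℤ.+ ℤ.- (a ℤ.+ b) ≡ ℤ.- a
      e₁ = solve-∀
      e₂ : ∀ a b → b ℤ.- ℤ.- (a ℤ.+ b) ≡ a ℤ.+ b ℤ.+ b
      e₂ = solve-∀

    out-−b-a+b : Out h m (ℤ.- b) (a ℤ.+ b)
    out-−b-a+b = out-bounds ps (bound (e₁ a b) a≤m) (bound (e₂ a b) (∣+∣≤ (a ℤ.+ b) b (∣+∣≤ a b pa pb) pb))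
      where
      e₁ : ∀ a b → a ℤ.+ b ℤ.+ ℤ.- b ≡ a
      e₁ = solve-∀
      e₂ : ∀ a b → a ℤ.+ b ℤ.- ℤ.- b ≡ a ℤ.+ b ℤ.+ b
      e₂ = solve-∀

    out-a+b-−a : Out h m (a ℤ.+ b) (ℤ.- a)
    out-a+b-−a = out-bounds (∣-∣≤ a a≤m) (bound (e₁ a b) b≤m) (bound (e₂ a b) (∣-∣≤ (a ℤ.+ a ℤ.+ b) (∣+∣≤ (a ℤ.+ a) b (∣+∣≤ a a pa pa) pb)))
      where
      e₁ : ∀ a b → ℤ.- a ℤ.+ (a ℤ.+ b) ≡ b
      e₁ = solve-∀
      e₂ : ∀ a b → ℤ.- a ℤ.- (a ℤ.+ b) ≡ ℤ.- (a ℤ.+ a ℤ.+ b)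
      e₂ = solve-∀

    out-−a-−b : Out h m (ℤ.- a) (ℤ.- b)
    out-−a-−b = out-bounds (∣-∣≤ b b≤m) (bound (e₁ a b) (∣-∣≤ (a ℤ.+ b) ps)) (bound (e₂ a b) (ℕ.≤-trans (∣+∣≤ a (ℤ.- b) pa (∣-∣≤ b pb)) (ℕ.m≤m+n (h ℕ.+ h) h)))
      where
      e₁ : ∀ a b → ℤ.- b ℤ.+ ℤ.- a ≡ ℤ.- (a ℤ.+ b)
      e₁ = solve-∀
      e₂ : ∀ a b → ℤ.- b ℤ.- ℤ.- a ≡ a ℤ.+ ℤ.- b
      e₂ = solve-∀

  in-00 : In h m 0ℤ 0ℤ
  in-00 = in-bounds z≤n z≤n z≤n

  out-00 : Out h m 0ℤ 0ℤ
  out-00 = out-bounds z≤n z≤n z≤n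

  adj-cycle₁ : ∀ t {a b c x f} → In h m b a → Out h m x a → Adjacent (Out h m) a f → Adjacent (Out h m) x (block (cycle₁ t) a b c ++ f)
  adj-cycle₁ zero    {a} {b} {c} i r s = adj-∷ (combine-100 a b c) r s
  adj-cycle₁ (suc t) {a} {b} {c} i r s = adj-∷ (combine-100 a b c) r (adj-∷ (combine--1-10 a b c) (out-a-−[a+b] i)
    (adj-∷ (combine-010 a b c) (out-−[a+b]-b i) (adj-cycle₁ t i (out-b-a i) s)))

  adj-cycle₂ : ∀ t {a b c x f} → In h m b a → Out h m x (a ℤ.+ b) → Adjacent (Out h m) (ℤ.- a) f → Adjacent (Out h m) x (block (cycle₂ t) a b c ++ f)
  adj-cycle₂ zero    {a} {b} {c} i r s = adj-∷ (combine-110 a b c) r (adj-∷ (combine--100 a b c) (out-a+b-−a i) s)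
  adj-cycle₂ (suc t) {a} {b} {c} i r s = adj-∷ (combine-110 a b c) r (adj-∷ (combine--100 a b c) (out-a+b-−a i)
    (adj-∷ (combine-0-10 a b c) (out-−a-−b i) (adj-cycle₂ t i (out-−b-a+b i) s)))

  -- The output coefficient before a block is the last one of the preceding block: the previous
  -- input coefficient itself for `cycle₁`, its negative for `cycle₂`. The second closing block is
  -- zero because w = 0 in all triples.
  adj-run₁ : ∀ t {b c} g → Adjacent (In h m) b g → Adjacent (Out h m) b (run (cycle₁ t) b c g)
  adj-run₁ t {b} {c} []      i = adj-cycle₁ t (pair i 0) (out-b-a (pair i 0)) (subst (Adjacent (Out h m) 0ℤ) (List.++-identityʳ _)
    (adj-cycle₁ t in-00 out-00 (adj-[] out-00 out-00)))
  adj-run₁ t {b} {c} (a ∷ g) i = adj-cycle₁ t (pair i 0) (out-b-a (pair i 0)) (adj-run₁ t g (adj λ j → pair i (suc j)))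

  adj-run₂ : ∀ t {b c} g → Adjacent (In h m) b g → Adjacent (Out h m) (ℤ.- b) (run (cycle₂ t) b c g)
  adj-run₂ t {b} {c} []      i = adj-cycle₂ t (pair i 0) (out-−b-a+b (pair i 0)) (subst (Adjacent (Out h m) 0ℤ) (List.++-identityʳ _)
    (adj-cycle₂ t in-00 out-00 (adj-[] out-00 out-00)))
  adj-run₂ t {b} {c} (a ∷ g) i = adj-cycle₂ t (pair i 0) (out-−b-a+b (pair i 0)) (adj-run₂ t g (adj λ j → pair i (suc j)))

adj-In : ∀ {h m} g → Bounded h g → Bounded m (X+1 ⊗ g) → Adjacent (In h m) 0ℤ g
adj-In {h} {m} g bg bs = adj λ i → in-bounds (prev i) (bg i) (subst (λ z → ℤ.∣ z ∣ ≤ m) (≡.trans (at eq i) (coeff-⊕ g (0ℤ ∷ g) i)) (bs i))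
  where
  prev : ∀ i → ℤ.∣ coeff (0ℤ ∷ g) i ∣ ≤ h
  prev zero    = z≤n
  prev (suc i) = bg i
  eq : X+1 ⊗ g ≋ g ⊕ (0ℤ ∷ g)
  eq = ≋-trans (solve 2 (λ x g → (x :+ con 1ℤ) :* g := g :+ x :* g) ≋-refl X g) (⊕-cong (≋-refl {g}) (X-⊗ g))

ThreeBounds : ℕ → ℕ → Poly → Set
ThreeBounds h m f = Bounded m f × Bounded m (X+1 ⊗ f) × Bounded (h ℕ.+ h ℕ.+ h) ((X ⊕ C -1ℤ) ⊗ f)

ThreeBounds-resp : ∀ {h m f g} → f ≋ g → ThreeBounds h m f → ThreeBounds h m g
ThreeBounds-resp e (a , b , c) = Bounded-resp e a , Bounded-resp (⊗-congˡ X+1 e) b , Bounded-resp (⊗-congˡ (X ⊕ C -1ℤ) e) c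

adj-Out : ∀ {h m} f → Adjacent (Out h m) 0ℤ f → ThreeBounds h m f
adj-Out {h} {m} f a = (λ i → Out.∣y∣≤ (pair a i)) ,
  Bounded-resp (≋-trans (⊕-cong (≋-refl {f}) (≋-sym (X-⊗ f))) (solve 2 (λ x f → f :+ x :* f := (x :+ con 1ℤ) :* f) ≋-refl X f))
    (λ i → subst (λ z → ℤ.∣ z ∣ ≤ m) (≡.sym (coeff-⊕ f (0ℤ ∷ f) i)) (Out.∣y+x∣≤ (pair a i))) ,
  Bounded-resp (≋-trans (⊝-cong (⊕-cong (≋-refl {f}) (⊝-cong (≋-sym (X-⊗ f))))) (solve 2 (λ x f → :- (f :+ :- (x :* f)) := (x :+ con -1ℤ) :* f) ≋-refl X f))
    (Bounded-⊝ (f ⊕ ⊝ (0ℤ ∷ f)) λ i → subst (λ z → ℤ.∣ z ∣ ≤ h ℕ.+ h ℕ.+ h) (≡.sym (≡.trans (coeff-⊕ f (⊝ (0ℤ ∷ f)) i) (cong (λ z → coeff f i ℤ.+ z) (coeff-⊝ (0ℤ ∷ f) i)))) (Out.∣y-x∣≤ (pair a i)))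

coeff-++-< : ∀ f g {i} → i < length f → coeff (f ++ g) i ≡ coeff f i
coeff-++-< (a ∷ f) g {zero}  _       = refl
coeff-++-< (a ∷ f) g {suc i} (s≤s p) = coeff-++-< f g p

coeff-++-+ : ∀ f g i → coeff (f ++ g) (length f ℕ.+ i) ≡ coeff g i
coeff-++-+ []      g i = refl
coeff-++-+ (a ∷ f) g i = coeff-++-+ f g i

coeff-run : ∀ T b c g s {r} → s < length g → r < length T →
            coeff (run T b c g) (s ℕ.* length T ℕ.+ r) ≡ coeff (block T (coeff g s) (coeff (b ∷ g) s) (coeff (c ∷ b ∷ g) s)) r
coeff-run T b c (a ∷ g) zero        _        r< = coeff-++-< (block T a b c) (run T a b g) (ℕ.≤-trans r< (ℕ.≤-reflexive (≡.sym (length-block T a b c))))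
coeff-run T b c (a ∷ g) (suc s) {r} (s≤s s<) r< = ≡.trans (cong (coeff (block T a b c ++ run T a b g)) (≡.trans (ℕ.+-assoc (length T) (s ℕ.* length T) r) (cong (ℕ._+ (s ℕ.* length T ℕ.+ r)) (≡.sym (length-block T a b c)))))
  (≡.trans (coeff-++-+ (block T a b c) (run T a b g) (s ℕ.* length T ℕ.+ r)) (≡.trans (coeff-run T a b g s s< r<) (cong (λ z → coeff (block T (coeff g s) (coeff (a ∷ g) s) z) r) (shift s))))
  where
  shift : ∀ s → coeff (b ∷ a ∷ g) s ≡ coeff (c ∷ b ∷ a ∷ g) (suc s)
  shift s = refl

0<∣coeff∣⇒<length : ∀ f {i} → 0 < ℤ.∣ coeff f i ∣ → i < length f
0<∣coeff∣⇒<length f {i} p with i ℕ.<? length f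
... | yes i<  = i<
... | no  i≮ = contradiction (≡.trans (cong ℤ.∣_∣ (coeff-≥length f (ℕ.≮⇒≥ i≮))) refl) (ℕ.>⇒≢ p)

-- The factors of x^n - 1 for n = p q^b, with p = 2 or 3 still open

X-1 : Poly
X-1 = X ⊕ C -1ℤ

X-1≋Z : X-1 ≋ Z 1
X-1≋Z = solve 1 (λ x → x :+ con -1ℤ := x :* con 1ℤ :+ con -1ℤ) ≋-refl X

X-1-monic : Monic 1 X-1
X-1-monic = Lead-resp (≋-sym X-1≋Z) (Z-monic 0)

∷[]≋C : ∀ a → a ∷ [] ≋ C a
∷[]≋C a = mk λ { zero → ≡.sym (coeff-C-zero a) ; (suc i) → ≡.sym (coeff-C-suc a i) }

X-1≋list : X-1 ≋ -1ℤ ∷ 1ℤ ∷ []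
X-1≋list = ≋-sym (≋-trans (∷≋ -1ℤ (1ℤ ∷ [])) (≋-trans (⊕-cong (≋-refl {C -1ℤ}) (⊗-congˡ X (∷[]≋C 1ℤ)))
  (solve 1 (λ x → con -1ℤ :+ x :* con 1ℤ := x :+ con -1ℤ) ≋-refl X)))

X+1≋list : X+1 ≋ 1ℤ ∷ 1ℤ ∷ []
X+1≋list = ≋-sym (≋-trans (∷≋ 1ℤ (1ℤ ∷ [])) (≋-trans (⊕-cong (≋-refl {1ₚ}) (⊗-congˡ X (∷[]≋C 1ℤ)))
  (solve 1 (λ x → con 1ℤ :+ x :* con 1ℤ := x :+ con 1ℤ) ≋-refl X)))

X²+X+1≋list : X²+X+1 ≋ 1ℤ ∷ 1ℤ ∷ 1ℤ ∷ []
X²+X+1≋list = ≋-sym (≋-trans (∷≋ 1ℤ (1ℤ ∷ 1ℤ ∷ [])) (≋-trans (⊕-cong (≋-refl {1ₚ}) (⊗-congˡ X (≋-sym X+1≋list)))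
  (solve 1 (λ x → con 1ℤ :+ x :* (x :+ con 1ℤ) := x :* x :+ x :+ con 1ℤ) ≋-refl X)))

-1↑odd : ∀ t → C -1ℤ ↑ suc (t ℕ.* 2) ≋ C -1ℤ
-1↑odd zero    = solve 0 (con -1ℤ :* con 1ℤ := con -1ℤ) ≋-refl
-1↑odd (suc t) = ≋-trans (solve 1 (λ e → con -1ℤ :* (con -1ℤ :* e) := e) ≋-refl (C -1ℤ ↑ suc (t ℕ.* 2))) (-1↑odd t)

module Factors {q : ℕ} (p′ t : ℕ) (q-prime : Prime q) (1<q : 1 < q) (q-odd : q ≡ suc (t ℕ.* 2))
  {d : ℕ} (P₂ Φ₂ : Poly) (P₂-monic : Monic d P₂) (base : X-1 ⊗ P₂ ≋ Z (suc p′))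
  (l : Poly) (P₂≋l : P₂ ≋ l) (l-ones : All (_≡ 1ℤ) l) (Φ₂⊗P₂≋ : Φ₂ ⊗ P₂ ≋ sub (X ↑ q) P₂) where

  p : ℕ
  p = suc p′

  Φ₁ : Poly
  Φ₁ = ⟦ ones q ⟧

  sub-X-1 : ∀ k → sub (X ↑ k) X-1 ≋ Z k
  sub-X-1 k = ≋-trans (sub-⊕ (X ↑ k) X (C -1ℤ)) (⊕-cong (sub-X (X ↑ k)) (sub-C (X ↑ k) -1ℤ))

  Φ₁⊗X-1≋Z : Φ₁ ⊗ X-1 ≋ Z q
  Φ₁⊗X-1≋Z = ≋-trans (⊗-comm Φ₁ X-1) (≋-trans (ones≋ q _ _ _) (≋-trans (⊗-comm (Z q) 1ₚ) (⊗-identityˡ (Z q))))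

  X≈1 : ∀ {v} → X ≈ 1ₚ [ X-1 , v ]
  X≈1 = mk {k = 1ₚ} {[]} (≋-trans (solve 1 (λ x → x := con 1ℤ :+ con 1ℤ :* (x :+ con -1ℤ)) ≋-refl X) (⊕-cong (≋-refl {1ₚ}) (≋-sym (⊕-identityʳ (1ₚ ⊗ X-1)))))

  ones≈ : ∀ {v} n β γ → blockₚ (ones n) 1ₚ β γ ≈ C (+ n) [ X-1 , v ]
  ones≈ zero    β γ = ≋⇒≈ (≋-sym C-0)
  ones≈ (suc n) β γ = mod-trans (mod-⊕ (≋⇒≈ (≋-refl {C 1ℤ ⊗ 1ₚ ⊕ C 0ℤ ⊗ β ⊕ C 0ℤ ⊗ γ})) (mod-⊗ X≈1 (ones≈ n β γ)))
    (≋⇒≈ (≋-trans (solve 3 (λ b c n → (con 1ℤ :* con 1ℤ :+ con 0ℤ :* b :+ con 0ℤ :* c) :+ con 1ℤ :* n := con 1ℤ :+ n) ≋-refl β γ (C (+ n))) (≋-sym (C-+ 1ℤ (+ n)))))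

  -- This is Φ_q(1) = q, the source of the Eisenstein property at both base polynomials.
  Φ₁≈q : ∀ {v} → Φ₁ ≈ C (+ q) [ X-1 , v ]
  Φ₁≈q = ones≈ q _ _

  -- Multiplied by x^p - 1, both sides become x^(pq) - 1. The identity transports Φ_q(1) = q from x
  -- - 1 to `P₂`.
  Φ₁Φ₂≋Φ₁[X^p] : Φ₁ ⊗ Φ₂ ≋ sub (X ↑ p) Φ₁
  Φ₁Φ₂≋Φ₁[X^p] = monic-cancel (Φ₁ ⊗ Φ₂) (sub (X ↑ p) Φ₁) (Z-monic p′) (begin
    (Φ₁ ⊗ Φ₂) ⊗ Z p                      ≈⟨ ⊗-congˡ (Φ₁ ⊗ Φ₂) (≋-sym base) ⟩
    (Φ₁ ⊗ Φ₂) ⊗ (X-1 ⊗ P₂)               ≈⟨ solve 4 (λ a b c d → a :* b :* (c :* d) := (a :* c) :* (b :* d)) ≋-refl Φ₁ Φ₂ X-1 P₂ ⟩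
    (Φ₁ ⊗ X-1) ⊗ (Φ₂ ⊗ P₂)               ≈⟨ ⊗-cong (≋-trans Φ₁⊗X-1≋Z (≋-sym (sub-X-1 q))) Φ₂⊗P₂≋ ⟩
    sub (X ↑ q) X-1 ⊗ sub (X ↑ q) P₂     ≈⟨ ≋-sym (sub-⊗ (X ↑ q) X-1 P₂) ⟩
    sub (X ↑ q) (X-1 ⊗ P₂)               ≈⟨ sub-cong (X ↑ q) base ⟩
    sub (X ↑ q) (Z p)                    ≈⟨ Z-⊗ q p ⟩
    Z (q ℕ.* p)                          ≈⟨ ≋-reflexive (cong Z (ℕ.*-comm q p)) ⟩
    Z (p ℕ.* q)                          ≈⟨ ≋-sym (Z-⊗ p q) ⟩
    sub (X ↑ p) (Z q)                    ≈⟨ sub-cong (X ↑ p) (≋-sym Φ₁⊗X-1≋Z) ⟩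
    sub (X ↑ p) (Φ₁ ⊗ X-1)               ≈⟨ sub-⊗ (X ↑ p) Φ₁ X-1 ⟩
    sub (X ↑ p) Φ₁ ⊗ sub (X ↑ p) X-1     ≈⟨ ⊗-congˡ (sub (X ↑ p) Φ₁) (sub-X-1 p) ⟩
    sub (X ↑ p) Φ₁ ⊗ Z p                 ∎)

  frobenius-≋ : ∀ {f} l → f ≋ l → All (λ a → C a ↑ q ≈ C a [ C (+ q) , [] ]) l → f ↑ q ≈ sub (X ↑ q) f [ C (+ q) , [] ]
  frobenius-≋ l e h = mod-trans (≋⇒≈ (↑-cong e (refl {x = q}))) (mod-trans (frobenius q-prime l h) (≋⇒≈ (≋-sym (sub-cong (X ↑ q) e))))

  L₁ : Ramified q
  L₁ = record
    { P       = X-1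
    ; Φ       = Φ₁
    ; P-monic = X-1-monic
    ; Φ⊗P≋    = ≋-trans Φ₁⊗X-1≋Z (≋-sym (sub-X-1 q))
    ; q∈      = mod-trans (mod-sym Φ₁≈q) modʳ
    ; P↑q≈    = frobenius-≋ (-1ℤ ∷ 1ℤ ∷ []) X-1≋list (≋⇒≈ (≋-trans (≋-reflexive (cong (C -1ℤ ↑_) q-odd)) (-1↑odd t)) ∷ ≋⇒≈ (1↑ q) ∷ [])
    }

  L₂ : Ramified q
  L₂ = record
    { P       = P₂
    ; Φ       = Φ₂
    ; P-monic = P₂-monic
    ; Φ⊗P≋    = Φ₂⊗P₂≋
    -- Substituting x^p into q ≡ Φ_q modulo x - 1 gives q ≡ Φ_q(x^p) modulo x^p - 1, a multiple of
    -- `P₂`; and Φ_q(x^p) = Φ₁ Φ₂ is a multiple of `Φ₂`.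
    ; q∈      = mod-trans (≋⇒≈ (≋-sym (sub-C (X ↑ p) (+ q)))) (mod-trans (mod-mono Z≈0 (≋⇒≈ ≋-refl) (mod-sub (X ↑ p) (mod-sym (Φ₁≈q {[]}))))
                  (mod-trans (≋⇒≈ (≋-sym Φ₁Φ₂≋Φ₁[X^p])) (mod-trans (mod-⊗ˡ Φ₁ modʳ) (≋⇒≈ (⊗-zeroʳ Φ₁)))))
    ; P↑q≈    = frobenius-≋ l P₂≋l (All.map (λ { refl → ≋⇒≈ (1↑ q) }) l-ones)
    }
    where
    Z≈0 : sub (X ↑ p) X-1 ≈ [] [ P₂ , Φ₂ ]
    Z≈0 = mod-trans (≋⇒≈ (≋-trans (sub-X-1 p) (≋-sym base))) (mod-trans (mod-⊗ˡ X-1 modˡ) (≋⇒≈ (⊗-zeroʳ X-1)))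

  open Tower p 1<q L₁ L₂ base public

  Φ₁Φ₂≋ : ∀ g → g ⊗ Z p ≋ Z (p ℕ.* q) → Φ₁ ⊗ Φ₂ ≋ g
  Φ₁Φ₂≋ g e = Φ₁⊗Φ₂≋ g e (_ , Z-monic p′)

  data Step (g : Poly) : Poly → Set where
    step₁ : ∀ {f} → f ≋ sub (X ↑ q) g → Step g f
    step₂ : ∀ {f} → f ≋ Φ₁ ⊗ sub (X ↑ q) g → Step g f
    step₃ : ∀ {f} → f ≋ Φ₂ ⊗ sub (X ↑ q) g → Step g f
    step₄ : ∀ {f} → f ≋ (Φ₁ ⊗ Φ₂) ⊗ sub (X ↑ q) g → Step g f

  step : ∀ b {f} → SubProduct (cofactors (suc b)) f → ∃[ g ] SubProduct (cofactors b) g × Step g f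
  step b (drop (drop s)) with subProduct-map-sub (X ↑ q) (cofactors b) s
  ... | g , s′ , e = g , s′ , step₁ e
  step b (keep (drop s)) with subProduct-map-sub (X ↑ q) (cofactors b) s
  ... | g , s′ , e = g , s′ , step₂ (⊗-congˡ Φ₁ e)
  step b (drop (keep s)) with subProduct-map-sub (X ↑ q) (cofactors b) s
  ... | g , s′ , e = g , s′ , step₃ (⊗-congˡ Φ₂ e)
  step b (keep (keep s)) with subProduct-map-sub (X ↑ q) (cofactors b) s
  ... | g , s′ , e = g , s′ , step₄ (≋-trans (⊗-congˡ Φ₁ (⊗-congˡ Φ₂ e)) (≋-sym (⊗-assoc Φ₁ Φ₂ _)))

  Bounded-Φ₁ : ∀ {h} g → Bounded h g → Bounded h (Φ₁ ⊗ sub (X ↑ q) g)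
  Bounded-Φ₁ g = Bounded-selecting (ones q) g (List.length-replicate q) (ones-selecting q) ≋-refl

  -- The four bounds belong to the four monic divisors 1, P₂, x - 1 and x^p - 1 of x^p - 1 built
  -- from the two base factors.
  FactorBound : ℕ → ℕ → Set
  FactorBound b m = ∀ {g} → SubProduct (cofactors b) g → Bounded m g × Bounded m (P₂ ⊗ g) × Bounded m (X-1 ⊗ g) × Bounded m (X-1 ⊗ (P₂ ⊗ g))

  SeparatesAll : ℕ → Set
  SeparatesAll N = ∀ c → c ≡ 0ℤ ⊎ c ≡ + q → X-1 ∣ₚ Z (suc N) → P₂ ∣ₚ Z (suc N) → Separates (sub (X ↑ N)) X-1 c × Separates (sub (X ↑ N)) P₂ c

  Bounded-factor : ∀ {b m g} → FactorBound b m → SubProduct (factors b) g → Bounded m g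
  Bounded-factor bound (drop (drop s)) = proj₁ (bound s)
  Bounded-factor bound (drop (keep s)) = proj₁ (proj₂ (bound s))
  Bounded-factor bound (keep (drop s)) = proj₁ (proj₂ (proj₂ (bound s)))
  Bounded-factor bound (keep (keep s)) = proj₂ (proj₂ (proj₂ (bound s)))

  Bounded-divisor : ∀ b m → FactorBound b m → (∀ N → SeparatesAll N) → ∀ f → f ∣ₚ Z (p ℕ.* q ℕ.^ b) → Bounded m f
  Bounded-divisor b m bound sep f f∣Z = bounded (factorization b N suc-N (sep N) f (subst (λ n → f ∣ₚ Z n) (≡.sym suc-N) f∣Z))
    where
    N = p ℕ.* q ℕ.^ b ∸ 1
    suc-N : suc N ≡ p ℕ.* q ℕ.^ b
    suc-N = ≡.trans (ℕ.+-comm 1 N) (ℕ.m∸n+n≡m (ℕ.*-mono-≤ {1} {p} (s≤s z≤n) (ℕ.≤-trans (s≤s z≤n) (n<m^n 1<q b))))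
    bounded : Factorization N (factors b) f → Bounded m f
    bounded (ε , g , unit , s , f≋) = Bounded-resp (≋-sym f≋) (Bounded-unit⊗ unit (Bounded-factor {b} bound s))

  B-intro : ∀ b m → FactorBound b m → (∀ N → SeparatesAll N) → ∀ {g} → SubProduct (factors b) g → ∀ i → m ≤ ℤ.∣ coeff g i ∣ → B[ p ℕ.* q ℕ.^ b ]≡ m
  B-intro b m bound sep {g} s i m≤ = (g , (proj₁ g∣ , at (≋-trans (proj₂ g∣) (≋-sym (xⁿ-1≋Z n)))) , ℕ.≤-antisym (upper g g∣) (ℕ.≤-trans m≤ (∣coeff∣≤H g i))) ,
    λ { k (f , (h , e) , refl) → upper f (h , ≋-trans (mk e) (xⁿ-1≋Z n)) }
    where
    n = p ℕ.* q ℕ.^ b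
    upper : ∀ f → f ∣ₚ Z n → H f ≤ m
    upper f f∣Z = Bounded⇒H≤ f (Bounded-divisor b m bound sep f f∣Z)
    g∣ : g ∣ₚ Z n
    g∣ = ∣ₚ-resp (prod-factors b) (subProduct∣prod s)

drop-all : ∀ L → SubProduct L 1ₚ
drop-all []      = done
drop-all (φ ∷ L) = drop (drop-all L)

-- Identification of the block polynomials with quotients of cyclotomic type

length-alternating : ∀ t → length (alternating t) ≡ suc (t ℕ.* 2)
length-alternating zero    = refl
length-alternating (suc t) = cong (λ n → suc (suc n)) (length-alternating t)

length-select₂ : ∀ t → length (select₂ t) ≡ suc (t ℕ.* 2)
length-select₂ zero    = refl
length-select₂ (suc t) = cong (λ n → suc (suc n)) (length-select₂ t)

length-cycle₁ : ∀ t → length (cycle₁ t) ≡ suc (t ℕ.* 3)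
length-cycle₁ zero    = refl
length-cycle₁ (suc t) = cong (λ n → suc (suc (suc n))) (length-cycle₁ t)

length-cycle₂ : ∀ t → length (cycle₂ t) ≡ suc (suc (t ℕ.* 3))
length-cycle₂ zero    = refl
length-cycle₂ (suc t) = cong (λ n → suc (suc (suc n))) (length-cycle₂ t)

length-select₃₁ : ∀ t → length (select₃₁ t) ≡ suc (t ℕ.* 3)
length-select₃₁ zero    = refl
length-select₃₁ (suc t) = cong (λ n → suc (suc (suc n))) (length-select₃₁ t)

length-select₃₂ : ∀ t → length (select₃₂ t) ≡ suc (suc (t ℕ.* 3))
length-select₃₂ zero    = refl
length-select₃₂ (suc t) = cong (λ n → suc (suc (suc n))) (length-select₃₂ t)

X↑2* : ∀ n → X ↑ (2 ℕ.* n) ≋ X ↑ n ⊗ X ↑ n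
X↑2* n = ≋-trans (↑-+ X n (n ℕ.+ 0)) (⊗-congˡ (X ↑ n) (≋-reflexive (cong (X ↑_) (ℕ.+-identityʳ n))))

X↑3* : ∀ n → X ↑ (3 ℕ.* n) ≋ X ↑ n ⊗ (X ↑ n ⊗ X ↑ n)
X↑3* n = ≋-trans (↑-+ X n (n ℕ.+ (n ℕ.+ 0))) (⊗-congˡ (X ↑ n) (X↑2* n))

Z2≋ : Z 2 ≋ X²-1
Z2≋ = solve 1 (λ x → x :* (x :* con 1ℤ) :+ con -1ℤ := x :* x :+ con -1ℤ) ≋-refl X

Z3≋ : Z 3 ≋ X³-1
Z3≋ = solve 1 (λ x → x :* (x :* (x :* con 1ℤ)) :+ con -1ℤ := x :* x :* x :+ con -1ℤ) ≋-refl X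

sub-X+1 : ∀ u → sub u X+1 ≋ u ⊕ 1ₚ
sub-X+1 u = ≋-trans (sub-⊕ u X 1ₚ) (⊕-cong (sub-X u) (sub-C u 1ℤ))

sub-X²+X+1 : ∀ u → sub u X²+X+1 ≋ u ⊗ u ⊕ u ⊕ 1ₚ
sub-X²+X+1 u = ≋-trans (sub-⊕ u (X ⊗ X ⊕ X) 1ₚ) (⊕-cong (≋-trans (sub-⊕ u (X ⊗ X) X) (⊕-cong (≋-trans (sub-⊗ u X X) (⊗-cong (sub-X u) (sub-X u))) (sub-X u))) (sub-C u 1ℤ))

⟦alternating⟧ : ∀ {q} t → q ≡ length (alternating t) → ⟦ alternating t ⟧ ⊗ X+1 ≋ sub (X ↑ q) X+1
⟦alternating⟧ t refl = ≋-trans (⊗-comm ⟦ alternating t ⟧ X+1) (≋-trans (alternating≋ t _ _ _)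
  (≋-trans (solve 1 (λ y → (con 1ℤ :+ y) :* con 1ℤ := y :+ con 1ℤ) ≋-refl (X ↑ length (alternating t))) (≋-sym (sub-X+1 _))))

⟦select₂⟧ : ∀ {q} t → q ≡ length (select₂ t) → ⟦ select₂ t ⟧ ⊗ Z 2 ≋ Z (2 ℕ.* q)
⟦select₂⟧ t refl = ≋-trans (≋-trans (⊗-congˡ ⟦ select₂ t ⟧ Z2≋) (⊗-comm ⟦ select₂ t ⟧ X²-1)) (≋-trans (select₂≋ t _ _ _)
  (≋-trans (solve 2 (λ x y → (x :* y :+ con -1ℤ) :* con 1ℤ :+ (y :+ :- x) :* y := y :* y :+ con -1ℤ) ≋-refl X (X ↑ length (select₂ t)))
  (⊕-cong (≋-sym (X↑2* (length (select₂ t)))) (≋-refl {C -1ℤ}))))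

⟦cycle₁⟧ : ∀ {q} t → q ≡ length (cycle₁ t) → ⟦ cycle₁ t ⟧ ⊗ X²+X+1 ≋ sub (X ↑ q) X²+X+1
⟦cycle₁⟧ t refl = ≋-trans (⊗-comm ⟦ cycle₁ t ⟧ X²+X+1) (≋-trans (cycle₁≋ t _ _ _)
  (≋-trans (solve 2 (λ x y → (con 1ℤ :+ y :+ x :* y) :* con 1ℤ :+ (y :+ :- x) :* y := y :* y :+ y :+ con 1ℤ) ≋-refl X (X ↑ length (cycle₁ t))) (≋-sym (sub-X²+X+1 _))))

⟦cycle₂⟧ : ∀ {q} t → q ≡ length (cycle₂ t) → ⟦ cycle₂ t ⟧ ⊗ X²+X+1 ≋ sub (X ↑ q) X²+X+1
⟦cycle₂⟧ t refl = ≋-trans (⊗-comm ⟦ cycle₂ t ⟧ X²+X+1) (≋-trans (cycle₂≋ t _ _ _)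
  (≋-trans (solve 2 (λ x y → (con 1ℤ :+ :- (x :* y)) :* con 1ℤ :+ (con 1ℤ :+ x :+ y) :* y := y :* y :+ y :+ con 1ℤ) ≋-refl X (X ↑ length (cycle₂ t))) (≋-sym (sub-X²+X+1 _))))

⟦select₃₁⟧ : ∀ {q} t → q ≡ length (select₃₁ t) → ⟦ select₃₁ t ⟧ ⊗ Z 3 ≋ Z (3 ℕ.* q)
⟦select₃₁⟧ t refl = ≋-trans (≋-trans (⊗-congˡ ⟦ select₃₁ t ⟧ Z3≋) (⊗-comm ⟦ select₃₁ t ⟧ X³-1)) (≋-trans (select₃₁≋ t _ _ _)
  (≋-trans (solve 2 (λ x y → (x :* x :* y :+ con -1ℤ) :* con 1ℤ :+ (x :* y :+ :- (x :* x)) :* y :+ (y :+ :- x) :* (y :* y) := y :* (y :* y) :+ con -1ℤ) ≋-refl X (X ↑ length (select₃₁ t)))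
  (⊕-cong (≋-sym (X↑3* (length (select₃₁ t)))) (≋-refl {C -1ℤ}))))

⟦select₃₂⟧ : ∀ {q} t → q ≡ length (select₃₂ t) → ⟦ select₃₂ t ⟧ ⊗ Z 3 ≋ Z (3 ℕ.* q)
⟦select₃₂⟧ t refl = ≋-trans (≋-trans (⊗-congˡ ⟦ select₃₂ t ⟧ Z3≋) (⊗-comm ⟦ select₃₂ t ⟧ X³-1)) (≋-trans (select₃₂≋ t _ _ _)
  (≋-trans (solve 2 (λ x y → (x :* y :+ con -1ℤ) :* con 1ℤ :+ (x :* x :* y :+ :- x) :* y :+ (y :+ :- (x :* x)) :* (y :* y) := y :* (y :* y) :+ con -1ℤ) ≋-refl X (X ↑ length (select₃₂ t)))
  (⊕-cong (≋-sym (X↑3* (length (select₃₂ t)))) (≋-refl {C -1ℤ}))))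

X+1-monic : Monic 1 X+1
X+1-monic = Lead-resp (≋-sym X+1≋list) (refl , λ _ → refl)

X²+X+1-monic : Monic 2 X²+X+1
X²+X+1-monic = Lead-resp (≋-sym X²+X+1≋list) (refl , λ _ → refl)

X-1⊗X+1≋Z : X-1 ⊗ X+1 ≋ Z 2
X-1⊗X+1≋Z = solve 1 (λ x → (x :+ con -1ℤ) :* (x :+ con 1ℤ) := x :* (x :* con 1ℤ) :+ con -1ℤ) ≋-refl X

X-1⊗X²+X+1≋Z : X-1 ⊗ X²+X+1 ≋ Z 3
X-1⊗X²+X+1≋Z = solve 1 (λ x → (x :+ con -1ℤ) :* (x :* x :+ x :+ con 1ℤ) := x :* (x :* (x :* con 1ℤ)) :+ con -1ℤ) ≋-refl X

prime⇒1< : ∀ {q} → Prime q → 1 < q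
prime⇒1< {zero}        pr = contradiction pr ¬prime[0]
prime⇒1< {suc zero}    pr = contradiction pr ¬prime[1]
prime⇒1< {suc (suc q)} pr = s≤s (s≤s z≤n)

prime⇒∤ : ∀ {p q} → Prime q → 1 < p → p < q → ∀ k → q ≢ k ℕ.* p
prime⇒∤ {p} pr 1<p p<q k e = [ (λ p≡1 → ℕ.<⇒≢ 1<p (≡.sym p≡1)) , ℕ.<⇒≢ p<q ]′ (prime⇒irreducible pr (divides k e))

euclid-0-or-prime : ∀ {q c} → Prime q → c ≡ 0ℤ ⊎ c ≡ + q → EuclidsLemma c
euclid-0-or-prime pr (inj₁ refl) = euclid-0
euclid-0-or-prime pr (inj₂ refl) = euclid-prime pr

-- The case p = 2

module TwoCase {q : ℕ} (t : ℕ) (q-prime : Prime q) (q≡ : q ≡ suc (suc t ℕ.* 2)) where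
  private
    Φ₂ = ⟦ alternating (suc t) ⟧
    q≡alternating = ≡.trans q≡ (≡.sym (length-alternating (suc t)))
    q≡select = ≡.trans q≡ (≡.sym (length-select₂ (suc t)))
  open Factors 1 (suc t) q-prime (prime⇒1< q-prime) q≡ X+1 Φ₂ X+1-monic X-1⊗X+1≋Z (1ℤ ∷ 1ℤ ∷ []) X+1≋list (refl ∷ refl ∷ []) (⟦alternating⟧ (suc t) q≡alternating)

  Bounded-1 : ∀ b {g} → SubProduct (cofactors b) g → Bounded 1 g
  Bounded-step : ∀ {g f} → Bounded 1 g → Step g f → Bounded 1 f
  Bounded-1 zero done zero    = ℕ.≤-reflexive (cong ℤ.∣_∣ (coeff-C-zero 1ℤ))
  Bounded-1 zero done (suc i) = subst (_≤ 1) (≡.sym (cong ℤ.∣_∣ (coeff-C-suc 1ℤ i))) z≤n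
  Bounded-1 (suc b) s = Bounded-step (Bounded-1 b (proj₁ (proj₂ (step b s)))) (proj₂ (proj₂ (step b s)))
  Bounded-step {g} bd (step₁ e) = Bounded-resp (≋-sym e) (Bounded-sub g (prime⇒1< q-prime) bd)
  Bounded-step {g} bd (step₂ e) = Bounded-resp (≋-sym e) (Bounded-Φ₁ g bd)
  Bounded-step {g} bd (step₃ e) = Bounded-resp (≋-sym e) (Bounded-selecting (alternating (suc t)) g (≡.sym q≡alternating) (alternating-selecting (suc t)) ≋-refl bd)
  Bounded-step {g} bd (step₄ e) = Bounded-resp (≋-sym e) (Bounded-selecting (select₂ (suc t)) g (≡.sym q≡select) (select₂-selecting (suc t))
    (≋-sym (Φ₁Φ₂≋ ⟦ select₂ (suc t) ⟧ (⟦select₂⟧ (suc t) q≡select))) bd)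

  factor-bound : ∀ b → FactorBound b 2
  factor-bound b {g} s = Bounded-mono {f = g} (s≤s z≤n) bd , Bounded-[X+1]⊗ g bd , Bounded-[X-1]⊗ g bd ,
    Bounded-resp (solve 2 (λ x g → (x :* x :+ con -1ℤ) :* g := (x :+ con -1ℤ) :* ((x :+ con 1ℤ) :* g)) ≋-refl X g) (Bounded-[X²-1]⊗ g bd)
    where bd = Bounded-1 b s

  separates : ∀ N → SeparatesAll N
  separates N c c≡ _ _ = separates-linear (sub (X ↑ N)) (euclid-0-or-prime q-prime c≡) X-1-monic , separates-linear (sub (X ↑ N)) (euclid-0-or-prime q-prime c≡) X+1-monic

  -- The multiplier `Φ₂` begins 1 - x, because `suc t` provides at least two alternating terms;
  -- times x - 1 the coefficient of x is 1 - (-1). This attains the height 2.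
  coeff-X-1⊗Φ₂ : coeff (X-1 ⊗ (Φ₂ ⊗ 1ₚ)) 1 ≡ + 2
  coeff-X-1⊗Φ₂ = ≡.trans (at eq 1) (≡.trans (coeff-⊕ (0ℤ ∷ f) (⊝ f) 1) (cong (λ z → coeff f 0 ℤ.+ z) (coeff-⊝ f 1)))
    where
    f = run (alternating (suc t)) 0ℤ 0ℤ (1ℤ ∷ [])
    eq : X-1 ⊗ (Φ₂ ⊗ 1ₚ) ≋ (0ℤ ∷ f) ⊕ ⊝ f
    eq = begin
      X-1 ⊗ (Φ₂ ⊗ 1ₚ)                          ≈⟨ ⊗-congˡ X-1 (⊗-congˡ Φ₂ (≋-sym (≋-trans (sub-cong (X ↑ q) (∷[]≋C 1ℤ)) (sub-C (X ↑ q) 1ℤ)))) ⟩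
      X-1 ⊗ (Φ₂ ⊗ sub (X ↑ q) (1ℤ ∷ []))       ≈⟨ ⊗-congˡ X-1 (≋-sym (run≋⟦⟧⊗ (alternating (suc t)) (≡.sym q≡alternating) (1ℤ ∷ []))) ⟩
      X-1 ⊗ f                                  ≈⟨ solve 2 (λ x f → (x :+ con -1ℤ) :* f := x :* f :+ :- f) ≋-refl X f ⟩
      X ⊗ f ⊕ ⊝ f                              ≈⟨ ⊕-cong (X-⊗ f) (≋-refl {⊝ f}) ⟩
      (0ℤ ∷ f) ⊕ ⊝ f                           ∎

  B≡2 : ∀ b → B[ 2 ℕ.* q ℕ.^ suc b ]≡ 2
  B≡2 b = B-intro (suc b) 2 (factor-bound (suc b)) separates (keep (drop (drop (keep (drop-all (map (sub (X ↑ q)) (cofactors b))))))) 1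
    (ℕ.≤-reflexive (≡.sym (cong ℤ.∣_∣ coeff-X-1⊗Φ₂)))

-- The case p = 3

lo : ℕ → ℕ
lo zero          = 1
lo (suc zero)    = 1
lo (suc (suc b)) = 2 ℕ.* lo b

lo-≤-suc : ∀ b → lo b ≤ lo (suc b)
lo-≤-suc zero          = s≤s z≤n
lo-≤-suc (suc zero)    = s≤s z≤n
lo-≤-suc (suc (suc b)) = ℕ.*-monoʳ-≤ 2 (lo-≤-suc b)

lo-suc-≤ : ∀ b → lo (suc b) ≤ lo b ℕ.+ lo b
lo-suc-≤ zero    = s≤s z≤n
lo-suc-≤ (suc b) = ℕ.≤-trans (ℕ.≤-reflexive (cong (lo b ℕ.+_) (ℕ.+-identityʳ (lo b)))) (ℕ.+-mono-≤ (lo-≤-suc b) (lo-≤-suc b))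

0<lo : ∀ b → 0 < lo b
0<lo zero          = s≤s z≤n
0<lo (suc zero)    = s≤s z≤n
0<lo (suc (suc b)) = ℕ.*-mono-≤ {1} {2} (s≤s z≤n) (0<lo b)

lo≡2^ : ∀ b → lo b ≡ 2 ℕ.^ (b / 2)
lo≡2^ zero          = refl
lo≡2^ (suc zero)    = refl
lo≡2^ (suc (suc b)) = ≡.trans (cong (2 ℕ.*_) (lo≡2^ b)) (cong (2 ℕ.^_) (≡.sym (m/n≡1+[m∸n]/n {suc (suc b)} {2} (s≤s (s≤s z≤n)))))

HasCoeff : ℕ → Poly → Set
HasCoeff n f = ∃[ i ] ℤ.∣ coeff f i ∣ ≡ n

-- Two equal neighbours suffice for a doubling by Φ_{3q}; three are what 1 + x + x² turns into three
-- times the coefficient.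
HasTriple : ℕ → Poly → Set
HasTriple n f = ∃[ i ] ∃[ a ] ℤ.∣ a ∣ ≡ n × coeff f i ≡ a × coeff f (suc i) ≡ a × coeff f (suc (suc i)) ≡ a

∣a+a∣ : ∀ a → ℤ.∣ a ℤ.+ a ∣ ≡ 2 ℕ.* ℤ.∣ a ∣
∣a+a∣ a = ≡.trans (cong ℤ.∣_∣ (double a)) (ℤ.abs-* (+ 2) a)
  where
  double : ∀ a → a ℤ.+ a ≡ + 2 ℤ.* a
  double = solve-∀

∣a+a+a∣ : ∀ a → ℤ.∣ a ℤ.+ a ℤ.+ a ∣ ≡ 3 ℕ.* ℤ.∣ a ∣
∣a+a+a∣ a = ≡.trans (cong ℤ.∣_∣ (triple a)) (ℤ.abs-* (+ 3) a)
  where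
  triple : ∀ a → a ℤ.+ a ℤ.+ a ≡ + 3 ℤ.* a
  triple = solve-∀

coeff-block-ones : ∀ {q r} a b c → r < q → coeff (block (ones q) a b c) r ≡ a
coeff-block-ones {suc q} {zero}  a b c _        = combine-100 a b c
coeff-block-ones {suc q} {suc r} a b c (s≤s r<) = coeff-block-ones a b c r<

triple⇒X²+X+1⊗ : ∀ {n f} → HasTriple n f → HasCoeff (3 ℕ.* n) (X²+X+1 ⊗ f)
triple⇒X²+X+1⊗ {f = f} (i , a , refl , p , r , s) = suc (suc i) , ≡.trans (cong ℤ.∣_∣ eq) (∣a+a+a∣ a)
  where
  expand : X²+X+1 ⊗ f ≋ (0ℤ ∷ 0ℤ ∷ f) ⊕ (0ℤ ∷ f) ⊕ f
  expand = ≋-trans (solve 2 (λ x f → (x :* x :+ x :+ con 1ℤ) :* f := x :* (x :* f) :+ x :* f :+ f) ≋-refl X f)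
    (⊕-cong (⊕-cong (≋-trans (⊗-congˡ X (X-⊗ f)) (X-⊗ (0ℤ ∷ f))) (X-⊗ f)) (≋-refl {f}))
  eq : coeff (X²+X+1 ⊗ f) (suc (suc i)) ≡ a ℤ.+ a ℤ.+ a
  eq = ≡.trans (at expand (suc (suc i))) (≡.trans (coeff-⊕ ((0ℤ ∷ 0ℤ ∷ f) ⊕ (0ℤ ∷ f)) f (suc (suc i)))
    (cong₂ ℤ._+_ (≡.trans (coeff-⊕ (0ℤ ∷ 0ℤ ∷ f) (0ℤ ∷ f) (suc (suc i))) (cong₂ ℤ._+_ p r)) s))

-- `0 < n` places the index inside the list, hence at the start of a genuine block, whose q > 2
-- entries all repeat the coefficient.
coeff⇒run-ones : ∀ {q n} g → 2 < q → 0 < n → HasCoeff n g → HasTriple n (run (ones q) 0ℤ 0ℤ g)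
coeff⇒run-ones {q} g 2<q 0<n (s , refl) = s ℕ.* length (ones q) ℕ.+ 0 , coeff g s , refl , value 0 (ℕ.≤-trans (s≤s z≤n) 2<q) ,
  ≡.trans (cong (coeff F) (≡.sym (ℕ.+-suc (s ℕ.* length (ones q)) 0))) (value 1 (ℕ.≤-trans (s≤s (s≤s z≤n)) 2<q)) ,
  ≡.trans (cong (coeff F) (≡.trans (cong suc (≡.sym (ℕ.+-suc (s ℕ.* length (ones q)) 0))) (≡.sym (ℕ.+-suc (s ℕ.* length (ones q)) 1)))) (value 2 2<q)
  where
  F = run (ones q) 0ℤ 0ℤ g
  value : ∀ r → r < q → coeff F (s ℕ.* length (ones q) ℕ.+ r) ≡ coeff g s
  value r r<q = ≡.trans (coeff-run (ones q) 0ℤ 0ℤ g s (0<∣coeff∣⇒<length g 0<n) (ℕ.≤-trans r<q (ℕ.≤-reflexive (≡.sym (List.length-replicate q)))))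
    (coeff-block-ones _ _ _ r<q)

-- In block s + 1 both gₛ₊₁ and gₛ equal a; `r` is the offset of an entry that adds the two up to
-- sign.
triple⇒run : ∀ {n} T r g → r < length T → (∀ a c → ℤ.∣ coeff (block T a a c) r ∣ ≡ 2 ℕ.* ℤ.∣ a ∣) → 0 < n → HasTriple n g → HasCoeff (2 ℕ.* n) (run T 0ℤ 0ℤ g)
triple⇒run T r g r< doubles 0<n (s , a , refl , p , p′ , _) = suc s ℕ.* length T ℕ.+ r , ≡.trans (cong ℤ.∣_∣ (coeff-run T 0ℤ 0ℤ g (suc s)
  (0<∣coeff∣⇒<length g (subst (λ z → 0 < ℤ.∣ z ∣) (≡.sym p′) 0<n)) r<)) (subst (λ z → ℤ.∣ coeff (block T (coeff g (suc s)) z (coeff (0ℤ ∷ g) s)) r ∣ ≡ 2 ℕ.* ℤ.∣ a ∣) (≡.sym p)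
    (subst (λ z → ℤ.∣ coeff (block T z a (coeff (0ℤ ∷ g) s)) r ∣ ≡ 2 ℕ.* ℤ.∣ a ∣) (≡.sym p′) (doubles a (coeff (0ℤ ∷ g) s))))

HasCoeff-resp : ∀ {n f g} → f ≋ g → HasCoeff n f → HasCoeff n g
HasCoeff-resp e (i , p) = i , ≡.trans (cong ℤ.∣_∣ (≡.sym (at e i))) p

HasTriple-resp : ∀ {n f g} → f ≋ g → HasTriple n f → HasTriple n g
HasTriple-resp e (i , a , n≡ , p , r , s) = i , a , n≡ , ≡.trans (≡.sym (at e i)) p , ≡.trans (≡.sym (at e (suc i))) r , ≡.trans (≡.sym (at e (suc (suc i)))) s

module ThreeCase {q : ℕ} (t : ℕ) (q-prime : Prime q) (3<q : 3 < q) (q-odd : q ≡ suc (t ℕ.* 2)) (T₃ T₄ : List Triple)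
  (len₃ : q ≡ length T₃) (T₃-eq : ⟦ T₃ ⟧ ⊗ X²+X+1 ≋ sub (X ↑ q) X²+X+1)
  (len₄ : q ≡ length T₄) (T₄-selecting : All Selecting T₄) (T₄-eq : ⟦ T₄ ⟧ ⊗ Z 3 ≋ Z (3 ℕ.* q))
  (bounds : ∀ {h m} g → h ≤ m → Bounded h g → Bounded m (X+1 ⊗ g) → ThreeBounds h m (run T₃ 0ℤ 0ℤ g))
  (r : ℕ) (r< : r < length T₃) (doubles : ∀ a c → ℤ.∣ coeff (block T₃ a a c) r ∣ ≡ 2 ℕ.* ℤ.∣ a ∣) where
  private
    Φ₂ = ⟦ T₃ ⟧
    1<q = prime⇒1< q-prime
    2<q = ℕ.<-trans (ℕ.n<1+n 2) 3<q
  open Factors 2 t q-prime 1<q q-odd X²+X+1 Φ₂ X²+X+1-monic X-1⊗X²+X+1≋Z (1ℤ ∷ 1ℤ ∷ 1ℤ ∷ []) X²+X+1≋list (refl ∷ refl ∷ refl ∷ []) T₃-eq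

  ĝ : Poly → Poly
  ĝ = sub (X ↑ q)

  Φ₂-bounds : ∀ {h m} g → h ≤ m → Bounded h g → Bounded m (X+1 ⊗ g) → ThreeBounds h m (Φ₂ ⊗ ĝ g)
  Φ₂-bounds {h} {m} g h≤m bg bs = ThreeBounds-resp {h} {m} (run≋⟦⟧⊗ T₃ (≡.sym len₃) g) (bounds g h≤m bg bs)

  Bounded-Φ₁Φ₂ : ∀ {h} g → Bounded h g → Bounded h ((Φ₁ ⊗ Φ₂) ⊗ ĝ g)
  Bounded-Φ₁Φ₂ g = Bounded-selecting T₄ g (≡.sym len₄) T₄-selecting (≋-sym (Φ₁Φ₂≋ ⟦ T₄ ⟧ T₄-eq))

  -- The height after b steps and, one level ahead, the sums of neighbours. A step with Φ_{3q} makes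
  -- the second bound the new height; any other step keeps the height and at most doubles it for the
  -- sums, which is the factor 2 from `lo b` to `lo (suc (suc b))`.
  State : ℕ → Poly → Set
  State b g = Bounded (lo b) g × Bounded (lo (suc b)) (X+1 ⊗ g)

  -- The equation is kept in `wild` because there the bound for (1 + x + x²) f comes from the shape
  -- of f and not from its height.
  data StepBounds (h m : ℕ) (g f : Poly) : Set where
    tame : Bounded h f → StepBounds h m g f
    wild : f ≋ Φ₂ ⊗ ĝ g → ThreeBounds h m f → StepBounds h m g f

  step-bounds : ∀ {b g f} → State b g → Step g f → StepBounds (lo b) (lo (suc b)) g f
  step-bounds {g = g} (bg , bs) (step₁ e) = tame (Bounded-resp (≋-sym e) (Bounded-sub g 1<q bg))
  step-bounds {g = g} (bg , bs) (step₂ e) = tame (Bounded-resp (≋-sym e) (Bounded-Φ₁ g bg))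
  step-bounds {b} {g} (bg , bs) (step₃ e) = wild e (ThreeBounds-resp {lo b} {lo (suc b)} (≋-sym e) (Φ₂-bounds g (lo-≤-suc b) bg bs))
  step-bounds {g = g} (bg , bs) (step₄ e) = tame (Bounded-resp (≋-sym e) (Bounded-Φ₁Φ₂ g bg))

  lo+lo≤ : ∀ b → lo b ℕ.+ lo b ≤ lo (suc (suc b))
  lo+lo≤ b = ℕ.≤-reflexive (cong (lo b ℕ.+_) (≡.sym (ℕ.+-identityʳ (lo b))))

  state-step : ∀ b {g f} → StepBounds (lo b) (lo (suc b)) g f → State (suc b) f
  state-step b {f = f} (tame bf) = Bounded-mono {f = f} (lo-≤-suc b) bf , Bounded-mono {f = X+1 ⊗ f} (lo+lo≤ b) (Bounded-[X+1]⊗ f bf)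
  state-step b {f = f} (wild e (bf , bs , _)) = bf , Bounded-mono {f = X+1 ⊗ f} (lo-≤-suc (suc b)) bs

  state : ∀ b {g} → SubProduct (cofactors b) g → State b g
  state zero done = one , Bounded-mono {f = X+1 ⊗ 1ₚ} (s≤s z≤n) sum
    where
    one : Bounded 1 1ₚ
    one zero    = ℕ.≤-reflexive (cong ℤ.∣_∣ (coeff-C-zero 1ℤ))
    one (suc i) = subst (_≤ 1) (≡.sym (cong ℤ.∣_∣ (coeff-C-suc 1ℤ i))) z≤n
    sum : Bounded 1 (X+1 ⊗ 1ₚ)
    sum = Bounded-resp {f = 1ℤ ∷ 1ℤ ∷ []} (≋-trans (≋-sym X+1≋list) (solve 1 (λ x → x :+ con 1ℤ := (x :+ con 1ℤ) :* con 1ℤ) ≋-refl X))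
      λ { zero → s≤s z≤n ; (suc zero) → s≤s z≤n ; (suc (suc i)) → z≤n }
  state (suc b) s = state-step b (step-bounds {b} (state b (proj₁ (proj₂ (step b s)))) (proj₂ (proj₂ (step b s))))

  3lo : ℕ → ℕ
  3lo b = lo b ℕ.+ lo b ℕ.+ lo b

  -- In the wild case (1 + x + x²) f equals ((1 + x + x²) g)(x^q), whose height is at most three
  -- times that of g and is not raised by x - 1. In the tame case x³ - 1 has only two terms.
  step-factor-bound : ∀ b {g f} → State b g → StepBounds (lo b) (lo (suc b)) g f →
    Bounded (3lo b) f × Bounded (3lo b) (X²+X+1 ⊗ f) × Bounded (3lo b) (X-1 ⊗ f) × Bounded (3lo b) (X-1 ⊗ (X²+X+1 ⊗ f))
  step-factor-bound b {f = f} _ (tame bf) = Bounded-mono {f = f} (ℕ.≤-trans (ℕ.m≤m+n h h) (ℕ.m≤m+n (h ℕ.+ h) h)) bf , Bounded-[X²+X+1]⊗ f bf ,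
    Bounded-mono {f = X-1 ⊗ f} (ℕ.m≤m+n (h ℕ.+ h) h) (Bounded-[X-1]⊗ f bf) ,
    Bounded-mono {f = X-1 ⊗ (X²+X+1 ⊗ f)} (ℕ.m≤m+n (h ℕ.+ h) h)
      (Bounded-resp (solve 2 (λ x g → (x :* x :* x :+ con -1ℤ) :* g := (x :+ con -1ℤ) :* ((x :* x :+ x :+ con 1ℤ) :* g)) ≋-refl X f) (Bounded-[X³-1]⊗ f bf))
    where h = lo b
  step-factor-bound b {g} {f} (bg , _) (wild e (bf , _ , bd)) = Bounded-mono {f = f} (ℕ.≤-trans (lo-suc-≤ b) (ℕ.m≤m+n (lo b ℕ.+ lo b) (lo b))) bf ,
    Bounded-resp (≋-sym Ψf≋) (Bounded-sub (X²+X+1 ⊗ g) 1<q (Bounded-[X²+X+1]⊗ g bg)) , bd ,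
    Bounded-resp (⊗-congˡ X-1 (≋-sym Ψf≋)) (Bounded-difference-sub (X²+X+1 ⊗ g) 1<q (Bounded-[X²+X+1]⊗ g bg))
    where
    Ψf≋ : X²+X+1 ⊗ f ≋ ĝ (X²+X+1 ⊗ g)
    Ψf≋ = begin
      X²+X+1 ⊗ f              ≈⟨ ⊗-congˡ X²+X+1 e ⟩
      X²+X+1 ⊗ (Φ₂ ⊗ ĝ g)     ≈⟨ solve 3 (λ p f g → p :* (f :* g) := (f :* p) :* g) ≋-refl X²+X+1 Φ₂ (ĝ g) ⟩
      (Φ₂ ⊗ X²+X+1) ⊗ ĝ g     ≈⟨ ⊗-cong T₃-eq (≋-refl {ĝ g}) ⟩
      ĝ X²+X+1 ⊗ ĝ g          ≈⟨ ≋-sym (sub-⊗ (X ↑ q) X²+X+1 g) ⟩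
      ĝ (X²+X+1 ⊗ g)          ∎

  factor-bound : ∀ b → FactorBound (suc b) (3lo b)
  factor-bound b s = step-factor-bound b (state b (proj₁ (proj₂ (step b s)))) (step-bounds {b} (state b (proj₁ (proj₂ (step b s)))) (proj₂ (proj₂ (step b s))))

  separates : ∀ N → SeparatesAll N
  separates N c c≡ _ Ψ∣Z = separates-linear (sub (X ↑ N)) (euclid-0-or-prime q-prime c≡) X-1-monic , separates-quadratic N (euclid-0-or-prime q-prime c≡) (c∤3 c≡) X²+X+1-monic Ψ∣Z
    where
    c∤3 : ∀ {c} → c ≡ 0ℤ ⊎ c ≡ + q → ¬ c ∣ᶻ + 3
    c∤3 (inj₁ refl) d = contradiction (ℤ.0∣⇒≡0 d) λ ()
    c∤3 (inj₂ refl) d = ℕ.<⇒≱ 3<q (∣⇒≤ (ℤ.∣⇒∣ᵤ d))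

  -- Multiplying by Φ_q repeats every coefficient, and Φ_{3q} doubles a repeated coefficient.
  triple-step : ∀ b {n} g → 0 < n → SubProduct (cofactors b) g → HasCoeff n g → ∃[ f ] SubProduct (cofactors (suc b)) f × HasTriple n f
  triple-step b {n} g 0<n s c = raise (subProduct-map-sub⁻ (X ↑ q) s)
    where
    repeated : HasTriple n (Φ₁ ⊗ ĝ g)
    repeated = HasTriple-resp {n} {run (ones q) 0ℤ 0ℤ g} {Φ₁ ⊗ ĝ g} (run≋⟦⟧⊗ (ones q) (List.length-replicate q) g) (coeff⇒run-ones g 2<q 0<n c)
    raise : ∃[ g′ ] SubProduct (map ĝ (cofactors b)) g′ × g′ ≋ ĝ g → ∃[ f ] SubProduct (cofactors (suc b)) f × HasTriple n f
    raise (g′ , s′ , e) = Φ₁ ⊗ g′ , keep (drop s′) , HasTriple-resp {n} {Φ₁ ⊗ ĝ g} {Φ₁ ⊗ g′} (⊗-congˡ Φ₁ (≋-sym e)) repeated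

  double-step : ∀ b {n} g → 0 < n → SubProduct (cofactors b) g → HasTriple n g → ∃[ f ] SubProduct (cofactors (suc b)) f × HasCoeff (2 ℕ.* n) f
  double-step b {n} g 0<n s c = raise (subProduct-map-sub⁻ (X ↑ q) s)
    where
    doubled : HasCoeff (2 ℕ.* n) (Φ₂ ⊗ ĝ g)
    doubled = HasCoeff-resp {2 ℕ.* n} {run T₃ 0ℤ 0ℤ g} {Φ₂ ⊗ ĝ g} (run≋⟦⟧⊗ T₃ (≡.sym len₃) g) (triple⇒run T₃ r g r< doubles 0<n c)
    raise : ∃[ g′ ] SubProduct (map ĝ (cofactors b)) g′ × g′ ≋ ĝ g → ∃[ f ] SubProduct (cofactors (suc b)) f × HasCoeff (2 ℕ.* n) f
    raise (g′ , s′ , e) = Φ₂ ⊗ g′ , drop (keep s′) , HasCoeff-resp {2 ℕ.* n} {Φ₂ ⊗ ĝ g} {Φ₂ ⊗ g′} (⊗-congˡ Φ₂ (≋-sym e)) doubled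

  one-coeff : HasCoeff 1 1ₚ
  one-coeff = 0 , cong ℤ.∣_∣ (coeff-C-zero 1ℤ)

  triple : ∀ b → ∃[ f ] SubProduct (cofactors (suc b)) f × HasTriple (lo b) f
  triple zero          = triple-step 0 1ₚ (s≤s z≤n) (drop-all (cofactors 0)) one-coeff
  -- For odd b the chain starts with an idle step, multiplier 1, which loses nothing since `lo 1`
  -- equals `lo 0`.
  triple (suc zero)    = triple-step 1 1ₚ (s≤s z≤n) (drop-all (cofactors 1)) one-coeff
  triple (suc (suc b)) = triple-step (suc (suc b)) (proj₁ doubled) (0<lo (suc (suc b))) (proj₁ (proj₂ doubled)) (proj₂ (proj₂ doubled))
    where doubled = double-step (suc b) (proj₁ (triple b)) (0<lo b) (proj₁ (proj₂ (triple b))) (proj₂ (proj₂ (triple b)))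

  B≡3*lo : ∀ b → B[ 3 ℕ.* q ℕ.^ suc b ]≡ (3 ℕ.* lo b)
  B≡3*lo b = subst (B[ 3 ℕ.* q ℕ.^ suc b ]≡_) 3lo≡ (B-intro (suc b) (3lo b) (factor-bound b) separates (drop (keep (proj₁ (proj₂ (triple b))))) (proj₁ large)
    (ℕ.≤-reflexive (≡.trans 3lo≡ (≡.sym (proj₂ large)))))
    where
    large = triple⇒X²+X+1⊗ (proj₂ (proj₂ (triple b)))
    3lo≡ : 3lo b ≡ 3 ℕ.* lo b
    3lo≡ = ≡.trans (ℕ.+-assoc (lo b) (lo b) (lo b)) (cong (λ z → lo b ℕ.+ (lo b ℕ.+ z)) (≡.sym (ℕ.+-identityʳ (lo b))))

-- Residues of q modulo 2 and 3, and the theorem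

odd-prime : ∀ {q} → Prime q → 2 < q → ∃[ t ] q ≡ suc (t ℕ.* 2)
odd-prime {q} pr 2<q with q % 2 | m≡m%n+[m/n]*n q 2 | m%n<n q 2
... | zero        | e | _ = contradiction e (prime⇒∤ pr (s≤s (s≤s z≤n)) 2<q (q / 2))
... | suc zero    | e | _ = q / 2 , e
... | suc (suc _) | _ | s≤s (s≤s ())

B[2qᵇ]≡2 : ∀ {q} → Prime q → 2 < q → ∀ b → B[ 2 ℕ.* q ℕ.^ suc b ]≡ 2
B[2qᵇ]≡2 pr 2<q b with odd-prime pr 2<q
... | zero  , refl = contradiction pr ¬prime[1]
... | suc t , e    = TwoCase.B≡2 t pr e b

B[3qᵇ]≡3*lo : ∀ {q} → Prime q → 3 < q → ∀ b → B[ 3 ℕ.* q ℕ.^ suc b ]≡ (3 ℕ.* lo b)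
B[3qᵇ]≡3*lo {q} pr 3<q b with q % 3 | q / 3 | m≡m%n+[m/n]*n q 3 | m%n<n q 3 | odd-prime pr (ℕ.<-trans (ℕ.n<1+n 2) 3<q)
... | zero              | t     | e | _ | _     = contradiction e (prime⇒∤ pr (s≤s (s≤s z≤n)) 3<q t)
... | suc zero          | zero  | e | _ | _     = contradiction (subst Prime e pr) ¬prime[1]
... | suc zero          | suc t | e | _ | u , o = ThreeCase.B≡3*lo u pr 3<q o (cycle₁ (suc t)) (select₃₁ (suc t))
    len (⟦cycle₁⟧ (suc t) len) len′ (select₃₁-selecting (suc t)) (⟦select₃₁⟧ (suc t) len′)
    -- The offset 1 is that of the first entry -(gₛ + gₛ₋₁) of `cycle₁`; in `cycle₂` the sum gₛ +
    -- gₛ₋₁ stands at offset 0.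
    (λ g h≤m bg bs → adj-Out _ (adj-run₁ h≤m (suc t) g (adj-In g bg bs))) 1 (s≤s (s≤s z≤n))
    (λ a c → ≡.trans (cong ℤ.∣_∣ (combine--1-10 a a c)) (≡.trans (ℤ.∣-i∣≡∣i∣ (a ℤ.+ a)) (∣a+a∣ a))) b
  where
  len = ≡.trans e (≡.sym (length-cycle₁ (suc t)))
  len′ = ≡.trans e (≡.sym (length-select₃₁ (suc t)))
... | suc (suc zero)    | t     | e | _ | u , o = ThreeCase.B≡3*lo u pr 3<q o (cycle₂ t) (select₃₂ t)
    len (⟦cycle₂⟧ t len) len′ (select₃₂-selecting t) (⟦select₃₂⟧ t len′)
    (λ g h≤m bg bs → adj-Out _ (adj-run₂ h≤m t g (adj-In g bg bs))) 0 (ℕ.≤-trans (s≤s z≤n) (ℕ.≤-reflexive (≡.sym (length-cycle₂ t))))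
    (λ a c → ≡.trans (cong ℤ.∣_∣ (head t a c)) (∣a+a∣ a)) b
  where
  len = ≡.trans e (≡.sym (length-cycle₂ t))
  len′ = ≡.trans e (≡.sym (length-select₃₂ t))
  head : ∀ t a c → coeff (block (cycle₂ t) a a c) 0 ≡ a ℤ.+ a
  head zero    a c = combine-110 a a c
  head (suc t) a c = combine-110 a a c
... | suc (suc (suc _)) | _     | _ | s≤s (s≤s (s≤s ())) | _

theorem1p5 : (p q : ℕ) → Prime p → Prime q → p < q →
    (b : ℕ) → 1 ≤ b →
    (p ≡ 2 → B[ p * q ^ b ]≡ 2)
    × (p ≡ 3 → B[ p * q ^ b ]≡ (3 * 2 ^ ((b ∸ 1) / 2)))
theorem1p5 p q _ q-prime p<q (suc b) _ =
  (λ { refl → B[2qᵇ]≡2 q-prime p<q b }) ,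
  (λ { refl → subst (λ n → B[ 3 * q ^ suc b ]≡ (3 * n)) (lo≡2^ b) (B[3qᵇ]≡3*lo q-prime p<q b) })
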